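{- Let $p\ge3$ and $\ell\ge5$ be distinct primes with $p^2\mid N$, $\ell\nmid N$, and suppose the inertial type at $p$ is non-exceptional supercuspidal with $K/\mathbb{Q}_p$ unramified (with $f$, $N$, $\bar\rho$, $K$ as in the context). Then: (i) if $p\not\equiv\pm1\pmod\ell$, then $\dim_\kappa H^0(G_p,\bar\varepsilon_\ell\otimes\mathrm{ad}^0\bar\rho)=0$; (ii) if $p\equiv-1\pmod\ell$, then $\dim_\kappa H^0(G_p,\bar\varepsilon_\ell\otimes\mathrm{ad}^0\bar\rho)=1$, generated by the class corresponding to $\varepsilon_K$ in the $(\bar\varepsilon_\ell\cdot\varepsilon_K)$-summand of $\bar\varepsilon_\ell\otimes\mathrm{ad}^0\bar\rho|_{G_p}$; (iii) if $p\equiv1\pmod\ell$, then $\dim_\kappa H^0(G_p,\bar\varepsilon_\ell\otimes\mathrm{ad}^0\bar\rho)=0$.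
   Context: $f$ is a normalized weight $2$ newform of level $N$ corresponding to an elliptic curve $E_f/\mathbb{Q}$ of conductor $N$, $\kappa$ is a finite field of characteristic $\ell$, $S$ is a finite set of places of $\mathbb{Q}$ containing $\infty$ and the primes dividing $N\ell$, and $\bar\rho:G_{\mathbb{Q},S}\to\mathrm{GL}_2(\kappa)$ is the residual representation attached to $f$. Throughout: $\bar\rho$ is odd, continuous and absolutely irreducible, $f$ is ordinary at $\ell$ ($a_\ell(f)\not\equiv0\bmod\ell$), and the deformation problem for $\bar\rho$ is minimally ramified at all primes dividing $N$; at a prime $p$ of supercuspidal type this means that deformations restricted to $G_p$ are of the form $\mathrm{Ind}_{G_K}^{G_p}\chi$ with $\chi$ a lift of $\bar\chi$ (below) of the same conductor exponent. $G_p\supseteq I_p$ are decomposition and inertia groups at $p$, $\mathrm{Frob}_p$ is arithmetic Frobenius; $\bar\varepsilon_\ell$ is the mod $\ell$ cyclotomic character; $\mathrm{ad}^0\bar\rho$ is the space of trace-zero $2\times2$ matrices over $\kappa$ with conjugation action via $\bar\rho$. $E_f$ has additive, potentially good reduction at $p$. $\tau_{\mathrm{sc},p}(d,c,r)$ denotes the inertial type of $\mathrm{Ind}_{G_K}^{G_p}\chi$ with $K=\mathbb{Q}_p(\sqrt d)$, $\chi$ of conductor exponent $c$ and order $r$ on $I_K$. The types with $K$ unramified are: for $p\ge5$, $\tau_{\mathrm{sc},p}(u,1,e)$ with $u$ a non-square unit, $e\in\{3,4,6\}$, $e\mid p+1$; for $p=3$, $\tau_{\mathrm{sc},3}(-1,1,4)$,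 $\tau_{\mathrm{sc},3}(-1,2,3)$ and $\tau_{\mathrm{sc},3}(-1,2,3)\otimes\varepsilon_3$, with $\varepsilon_3$ the quadratic character of $\mathbb{Q}_3(\sqrt3)/\mathbb{Q}_3$. Residually $\bar\rho|_{G_p}\cong\mathrm{Ind}_{G_K}^{G_p}\bar\chi$ with $\bar\chi\ne\bar\chi^s$, $\bar\chi^s(g)=\bar\chi(\mathrm{Frob}_p^{ -1}g\,\mathrm{Frob}_p)$. $\varepsilon_K$ is the quadratic character of $G_p$ attached to $K/\mathbb{Q}_p$ (so $\varepsilon_K|_{I_p}=1$, $\varepsilon_K(\mathrm{Frob}_p)=-1$), and $$\bar\varepsilon_\ell\otimes\mathrm{ad}^0\bar\rho|_{G_p}\cong(\bar\varepsilon_\ell\cdot\varepsilon_K)\oplus(\bar\varepsilon_\ell\otimes\mathrm{Ind}_{G_K}^{G_p}\bar\psi),\qquad \bar\psi=\bar\chi/\bar\chi^s.$$ -}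

module Defs where

open import Level using (0ℓ)
open import Algebra.Bundles using (CommutativeRing; Group; RawRing)
open import Algebra.Morphism.Structures using (IsRingHomomorphism; IsRingIsomorphism; IsMonoidHomomorphism)
import Algebra.Morphism.Construct.Composition as Composition
import Algebra.Morphism.Construct.Identity as Identity
open import Algebra.Module.Bundles using (LeftModule)
open import Algebra.Module.Morphism.Structures using (IsLeftModuleIsomorphism)
import Algebra.Module.Construct.TensorUnit as TensorUnit
import Algebra.Module.Construct.DirectProduct as DirectProduct
import Algebra.Definitions.RawSemiring as RawSemiringDefs
import Algebra.Properties.Semiring.Sum as SemiringSum
import Algebra.Properties.CommutativeMonoid.Sum as MonoidSum
import Algebra.Properties.Ring as RingProperties
import Algebra.Properties.Group as GroupProperties
import Relation.Binary.Reasoning.Setoid as SetoidReasoning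
import Data.List.Membership.Setoid as SetoidMembership
open import Data.Bool.Base using (Bool; true; false; if_then_else_)
open import Data.Nat.Base as ℕ using (ℕ; zero; suc)
import Data.Nat.Divisibility as ℕ
open import Data.Nat.Primality using (Prime)
open import Data.Nat.Coprimality using (Coprime)
open import Data.Integer.Base as Int using (ℤ; +_; -[1+_])
open import Data.Integer.Divisibility using () renaming (_∣_ to _∣ℤ_)
open import Data.Rational.Base as Rat using (ℚ; 0ℚ)
open import Data.Fin.Base using (Fin; zero; suc)
open import Data.Fin.Properties using (_≟_)
open import Data.List.Base using (List; []; _∷_; _++_; [_]; map; upTo; applyUpTo; cartesianProduct; filter; length)
import Data.Nat.ListAction as List
open import Data.List.Relation.Unary.All using (All)
open import Data.List.Relation.Unary.Any using (Any)
open import Data.List.Membership.Propositional using (_∈_)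
open import Data.Product.Base using (Σ; ∃; ∃₂; _×_; _,_; proj₁; proj₂)
open import Data.Sum.Base using (_⊎_; inj₁; inj₂)
open import Data.Unit.Base using (⊤)
open import Function.Base using (_∘_)
open import Relation.Nullary using (¬_; does)
open import Relation.Binary.PropositionalEquality.Core as ≡ using (_≡_; _≢_)

Ring₀ : Set₁
Ring₀ = CommutativeRing 0ℓ 0ℓ

Group₀ : Set₁
Group₀ = Group 0ℓ 0ℓ

module _ (R : Ring₀) where
  open CommutativeRing R

  infixr 8 _^ʳ_
  _^ʳ_ : Carrier → ℕ → Carrier
  _^ʳ_ = RawSemiringDefs._^_ (RawRing.rawSemiring (CommutativeRing.rawRing R))

  fromℕ : ℕ → Carrier
  fromℕ n = RawSemiringDefs._×_ (RawRing.rawSemiring (CommutativeRing.rawRing R)) n 1#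

  fromℤ : ℤ → Carrier
  fromℤ (+ n)    = fromℕ n
  fromℤ -[1+ n ] = - fromℕ (suc n)

  -- Coefficients are listed from the constant term upwards.
  eval : List Carrier → Carrier → Carrier
  eval []       x = 0#
  eval (c ∷ cs) x = c + x * eval cs x

  record IsField : Set where
    field
      1≉0       : ¬ 1# ≈ 0#
      zero⊎unit : ∀ x → x ≈ 0# ⊎ ∃ λ y → x * y ≈ 1#

  IsFinite : Set
  IsFinite = ∃ λ n → Σ (Fin n → Carrier) λ e → ∀ x → ∃ λ i → e i ≈ x

Hom : (R S : Ring₀) → (CommutativeRing.Carrier R → CommutativeRing.Carrier S) → Set
Hom R S = IsRingHomomorphism (CommutativeRing.rawRing R) (CommutativeRing.rawRing S)

record Subgroup (G : Group₀) : Set₁ where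
  open Group G
  field
    Member   : Carrier → Set
    resp     : ∀ {x y} → x ≈ y → Member x → Member y
    ε-mem    : Member ε
    ∙-mem    : ∀ {x y} → Member x → Member y → Member (x ∙ y)
    ⁻¹-mem   : ∀ {x} → Member x → Member (x ⁻¹)

  group : Group₀
  group = record
    { Carrier = Σ Carrier Member
    ; _≈_     = λ x y → proj₁ x ≈ proj₁ y
    ; _∙_     = λ (x , m) (y , n) → x ∙ y , ∙-mem m n
    ; ε       = ε , ε-mem
    ; _⁻¹     = λ (x , m) → x ⁻¹ , ⁻¹-mem m
    ; isGroup = record
      { isMonoid = record
        { isSemigroup = record
          { isMagma = record
            { isEquivalence = record { refl = refl ; sym = sym ; trans = trans }
            ; ∙-cong        = ∙-cong
            }
          ; assoc = λ (x , _) (y , _) (z , _) → assoc x y z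
          }
        ; identity = (λ (x , _) → identityˡ x) , (λ (x , _) → identityʳ x)
        }
      ; inverse = (λ (x , _) → inverseˡ x) , (λ (x , _) → inverseʳ x)
      ; ⁻¹-cong = ⁻¹-cong
      }
    }

module Linear (R : Ring₀) where
  Mod : Set₁
  Mod = LeftModule (CommutativeRing.ring R) 0ℓ 0ℓ

  scalars : Mod
  scalars = TensorUnit.leftModule {R = CommutativeRing.ring R}

  infixr 8 _^ᴹ_
  _^ᴹ_ : Mod → Set → Mod
  M ^ᴹ I = record
    { Carrierᴹ = I → Carrierᴹ
    ; _≈ᴹ_     = λ f g → ∀ i → f i ≈ᴹ g i
    ; _+ᴹ_     = λ f g i → f i +ᴹ g i
    ; _*ₗ_     = λ r f i → r *ₗ f i
    ; 0ᴹ       = λ _ → 0ᴹ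
    ; -ᴹ_      = λ f i → -ᴹ f i
    ; isLeftModule = record
      { isLeftSemimodule = record
        { +ᴹ-isCommutativeMonoid = record
          { isMonoid = record
            { isSemigroup = record
              { isMagma = record
                { isEquivalence = record
                  { refl  = λ _ → ≈ᴹ-refl
                  ; sym   = λ p i → ≈ᴹ-sym (p i)
                  ; trans = λ p q i → ≈ᴹ-trans (p i) (q i)
                  }
                ; ∙-cong = λ p q i → +ᴹ-cong (p i) (q i)
                }
              ; assoc = λ f g h i → +ᴹ-assoc (f i) (g i) (h i)
              }
            ; identity = (λ f i → +ᴹ-identityˡ (f i)) , (λ f i → +ᴹ-identityʳ (f i))
            }
          ; comm = λ f g i → +ᴹ-comm (f i) (g i)
          }
        ; isPreleftSemimodule = record
          { *ₗ-cong      = λ p q i → *ₗ-cong p (q i)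
          ; *ₗ-zeroˡ     = λ f i → *ₗ-zeroˡ (f i)
          ; *ₗ-distribʳ  = λ f r s i → *ₗ-distribʳ (f i) r s
          ; *ₗ-identityˡ = λ f i → *ₗ-identityˡ (f i)
          ; *ₗ-assoc     = λ r s f i → *ₗ-assoc r s (f i)
          ; *ₗ-zeroʳ     = λ r i → *ₗ-zeroʳ r
          ; *ₗ-distribˡ  = λ r f g i → *ₗ-distribˡ r (f i) (g i)
          }
        }
      ; -ᴹ‿cong    = λ p i → -ᴹ‿cong (p i)
      ; -ᴹ‿inverse = (λ f i → -ᴹ‿inverseˡ (f i)) , (λ f i → -ᴹ‿inverseʳ (f i))
      }
    }
    where open LeftModule M

  record Submodule (M : Mod) : Set₁ where
    open LeftModule M
    field
      Member : Carrierᴹ → Set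
      0-mem  : Member 0ᴹ
      +-mem  : ∀ {x y} → Member x → Member y → Member (x +ᴹ y)
      *-mem  : ∀ r {x} → Member x → Member (r *ₗ x)
      neg-mem : ∀ {x} → Member x → Member (-ᴹ x)

    leftModule : Mod
    leftModule = record
      { Carrierᴹ = Σ Carrierᴹ Member
      ; _≈ᴹ_     = λ x y → proj₁ x ≈ᴹ proj₁ y
      ; _+ᴹ_     = λ (x , m) (y , n) → x +ᴹ y , +-mem m n
      ; _*ₗ_     = λ r (x , m) → r *ₗ x , *-mem r m
      ; 0ᴹ       = 0ᴹ , 0-mem
      ; -ᴹ_      = λ (x , m) → -ᴹ x , neg-mem m
      ; isLeftModule = record
        { isLeftSemimodule = record
          { +ᴹ-isCommutativeMonoid = record
            { isMonoid = record
              { isSemigroup = record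
                { isMagma = record
                  { isEquivalence = record { refl = ≈ᴹ-refl ; sym = ≈ᴹ-sym ; trans = ≈ᴹ-trans }
                  ; ∙-cong        = +ᴹ-cong
                  }
                ; assoc = λ (x , _) (y , _) (z , _) → +ᴹ-assoc x y z
                }
              ; identity = (λ (x , _) → +ᴹ-identityˡ x) , (λ (x , _) → +ᴹ-identityʳ x)
              }
            ; comm = λ (x , _) (y , _) → +ᴹ-comm x y
            }
          ; isPreleftSemimodule = record
            { *ₗ-cong      = *ₗ-cong
            ; *ₗ-zeroˡ     = λ (x , _) → *ₗ-zeroˡ x
            ; *ₗ-distribʳ  = λ (x , _) r s → *ₗ-distribʳ x r s
            ; *ₗ-identityˡ = λ (x , _) → *ₗ-identityˡ x
            ; *ₗ-assoc     = λ r s (x , _) → *ₗ-assoc r s x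
            ; *ₗ-zeroʳ     = *ₗ-zeroʳ
            ; *ₗ-distribˡ  = λ r (x , _) (y , _) → *ₗ-distribˡ r x y
            }
          }
        ; -ᴹ‿cong    = -ᴹ‿cong
        ; -ᴹ‿inverse = (λ (x , _) → -ᴹ‿inverseˡ x) , (λ (x , _) → -ᴹ‿inverseʳ x)
        }
      }

  module _ (M : Mod) where
    open CommutativeRing R using (Carrier; _≈_; 0#)
    open LeftModule M

    combination : ∀ {n} → (Fin n → Carrier) → (Fin n → Carrierᴹ) → Carrierᴹ
    combination c b = MonoidSum.sum +ᴹ-commutativeMonoid (λ i → c i *ₗ b i)

    record IsBasis (P : Carrierᴹ → Set) {n : ℕ} (b : Fin n → Carrierᴹ) : Set where
      field
        members     : ∀ i → P (b i)
        independent : ∀ c → combination c b ≈ᴹ 0ᴹ → ∀ i → c i ≈ 0#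
        spanning    : ∀ v → P v → ∃ λ c → v ≈ᴹ combination c b

    HasDimension : (Carrierᴹ → Set) → ℕ → Set
    HasDimension P n = ∃ λ (b : Fin n → Carrierᴹ) → IsBasis P b

module Matrix (R : Ring₀) where
  open CommutativeRing R hiding (zero)
  open SemiringSum semiring
    using (sum; sum-cong-≋; ∑-comm; ∑-distrib-+; *-distribˡ-sum; *-distribʳ-sum; sum-replicate-zero)

  Mat : ℕ → Set
  Mat n = Fin n → Fin n → Carrier

  infix 4 _≈ₘ_
  _≈ₘ_ : ∀ {n} → Mat n → Mat n → Set
  A ≈ₘ B = ∀ i j → A i j ≈ B i j

  infixl 7 _·_ _·ᵛ_
  _·_ : ∀ {n} → Mat n → Mat n → Mat n
  (A · B) i j = sum (λ k → A i k * B k j)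

  _·ᵛ_ : ∀ {n} → Mat n → (Fin n → Carrier) → (Fin n → Carrier)
  (A ·ᵛ v) i = sum (λ k → A i k * v k)

  1ₘ : ∀ {n} → Mat n
  1ₘ i j = if does (i ≟ j) then 1# else 0#

  tr : ∀ {n} → Mat n → Carrier
  tr A = sum (λ i → A i i)

  det₂ : Mat 2 → Carrier
  det₂ A = A zero zero * A (suc zero) (suc zero) - A zero (suc zero) * A (suc zero) zero

  private
    sum-0 : ∀ {n} (f : Fin n → Carrier) → (∀ k → f k ≈ 0#) → sum f ≈ 0#
    sum-0 {n} f p = trans (sum-cong-≋ {n} p) (sum-replicate-zero n)

  1ₘ-sumˡ : ∀ {n} (i : Fin n) (v : Fin n → Carrier) → sum (λ k → 1ₘ i k * v k) ≈ v i
  1ₘ-sumˡ {suc n} zero v = trans (+-cong (*-identityˡ _) (sum-0 {n} _ λ k → zeroˡ _)) (+-identityʳ _)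
  1ₘ-sumˡ (suc i) v = trans (+-cong (zeroˡ _) (1ₘ-sumˡ i (v ∘ suc))) (+-identityˡ _)

  1ₘ-sumʳ : ∀ {n} (j : Fin n) (v : Fin n → Carrier) → sum (λ k → v k * 1ₘ k j) ≈ v j
  1ₘ-sumʳ {suc n} zero v = trans (+-cong (*-identityʳ _) (sum-0 {n} _ λ k → zeroʳ _)) (+-identityʳ _)
  1ₘ-sumʳ (suc j) v = trans (+-cong (zeroʳ _) (1ₘ-sumʳ j (v ∘ suc))) (+-identityˡ _)

  sum-assoc : ∀ {n} (u : Fin n → Carrier) (B : Mat n) (v : Fin n → Carrier) →
              sum (λ k → sum (λ j → u j * B j k) * v k) ≈ sum (λ j → u j * sum (λ k → B j k * v k))
  sum-assoc {n} u B v = trans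
    (sum-cong-≋ {n} λ k → *-distribʳ-sum {n} (v k) _)
    (trans (∑-comm {n} {n} _)
      (sum-cong-≋ {n} λ j →
        trans (sum-cong-≋ {n} λ k → *-assoc _ _ _) (sym (*-distribˡ-sum {n} (u j) _))))

  sum-* : ∀ {n} r (u v : Fin n → Carrier) → sum (λ k → u k * (r * v k)) ≈ r * sum (λ k → u k * v k)
  sum-* {n} r u v = trans
    (sum-cong-≋ {n} λ k → trans (sym (*-assoc _ _ _)) (trans (*-congʳ (*-comm _ _)) (*-assoc _ _ _)))
    (sym (*-distribˡ-sum {n} r _))

  sum-+ : ∀ {n} (u v w : Fin n → Carrier) →
          sum (λ k → u k * (v k + w k)) ≈ sum (λ k → u k * v k) + sum (λ k → u k * w k)
  sum-+ {n} u v w = trans (sum-cong-≋ {n} λ k → distribˡ _ _ _) (∑-distrib-+ {n} _ _)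

  sum-*ˡ : ∀ {n} r (u v : Fin n → Carrier) → sum (λ k → (r * u k) * v k) ≈ r * sum (λ k → u k * v k)
  sum-*ˡ {n} r u v = trans (sum-cong-≋ {n} λ k → *-assoc _ _ _) (sym (*-distribˡ-sum {n} r _))

  sum-+ˡ : ∀ {n} (u v w : Fin n → Carrier) →
           sum (λ k → (u k + v k) * w k) ≈ sum (λ k → u k * w k) + sum (λ k → v k * w k)
  sum-+ˡ {n} u v w = trans (sum-cong-≋ {n} λ k → distribʳ _ _ _) (∑-distrib-+ {n} _ _)

  ·-assoc : ∀ {n} (A B C : Mat n) → (A · B) · C ≈ₘ A · (B · C)
  ·-assoc A B C i j = sum-assoc (A i) B (λ k → C k j)

  ·-cong : ∀ {n} {A B C D : Mat n} → A ≈ₘ B → C ≈ₘ D → A · C ≈ₘ B · D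
  ·-cong {n} p q i j = sum-cong-≋ {n} λ k → *-cong (p i k) (q k j)

  1ₘ-identityˡ : ∀ {n} (A : Mat n) → 1ₘ · A ≈ₘ A
  1ₘ-identityˡ A i j = 1ₘ-sumˡ i (λ k → A k j)

  1ₘ-identityʳ : ∀ {n} (A : Mat n) → A · 1ₘ ≈ₘ A
  1ₘ-identityʳ A i j = 1ₘ-sumʳ j (A i)

  tr-cong : ∀ {n} {A B : Mat n} → A ≈ₘ B → tr A ≈ tr B
  tr-cong {n} p = sum-cong-≋ {n} λ i → p i i

  tr-comm : ∀ {n} (A B : Mat n) → tr (A · B) ≈ tr (B · A)
  tr-comm {n} A B = trans (∑-comm {n} {n} _) (sum-cong-≋ {n} λ k → sum-cong-≋ {n} λ i → *-comm _ _)

  ≈ₘ-refl : ∀ {n} {A : Mat n} → A ≈ₘ A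
  ≈ₘ-refl i j = refl

  ≈ₘ-sym : ∀ {n} {A B : Mat n} → A ≈ₘ B → B ≈ₘ A
  ≈ₘ-sym p i j = sym (p i j)

  ≈ₘ-trans : ∀ {n} {A B C : Mat n} → A ≈ₘ B → B ≈ₘ C → A ≈ₘ C
  ≈ₘ-trans p q i j = trans (p i j) (q i j)

record Rep (G : Group₀) (R : Ring₀) : Set₁ where
  private module G = Group G
  open CommutativeRing R using (Carrier)
  field
    space : Linear.Mod R
  open LeftModule space public
  field
    act      : G.Carrier → Carrierᴹ → Carrierᴹ
    act-cong : ∀ {g h v w} → g G.≈ h → v ≈ᴹ w → act g v ≈ᴹ act h w
    act-+    : ∀ g v w → act g (v +ᴹ w) ≈ᴹ act g v +ᴹ act g w
    act-*    : ∀ g r v → act g (r *ₗ v) ≈ᴹ r *ₗ act g v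
    act-ε    : ∀ v → act G.ε v ≈ᴹ v
    act-∙    : ∀ g h v → act (g G.∙ h) v ≈ᴹ act g (act h v)

  H⁰ : Carrierᴹ → Set
  H⁰ v = ∀ g → act g v ≈ᴹ v

record _≅_ {G : Group₀} {R : Ring₀} (V W : Rep G R) : Set where
  private
    module V = Rep V
    module W = Rep W
  field
    to                    : V.Carrierᴹ → W.Carrierᴹ
    isLeftModuleIsomorphism : IsLeftModuleIsomorphism V.rawLeftModule W.rawLeftModule to
    equivariant           : ∀ g v → to (V.act g v) W.≈ᴹ W.act g (to v)
infix 4 _≅_

infixr 6 _⊕_
_⊕_ : ∀ {G R} → Rep G R → Rep G R → Rep G R
V ⊕ W = record
  { space    = DirectProduct.leftModule V.space W.space
  ; act      = λ g (v , w) → V.act g v , W.act g w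
  ; act-cong = λ p (q , r) → V.act-cong p q , W.act-cong p r
  ; act-+    = λ g (v , w) (v′ , w′) → V.act-+ g v v′ , W.act-+ g w w′
  ; act-*    = λ g r (v , w) → V.act-* g r v , W.act-* g r w
  ; act-ε    = λ (v , w) → V.act-ε v , W.act-ε w
  ; act-∙    = λ g h (v , w) → V.act-∙ g h v , W.act-∙ g h w
  }
  where
  module V = Rep V
  module W = Rep W

-- A homomorphism to the multiplicative monoid of R automatically takes values
-- in the unit group.
record Character (G : Group₀) (R : Ring₀) : Set where
  private module R = CommutativeRing R
  field
    at  : Group.Carrier G → R.Carrier
    hom : IsMonoidHomomorphism (Group.rawMonoid G) (RawRing.*-rawMonoid R.rawRing) at
  open IsMonoidHomomorphism hom public
open Character public using (at)

module _ {G : Group₀} {R : Ring₀} where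
  private
    module G = Group G
    module R = CommutativeRing R
  open R using (_*_; ring)
  open Linear R using (scalars; _^ᴹ_; Submodule; module Submodule)

  interchange : ∀ a b c d → (a * b) * (c * d) R.≈ (a * c) * (b * d)
  interchange a b c d = begin
    (a * b) * (c * d)  ≈⟨ R.*-assoc a b (c * d) ⟩
    a * (b * (c * d))  ≈⟨ R.*-congˡ (R.*-assoc b c d) ⟨
    a * ((b * c) * d)  ≈⟨ R.*-congˡ (R.*-congʳ (R.*-comm b c)) ⟩
    a * ((c * b) * d)  ≈⟨ R.*-congˡ (R.*-assoc c b d) ⟩
    a * (c * (b * d))  ≈⟨ R.*-assoc a c (b * d) ⟨
    (a * c) * (b * d)  ∎
    where open SetoidReasoning R.setoid

  infixl 7 _·ᶜ_
  _·ᶜ_ : Character G R → Character G R → Character G R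
  α ·ᶜ β = record
    { at  = λ g → at α g * at β g
    ; hom = record
      { isMagmaHomomorphism = record
        { isRelHomomorphism = record { cong = λ p → R.*-cong (α.⟦⟧-cong p) (β.⟦⟧-cong p) }
        ; homo = λ g h → R.trans (R.*-cong (α.homo g h) (β.homo g h)) (interchange _ _ _ _)
        }
      ; ε-homo = R.trans (R.*-cong α.ε-homo β.ε-homo) (R.*-identityˡ _)
      }
    }
    where
    module α = Character α
    module β = Character β

  inverseᶜ : Character G R → Character G R
  inverseᶜ α = record
    { at  = λ g → at α (g G.⁻¹)
    ; hom = record
      { isMagmaHomomorphism = record
        { isRelHomomorphism = record { cong = λ p → α.⟦⟧-cong (G.⁻¹-cong p) }
        ; homo = λ g h → R.trans (α.⟦⟧-cong (GroupProperties.⁻¹-anti-homo-∙ G g h))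
                          (R.trans (α.homo _ _) (R.*-comm _ _))
        }
      ; ε-homo = R.trans (α.⟦⟧-cong (GroupProperties.ε⁻¹≈ε G)) α.ε-homo
      }
    }
    where module α = Character α

  infixl 7 _/ᶜ_
  _/ᶜ_ : Character G R → Character G R → Character G R
  α /ᶜ β = α ·ᶜ inverseᶜ β

  line : Character G R → Rep G R
  line α = record
    { space    = scalars
    ; act      = λ g v → at α g * v
    ; act-cong = λ p q → R.*-cong (α.⟦⟧-cong p) q
    ; act-+    = λ g v w → R.distribˡ _ v w
    ; act-*    = λ g r v → R.trans (R.sym (R.*-assoc _ _ _)) (R.trans (R.*-congʳ (R.*-comm _ _)) (R.*-assoc _ _ _))
    ; act-ε    = λ v → R.trans (R.*-congʳ α.ε-homo) (R.*-identityˡ v)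
    ; act-∙    = λ g h v → R.trans (R.*-congʳ (α.homo g h)) (R.*-assoc _ _ _)
    }
    where module α = Character α

  infixr 7 _⊗_
  _⊗_ : Character G R → Rep G R → Rep G R
  α ⊗ V = record
    { space    = space
    ; act      = λ g v → at α g *ₗ act g v
    ; act-cong = λ p q → *ₗ-cong (α.⟦⟧-cong p) (act-cong p q)
    ; act-+    = λ g v w → ≈ᴹ-trans (*ₗ-congˡ (act-+ g v w)) (*ₗ-distribˡ _ _ _)
    ; act-*    = λ g r v → ≈ᴹ-trans (*ₗ-congˡ (act-* g r v)) (swap _ _ _)
    ; act-ε    = λ v → ≈ᴹ-trans (*ₗ-cong α.ε-homo (act-ε v)) (*ₗ-identityˡ v)
    ; act-∙    = λ g h v → ≈ᴹ-trans (*ₗ-cong (α.homo g h) (act-∙ g h v))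
                   (≈ᴹ-trans (*ₗ-assoc _ _ _) (*ₗ-congˡ (≈ᴹ-sym (act-* g _ _))))
    }
    where
    module α = Character α
    open Rep V
    swap : ∀ r s v → r *ₗ s *ₗ v ≈ᴹ s *ₗ r *ₗ v
    swap r s v = ≈ᴹ-trans (≈ᴹ-sym (*ₗ-assoc r s v)) (≈ᴹ-trans (*ₗ-congʳ (R.*-comm r s)) (*ₗ-assoc s r v))

  -- Functions f : G → R with f (h ∙ x) = χ h * f x for h ∈ H, acted on by right
  -- translation.
  Ind : (H : Subgroup G) → Character (Subgroup.group H) R → Rep G R
  Ind H χ = record
    { space    = Submodule.leftModule equivariants
    ; act      = λ g (f , f-cong , f-eq) →
                   (λ x → f (x G.∙ g)) ,
                   (λ p → f-cong (G.∙-congʳ p)) ,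
                   (λ h x → R.trans (f-cong (G.assoc _ _ _)) (f-eq h (x G.∙ g)))
    ; act-cong = λ {g} {h} {v} p q x → R.trans (proj₁ (proj₂ v) (G.∙-congˡ p)) (q (x G.∙ h))
    ; act-+    = λ g v w x → R.refl
    ; act-*    = λ g r v x → R.refl
    ; act-ε    = λ (f , f-cong , _) x → f-cong (G.identityʳ x)
    ; act-∙    = λ g h (f , f-cong , _) x → f-cong (G.sym (G.assoc x g h))
    }
    where
    open RingProperties ring using (-‿distribʳ-*)
    equivariants : Submodule (scalars ^ᴹ G.Carrier)
    equivariants = record
      { Member = λ f → (∀ {x y} → x G.≈ y → f x R.≈ f y)
                     × (∀ h x → f (proj₁ h G.∙ x) R.≈ at χ h * f x)
      ; 0-mem  = (λ _ → R.refl) , (λ h x → R.sym (R.zeroʳ _))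
      ; +-mem  = λ (c , e) (c′ , e′) →
                   (λ p → R.+-cong (c p) (c′ p)) ,
                   (λ h x → R.trans (R.+-cong (e h x) (e′ h x)) (R.sym (R.distribˡ _ _ _)))
      ; *-mem  = λ r (c , e) →
                   (λ p → R.*-congˡ (c p)) ,
                   (λ h x → R.trans (R.*-congˡ (e h x)) (R.trans (R.sym (R.*-assoc _ _ _))
                              (R.trans (R.*-congʳ (R.*-comm _ _)) (R.*-assoc _ _ _))))
      ; neg-mem = λ (c , e) →
                   (λ p → R.-‿cong (c p)) ,
                   (λ h x → R.trans (R.-‿cong (e h x)) (-‿distribʳ-* _ _))
      }

-- A homomorphism G → GLₙ(R): multiplicativity on a group makes every value
-- an invertible matrix.
record MatRep (n : ℕ) (G : Group₀) (R : Ring₀) : Set where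
  private module G = Group G
  open Matrix R
  field
    mat  : G.Carrier → Mat n
    cong : ∀ {g h} → g G.≈ h → mat g ≈ₘ mat h
    mat-ε : mat G.ε ≈ₘ 1ₘ
    mat-∙ : ∀ g h → mat (g G.∙ h) ≈ₘ mat g · mat h
open MatRep public using (mat)

module _ {n : ℕ} {G : Group₀} {R : Ring₀} (ρ : MatRep n G R) where
  private
    module G = Group G
    module R = CommutativeRing R
    module ρ = MatRep ρ
  open Matrix R
  open Linear R using (scalars; _^ᴹ_; Submodule; module Submodule)
  open R using (ring)

  standard : Rep G R
  standard = record
    { space    = scalars ^ᴹ Fin n
    ; act      = λ g v → mat ρ g ·ᵛ v
    ; act-cong = λ p q i → sum-cong-≋ {n} (λ k → R.*-cong (ρ.cong p i k) (q k))
    ; act-+    = λ g v w i → sum-+ (mat ρ g i) v w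
    ; act-*    = λ g r v i → sum-* r (mat ρ g i) v
    ; act-ε    = λ v i → R.trans (sum-cong-≋ {n} λ k → R.*-congʳ (ρ.mat-ε i k)) (1ₘ-sumˡ i v)
    ; act-∙    = λ g h v i → R.trans (sum-cong-≋ {n} λ k → R.*-congʳ (ρ.mat-∙ g h i k))
                   (sum-assoc (mat ρ g i) (mat ρ h) v)
    }
    where open SemiringSum R.semiring using (sum-cong-≋)

  ad⁰ : Rep G R
  ad⁰ = record
    { space    = Submodule.leftModule traceless
    ; act      = λ g (X , t) → conj g X , R.trans (tr-conj g X) t
    ; act-cong = λ {g} {h} {v} {w} p q →
                   ·-cong {n} {mat ρ g · proj₁ v} {mat ρ h · proj₁ w}
                     (·-cong {n} {mat ρ g} {mat ρ h} (ρ.cong p) q) (ρ.cong (G.⁻¹-cong p))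
    ; act-+    = λ g (X , _) (Y , _) i j → R.trans
                   (sum-cong-≋ {n} λ k → R.*-congʳ (sum-+ (mat ρ g i) (λ l → X l k) (λ l → Y l k)))
                   (sum-+ˡ ((mat ρ g · X) i) ((mat ρ g · Y) i) (λ k → mat ρ (g G.⁻¹) k j))
    ; act-*    = λ g r (X , _) i j → R.trans
                   (sum-cong-≋ {n} λ k → R.*-congʳ (sum-* r (mat ρ g i) (λ l → X l k)))
                   (sum-*ˡ r ((mat ρ g · X) i) (λ k → mat ρ (g G.⁻¹) k j))
    ; act-ε    = λ (X , _) → conj-ε X
    ; act-∙    = λ g h (X , _) → conj-∙ g h X
    }
    where
    open SemiringSum R.semiring using (sum-cong-≋; ∑-distrib-+; *-distribˡ-sum; sum-replicate-zero)
    open RingProperties ring using (-1*x≈-x)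

    conj : G.Carrier → Mat n → Mat n
    conj g X = mat ρ g · X · mat ρ (g G.⁻¹)

    mat-inverseˡ : ∀ g → mat ρ (g G.⁻¹) · mat ρ g ≈ₘ 1ₘ
    mat-inverseˡ g = ≈ₘ-trans (≈ₘ-sym (ρ.mat-∙ (g G.⁻¹) g)) (≈ₘ-trans (ρ.cong (G.inverseˡ g)) ρ.mat-ε)

    tr-conj : ∀ g X → tr (conj g X) R.≈ tr X
    tr-conj g X = R.trans (tr-comm (mat ρ g · X) (mat ρ (g G.⁻¹))) (tr-cong
      {A = mat ρ (g G.⁻¹) · (mat ρ g · X)} {B = X}
      (≈ₘ-trans {n} (≈ₘ-sym {n} (·-assoc (mat ρ (g G.⁻¹)) (mat ρ g) X))
        (≈ₘ-trans {n} (·-cong {n} {mat ρ (g G.⁻¹) · mat ρ g} {1ₘ} {X} (mat-inverseˡ g) (≈ₘ-refl {n}))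
          (1ₘ-identityˡ X))))

    conj-ε : ∀ X → conj G.ε X ≈ₘ X
    conj-ε X = ≈ₘ-trans {n}
      (·-cong {n} {mat ρ G.ε · X} {X} {mat ρ (G.ε G.⁻¹)} {1ₘ}
        (≈ₘ-trans {n} (·-cong {n} {mat ρ G.ε} {1ₘ} {X} ρ.mat-ε (≈ₘ-refl {n})) (1ₘ-identityˡ X))
        (≈ₘ-trans {n} (ρ.cong (GroupProperties.ε⁻¹≈ε G)) ρ.mat-ε))
      (1ₘ-identityʳ X)

    conj-∙ : ∀ g h X → conj (g G.∙ h) X ≈ₘ conj g (conj h X)
    conj-∙ g h X = ≈ₘ-trans {n}
      (·-cong {n} {mat ρ (g G.∙ h) · X} {A · B · X} {mat ρ ((g G.∙ h) G.⁻¹)} {B′ · A′}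
        (·-cong {n} {mat ρ (g G.∙ h)} {A · B} {X} (ρ.mat-∙ g h) (≈ₘ-refl {n}))
        (≈ₘ-trans {n} (ρ.cong (GroupProperties.⁻¹-anti-homo-∙ G g h)) (ρ.mat-∙ (h G.⁻¹) (g G.⁻¹))))
      (≈ₘ-trans {n} (≈ₘ-sym {n} (·-assoc (A · B · X) B′ A′))
        (·-cong {n} {A · B · X · B′} {A · (B · X · B′)} {A′}
          (≈ₘ-trans {n}
            (·-cong {n} {A · B · X} {A · (B · X)} {B′} (·-assoc A B X) (≈ₘ-refl {n}))
            (·-assoc A (B · X) B′))
          (≈ₘ-refl {n})))
      where
      A B A′ B′ : Mat n
      A  = mat ρ g
      B  = mat ρ h
      A′ = mat ρ (g G.⁻¹)
      B′ = mat ρ (h G.⁻¹)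

    traceless : Submodule ((scalars ^ᴹ Fin n) ^ᴹ Fin n)
    traceless = record
      { Member  = λ X → tr X R.≈ R.0#
      ; 0-mem   = sum-replicate-zero n
      ; +-mem   = λ p q → R.trans (∑-distrib-+ {n} _ _) (R.trans (R.+-cong p q) (R.+-identityˡ _))
      ; *-mem   = λ r p → R.trans (R.sym (*-distribˡ-sum {n} r _)) (R.trans (R.*-congˡ p) (R.zeroʳ r))
      ; neg-mem = λ p → R.trans (sum-cong-≋ {n} λ i → R.sym (-1*x≈-x _))
                    (R.trans (R.sym (*-distribˡ-sum {n} (R.- R.1#) _)) (R.trans (R.*-congˡ p) (R.zeroʳ _)))
      }

module _ {G : Group₀} {R : Ring₀} (H : Subgroup G) where

  resᶜ : Character G R → Character (Subgroup.group H) R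
  resᶜ α = record
    { at  = λ (g , _) → at α g
    ; hom = record
      { isMagmaHomomorphism = record
        { isRelHomomorphism = record { cong = α.⟦⟧-cong }
        ; homo = λ (g , _) (h , _) → α.homo g h
        }
      ; ε-homo = α.ε-homo
      }
    }
    where module α = Character α

  resᵐ : ∀ {n} → MatRep n G R → MatRep n (Subgroup.group H) R
  resᵐ ρ = record
    { mat   = λ (g , _) → mat ρ g
    ; cong  = ρ.cong
    ; mat-ε = ρ.mat-ε
    ; mat-∙ = λ (g , _) (h , _) → ρ.mat-∙ g h
    }
    where module ρ = MatRep ρ

module _ {G : Group₀} {R : Ring₀} (N : Subgroup G) (φ : Group.Carrier G)
         (normal : ∀ {g} → Subgroup.Member N g →
                   Subgroup.Member N (Group._∙_ G (Group._∙_ G (Group._⁻¹ G φ) g) φ)) where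
  private
    module G = Group G
    module R = CommutativeRing R

    conj : G.Carrier → G.Carrier
    conj g = φ G.⁻¹ G.∙ g G.∙ φ

    conj-∙ : ∀ g h → conj (g G.∙ h) G.≈ conj g G.∙ conj h
    conj-∙ g h = begin
      φ G.⁻¹ G.∙ (g G.∙ h) G.∙ φ                   ≈⟨ G.∙-congʳ (G.assoc (φ G.⁻¹) g h) ⟨
      φ G.⁻¹ G.∙ g G.∙ h G.∙ φ                     ≈⟨ G.assoc (φ G.⁻¹ G.∙ g) h φ ⟩
      φ G.⁻¹ G.∙ g G.∙ (h G.∙ φ)                   ≈⟨ G.∙-congˡ (G.identityˡ (h G.∙ φ)) ⟨
      φ G.⁻¹ G.∙ g G.∙ (G.ε G.∙ (h G.∙ φ))         ≈⟨ G.∙-congˡ (G.∙-congʳ (G.inverseʳ φ)) ⟨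
      φ G.⁻¹ G.∙ g G.∙ (φ G.∙ φ G.⁻¹ G.∙ (h G.∙ φ)) ≈⟨ G.∙-congˡ (G.assoc φ (φ G.⁻¹) (h G.∙ φ)) ⟩
      φ G.⁻¹ G.∙ g G.∙ (φ G.∙ (φ G.⁻¹ G.∙ (h G.∙ φ))) ≈⟨ G.assoc (φ G.⁻¹ G.∙ g) φ _ ⟨
      conj g G.∙ (φ G.⁻¹ G.∙ (h G.∙ φ))            ≈⟨ G.∙-congˡ (G.assoc (φ G.⁻¹) h φ) ⟨
      conj g G.∙ conj h                            ∎
      where open SetoidReasoning G.setoid

    conj-ε : conj G.ε G.≈ G.ε
    conj-ε = G.trans (G.∙-congʳ (G.identityʳ (φ G.⁻¹))) (G.inverseˡ φ)

  conjugateᶜ : Character (Subgroup.group N) R → Character (Subgroup.group N) R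
  conjugateᶜ χ = record
    { at  = λ (g , m) → at χ (conj g , normal m)
    ; hom = record
      { isMagmaHomomorphism = record
        { isRelHomomorphism = record { cong = λ p → χ.⟦⟧-cong (G.∙-congʳ (G.∙-congˡ p)) }
        ; homo = λ (g , m) (h , n) → R.trans
            (χ.⟦⟧-cong {_ , normal (Subgroup.∙-mem N m n)} {_ , Subgroup.∙-mem N (normal m) (normal n)} (conj-∙ g h))
            (χ.homo (conj g , normal m) (conj h , normal n))
        }
      ; ε-homo = R.trans (χ.⟦⟧-cong {_ , normal (Subgroup.ε-mem N)} {_ , Subgroup.ε-mem N} conj-ε) χ.ε-homo
      }
    }
    where module χ = Character χ

record AlgebraicClosureOfℚ : Set₁ where
  field
    Ω : Ring₀
  open CommutativeRing Ω public hiding (zero)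
  field
    isField   : IsField Ω
    char-0    : ∀ n → ¬ fromℕ Ω (suc n) ≈ 0#
    algebraic : ∀ x → ∃ λ cs → Any (_≢ + 0) cs × eval Ω (map (fromℤ Ω) cs) x ≈ 0#
    closed    : ∀ c cs → ∃ λ x → eval Ω (c ∷ cs ++ [ 1# ]) x ≈ 0#

module _ (Q̄ : AlgebraicClosureOfℚ) where
  open AlgebraicClosureOfℚ Q̄

  -- Ring automorphisms automatically fix ℚ.
  record Automorphism : Set where
    field
      ap  : Carrier → Carrier
      iso : IsRingIsomorphism rawRing rawRing ap
    open IsRingIsomorphism iso public

  open Automorphism using (ap)

  private
    inv : Automorphism → Automorphism
    inv σ = record
      { ap  = f⁻¹
      ; iso = record
        { isRingMonomorphism = record
          { isRingHomomorphism = record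
            { isSemiringHomomorphism = record
              { isNearSemiringHomomorphism = record
                { +-isMonoidHomomorphism = record
                  { isMagmaHomomorphism = record
                    { isRelHomomorphism = record { cong = f⁻¹-cong }
                    ; homo = λ x y → σ.injective (trans (f-f⁻¹ _) (sym (trans (σ.+-homo _ _) (+-cong (f-f⁻¹ x) (f-f⁻¹ y)))))
                    }
                  ; ε-homo = σ.injective (trans (f-f⁻¹ _) (sym σ.0#-homo))
                  }
                ; *-homo = λ x y → σ.injective (trans (f-f⁻¹ _) (sym (trans (σ.*-homo _ _) (*-cong (f-f⁻¹ x) (f-f⁻¹ y)))))
                }
              ; 1#-homo = σ.injective (trans (f-f⁻¹ _) (sym σ.1#-homo))
              }
            ; -‿homo = λ x → σ.injective (trans (f-f⁻¹ _) (sym (trans (σ.-‿homo _) (-‿cong (f-f⁻¹ x)))))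
            }
          ; injective = λ {x} {y} p → trans (sym (f-f⁻¹ x)) (trans (σ.⟦⟧-cong p) (f-f⁻¹ y))
          }
        ; surjective = λ y → ap σ y , λ p → σ.injective (trans (f-f⁻¹ _) p)
        }
      }
      where
      module σ = Automorphism σ
      f⁻¹ : Carrier → Carrier
      f⁻¹ y = proj₁ (σ.surjective y)
      f-f⁻¹ : ∀ y → ap σ (f⁻¹ y) ≈ y
      f-f⁻¹ y = proj₂ (σ.surjective y) refl
      f⁻¹-cong : ∀ {x y} → x ≈ y → f⁻¹ x ≈ f⁻¹ y
      f⁻¹-cong p = σ.injective (trans (f-f⁻¹ _) (trans p (sym (f-f⁻¹ _))))

  Gℚ : Group₀
  Gℚ = record
    { Carrier = Automorphism
    ; _≈_     = λ σ τ → ∀ x → ap σ x ≈ ap τ x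
    ; _∙_     = λ σ τ → record
      { ap  = ap σ ∘ ap τ
      ; iso = Composition.isRingIsomorphism trans (Automorphism.iso τ) (Automorphism.iso σ)
      }
    ; ε       = record { iso = Identity.isRingIsomorphism rawRing refl }
    ; _⁻¹     = inv
    ; isGroup = record
      { isMonoid = record
        { isSemigroup = record
          { isMagma = record
            { isEquivalence = record
              { refl  = λ x → refl
              ; sym   = λ p x → sym (p x)
              ; trans = λ p q x → trans (p x) (q x)
              }
            ; ∙-cong = λ {σ} {σ′} {τ} {τ′} p q x → trans (p (ap τ x)) (Automorphism.⟦⟧-cong σ′ (q x))
            }
          ; assoc = λ σ τ υ x → refl
          }
        ; identity = (λ σ x → refl) , (λ σ x → refl)
        }
      ; inverse = (λ σ x → Automorphism.injective σ (proj₂ (Automorphism.surjective σ _) refl))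
                , (λ σ x → proj₂ (Automorphism.surjective σ x) refl)
      ; ⁻¹-cong = λ {σ} {τ} p x → Automorphism.injective σ
          (trans (proj₂ (Automorphism.surjective σ x) refl)
            (sym (trans (p _) (proj₂ (Automorphism.surjective τ x) refl))))
      }
    }

  -- A place of Ω above q, given by its valuation ring 𝒪.  Its decomposition group
  -- in Gal(Ω/ℚ) is Gₚ = Gal(Q̄ₚ/ℚₚ), so no construction of ℚₚ is needed; likewise
  -- ℚₚ(√d) enters through the stabiliser in Gₚ of a square root of d in Ω.
  record Place (q : ℕ) : Set₁ where
    field
      𝒪       : Carrier → Set
      resp    : ∀ {x y} → x ≈ y → 𝒪 x → 𝒪 y
      1-mem   : 𝒪 1#
      +-mem   : ∀ {x y} → 𝒪 x → 𝒪 y → 𝒪 (x + y)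
      *-mem   : ∀ {x y} → 𝒪 x → 𝒪 y → 𝒪 (x * y)
      neg-mem : ∀ {x} → 𝒪 x → 𝒪 (- x)
      total   : ∀ x y → x * y ≈ 1# → 𝒪 x ⊎ 𝒪 y

    Unit : Carrier → Set
    Unit x = ∃ λ y → 𝒪 y × x * y ≈ 1#

    𝔪 : Carrier → Set
    𝔪 x = 𝒪 x × ¬ Unit x

    field
      above : ¬ Unit (fromℕ Ω q)

    decomposition : Subgroup Gℚ
    decomposition = record
      { Member = λ σ → ∀ x → (𝒪 x → 𝒪 (ap σ x)) × (𝒪 (ap σ x) → 𝒪 x)
      ; resp   = λ p d x → (λ m → resp (p x) (proj₁ (d x) m)) , (λ m → proj₂ (d x) (resp (sym (p x)) m))
      ; ε-mem  = λ x → (λ m → m) , (λ m → m)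
      ; ∙-mem  = λ {σ} {τ} d e x →
                   (λ m → proj₁ (d (ap τ x)) (proj₁ (e x) m)) ,
                   (λ m → proj₂ (e x) (proj₂ (d (ap τ x)) m))
      ; ⁻¹-mem = λ {σ} d x →
                   (λ m → proj₂ (d _) (resp (sym (proj₂ (Automorphism.surjective σ x) refl)) m)) ,
                   (λ m → resp (proj₂ (Automorphism.surjective σ x) refl) (proj₁ (d _) m))
      }

    D : Automorphism → Set
    D = Subgroup.Member decomposition

    Inertia : Automorphism → Set
    Inertia σ = D σ × (∀ x → 𝒪 x → 𝔪 (ap σ x - x))

    IsFrobenius : Automorphism → Set
    IsFrobenius σ = D σ × (∀ x → 𝒪 x → 𝔪 (ap σ x - _^ʳ_ Ω x q))

    Gₚ : Group₀
    Gₚ = Subgroup.group decomposition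

    stabiliser : Carrier → Subgroup Gₚ
    stabiliser s = record
      { Member = λ (σ , _) → ap σ s ≈ s
      ; resp   = λ p m → trans (sym (p s)) m
      ; ε-mem  = refl
      ; ∙-mem  = λ {(σ , _)} {(τ , _)} m n → trans (Automorphism.⟦⟧-cong σ n) m
      ; ⁻¹-mem = λ {(σ , _)} m → Automorphism.injective σ
                   (trans (proj₂ (Automorphism.surjective σ s) refl) (sym m))
      }

    IsQuadraticCharacter : {R : Ring₀} → Carrier → Character Gₚ R → Set
    IsQuadraticCharacter {R} s ε = ∀ g →
        (ap (proj₁ g) s ≈ s → at ε g R.≈ R.1#)
      × (ap (proj₁ g) s ≈ - s → at ε g R.≈ R.- R.1#)
      where module R = CommutativeRing R

  FixesAll : List Carrier → Automorphism → Set
  FixesAll xs σ = All (λ x → ap σ x ≈ x) xs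

  IsModCyclotomic : ∀ {κ} → ℕ → Character Gℚ κ → Set
  IsModCyclotomic {κ} ℓ ε = ∀ σ → ∃ λ a →
      (∀ ζ → _^ʳ_ Ω ζ ℓ ≈ 1# → ap σ ζ ≈ _^ʳ_ Ω ζ a)
    × CommutativeRing._≈_ κ (at ε σ) (fromℕ κ a)

  fixes-fromℕ : ∀ σ n → ap σ (fromℕ Ω n) ≈ fromℕ Ω n
  fixes-fromℕ σ zero    = Automorphism.0#-homo σ
  fixes-fromℕ σ (suc n) = trans (Automorphism.+-homo σ _ _)
    (+-cong (Automorphism.1#-homo σ) (fixes-fromℕ σ n))

  fixes-fromℤ : ∀ σ d → ap σ (fromℤ Ω d) ≈ fromℤ Ω d
  fixes-fromℤ σ (+ n)    = fixes-fromℕ σ n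
  fixes-fromℤ σ -[1+ n ] = trans (Automorphism.-‿homo σ _) (-‿cong (fixes-fromℕ σ (suc n)))

  open RingProperties ring using (-‿distribˡ-*; -‿involutive)
  open GroupProperties +-group using () renaming (x∙y⁻¹≈ε⇒x≈y to x-y≈0⇒x≈y)

  square-roots : ∀ {x y} → x * x ≈ y * y → x ≈ y ⊎ x ≈ - y
  square-roots {x} {y} p with IsField.zero⊎unit isField (x - y)
  ... | inj₁ q       = inj₁ (x-y≈0⇒x≈y x y q)
  ... | inj₂ (z , q) = inj₂ (x-y≈0⇒x≈y x (- y) (begin
    x - - y                  ≈⟨ +-congˡ (-‿involutive y) ⟩
    x + y                    ≈⟨ *-identityˡ (x + y) ⟨
    1# * (x + y)             ≈⟨ *-congʳ q ⟨
    (x - y) * z * (x + y)    ≈⟨ *-congʳ (*-comm (x - y) z) ⟩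
    z * (x - y) * (x + y)    ≈⟨ *-assoc z (x - y) (x + y) ⟩
    z * ((x - y) * (x + y))  ≈⟨ *-congˡ difference ⟩
    z * 0#                   ≈⟨ zeroʳ z ⟩
    0#                       ∎))
    where
    open SetoidReasoning setoid
    difference : (x - y) * (x + y) ≈ 0#
    difference = begin
      (x - y) * (x + y)                        ≈⟨ distribʳ (x + y) x (- y) ⟩
      x * (x + y) + - y * (x + y)              ≈⟨ +-congˡ (-‿distribˡ-* y (x + y)) ⟨
      x * (x + y) - y * (x + y)                ≈⟨ +-congˡ (-‿cong (distribˡ y x y)) ⟩
      x * (x + y) - (y * x + y * y)            ≈⟨ +-congˡ (-‿cong (+-cong (*-comm y x) (sym p))) ⟩
      x * (x + y) - (x * y + x * x)            ≈⟨ +-congˡ (-‿cong (+-comm (x * y) (x * x))) ⟩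
      x * (x + y) - (x * x + x * y)            ≈⟨ +-congˡ (-‿cong (distribˡ x x y)) ⟨
      x * (x + y) - x * (x + y)                ≈⟨ -‿inverseʳ _ ⟩
      0#                                       ∎

  image-of-root : ∀ {d s} → s * s ≈ fromℤ Ω d → ∀ σ → ap σ s ≈ s ⊎ ap σ s ≈ - s
  image-of-root {d} {s} p σ = square-roots
    (trans (sym (Automorphism.*-homo σ s s))
      (trans (Automorphism.⟦⟧-cong σ p) (trans (fixes-fromℤ σ d) (sym p))))

  stabiliser-normal : ∀ {q d s} (𝔓 : Place q) → s * s ≈ fromℤ Ω d →
    let open Place 𝔓 in
    let open Group Gₚ using (_∙_; _⁻¹) in
    (φ : Group.Carrier Gₚ) → ∀ {g} → Subgroup.Member (stabiliser s) g →
    Subgroup.Member (stabiliser s) (φ ⁻¹ ∙ g ∙ φ)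
  stabiliser-normal {d = d} {s = s} 𝔓 p (σ₀ , _) {g , _} m =
    φ.injective (trans (proj₂ (φ.surjective _) refl) g-fixes)
    where
    module φ = Automorphism σ₀
    module g = Automorphism g
    g-fixes : ap g (ap σ₀ s) ≈ ap σ₀ s
    g-fixes with image-of-root {d} p σ₀
    ... | inj₁ q = trans (g.⟦⟧-cong q) (trans m (sym q))
    ... | inj₂ q = trans (g.⟦⟧-cong q) (trans (g.-‿homo s) (trans (-‿cong m) (sym q)))

module Ramification {Q̄ : AlgebraicClosureOfℚ} {q : ℕ} (𝔔 : Place Q̄ q) where
  open AlgebraicClosureOfℚ Q̄
  open Place 𝔔
  open Automorphism using (ap)
  open SetoidMembership setoid using () renaming (_∈_ to _∈ˢ_)

  HasSize : (Automorphism Q̄ → Automorphism Q̄ → Set) → (Automorphism Q̄ → Set) → ℕ → Set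
  HasSize _~_ P n = Σ (Fin n → Automorphism Q̄) λ e →
      (∀ i → P (e i))
    × (∀ i j → e i ~ e j → i ≡ j)
    × (∀ σ → P σ → ∃ λ i → σ ~ e i)

  -- A finite Galois extension L = ℚ(gens) of ℚ, used to compute lower
  -- ramification groups of L·K over K at 𝔔, where K is the fixed field of H in
  -- the completion at 𝔔 and is required to lie in the completion of L.  Lower
  -- numbering is compatible with subgroups, so the i-th group is H ∩ Gᵢ(L/ℚ).
  -- Its elements are represented by their lifts to the inertia group of Ω.
  record Filtration (H : Automorphism Q̄ → Set) : Set where
    field
      gens     : List Carrier
      stable   : ∀ (σ : Automorphism Q̄) {x} → x ∈ˢ gens → ap σ x ∈ˢ gens
      contains : ∀ σ → D σ → FixesAll Q̄ gens σ → H σ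

    InL : Carrier → Set
    InL x = ∀ σ → FixesAll Q̄ gens σ → ap σ x ≈ x

    field
      π           : Carrier
      π∈L         : InL π
      π∈𝔪         : 𝔪 π
      uniformizer : ∀ y → InL y → 𝔪 y → ∃ λ z → 𝒪 z × y ≈ π * z

    Ram : ℕ → Automorphism Q̄ → Set
    Ram i σ = Inertia σ × H σ ×
      (∀ x → InL x → 𝒪 x → ∃ λ z → 𝒪 z × ap σ x - x ≈ _^ʳ_ Ω π (suc i) * z)

    field
      order      : ℕ → ℕ
      order-size : ∀ i → HasSize (λ σ τ → All (λ x → ap σ x ≈ ap τ x) gens) (Ram i) (order i)
      bound      : ℕ
      trivial    : ∀ σ → Ram bound σ → FixesAll Q̄ gens σ

  -- For a representation V trivial on the part of inertia that fixes L, with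
  -- codim i = dim V/V^{Gᵢ} and gᵢ = |Gᵢ|, the conductor exponents are
  --   artin = Σ_{i≥0} (gᵢ/g₀) codim i,   swan = Σ_{i≥1} (gᵢ/g₀) codim i.
  module _ {H : Automorphism Q̄ → Set} (F : Filtration H) (codim : ℕ → ℕ) where
    open Filtration F

    IsArtin IsSwan : ℕ → Set
    IsArtin c = c ℕ.* order 0 ≡ List.sum (applyUpTo (λ i → order i ℕ.* codim i) bound)
    IsSwan  c = c ℕ.* order 0 ≡ List.sum (applyUpTo (λ i → order (suc i) ℕ.* codim (suc i)) bound)

  module _ {R : Ring₀} {s : Carrier} (χ : Character (Subgroup.group (stabiliser s)) R) where
    private module R = CommutativeRing R

    Trivial : (Automorphism Q̄ → Set) → Set
    Trivial P = ∀ g → P (proj₁ (proj₁ g)) → at χ g R.≈ R.1#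

    HasConductorExponent : ℕ → Set
    HasConductorExponent c =
      Σ (Filtration (λ σ → ap σ s ≈ s)) λ F →
      let open Filtration F in
      Trivial (λ σ → Inertia σ × FixesAll Q̄ gens σ) ×
      ∃ λ codim →
        (∀ i → (Trivial (Ram i) × codim i ≡ 0) ⊎ (¬ Trivial (Ram i) × codim i ≡ 1)) ×
        IsArtin F codim c

    HasOrderOnInertia : ℕ → Set
    HasOrderOnInertia r = 1 ℕ.≤ r × TrivialPower r × (∀ k → 1 ℕ.≤ k → k ℕ.< r → ¬ TrivialPower k)
      where
      TrivialPower : ℕ → Set
      TrivialPower k = ∀ g → Inertia (proj₁ (proj₁ g)) → _^ʳ_ R (at χ g) k R.≈ R.1#

  module _ {κ : Ring₀} (ρ : MatRep 2 (Gℚ Q̄) κ) where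
    open Matrix κ
    private module κ = CommutativeRing κ

    Invariant : (Automorphism Q̄ → Set) → (Fin 2 → κ.Carrier) → Set
    Invariant P v = ∀ σ → P σ → ∀ i → (mat ρ σ ·ᵛ v) i κ.≈ v i

    HasSwanExponent : ℕ → Set
    HasSwanExponent δ =
      Σ (Filtration (λ _ → ⊤)) λ F →
      let open Filtration F in
      (∀ σ → Inertia σ → FixesAll Q̄ gens σ → mat ρ σ ≈ₘ 1ₘ) ×
      ∃ λ codim →
        (∀ i → ∃ λ d → Linear.HasDimension κ (Rep.space (standard ρ)) (Invariant (Ram i)) d
                     × d ℕ.+ codim i ≡ 2) ×
        IsSwan F codim δ

record WeierstrassEquation : Set where
  field
    a₁ a₂ a₃ a₄ a₆ : ℤ
  open Int using (_+_; _*_; _-_; -_)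

  b₂ b₄ b₆ b₈ c₄ Δ : ℤ
  b₂ = a₁ * a₁ + + 4 * a₂
  b₄ = + 2 * a₄ + a₁ * a₃
  b₆ = a₃ * a₃ + + 4 * a₆
  b₈ = a₁ * a₁ * a₆ + + 4 * a₂ * a₆ - a₁ * a₃ * a₄ + a₂ * a₃ * a₃ - a₄ * a₄
  c₄ = b₂ * b₂ - + 24 * b₄
  Δ  = - (b₂ * b₂ * b₈) - + 8 * (b₄ * b₄ * b₄) - + 27 * (b₆ * b₆) + + 9 * (b₂ * b₄ * b₆)

  equation : ℤ → ℤ → ℤ
  equation x y = (y * y + a₁ * x * y + a₃ * y) - (x * x * x + a₂ * x * x + a₄ * x + a₆)

  affinePoints : ℕ → ℕ
  affinePoints q = length (filter (λ (x , y) → q ℕ.∣? Int.∣ equation (+ x) (+ y) ∣)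
                                  (cartesianProduct (upTo q) (upTo q)))

module _ (E : WeierstrassEquation) where
  open WeierstrassEquation E

  -- Isomorphism over ℚ via x = u²x′ + r, y = u³y′ + u²sx′ + t.
  Isomorphic : WeierstrassEquation → Set
  Isomorphic E′ = ∃ λ u → ∃ λ r → ∃ λ s → ∃ λ t → u ≢ 0ℚ
    × u * E′.a₁′ ≡ a₁′ + 2ℚ * s
    × u * u * E′.a₂′ ≡ a₂′ - s * a₁′ + 3ℚ * r - s * s
    × u * u * u * E′.a₃′ ≡ a₃′ + r * a₁′ + 2ℚ * t
    × u * u * u * u * E′.a₄′ ≡ a₄′ - s * a₃′ + 2ℚ * r * a₂′ - (t + r * s) * a₁′ + 3ℚ * r * r - 2ℚ * s * t
    × u * u * u * u * u * u * E′.a₆′ ≡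
        a₆′ + r * a₄′ + r * r * a₂′ + r * r * r - t * a₃′ - t * t - r * t * a₁′
    where
    open Rat using (_+_; _*_; _-_)
    2ℚ 3ℚ : ℚ
    2ℚ = + 2 Rat./ 1
    3ℚ = + 3 Rat./ 1
    module Coefficients (C : WeierstrassEquation) where
      module C = WeierstrassEquation C
      a₁′ a₂′ a₃′ a₄′ a₆′ : ℚ
      a₁′ = C.a₁ Rat./ 1
      a₂′ = C.a₂ Rat./ 1
      a₃′ = C.a₃ Rat./ 1
      a₄′ = C.a₄ Rat./ 1
      a₆′ = C.a₆ Rat./ 1
    open Coefficients E
    module E′ = Coefficients E′

  record IsMinimalModel : Set where
    field
      nonsingular : Δ ≢ + 0
      minimal     : ∀ E′ → Isomorphic E′ → Int.∣ Δ ∣ ℕ.≤ Int.∣ WeierstrassEquation.Δ E′ ∣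

  -- For a globally minimal equation; the index is the tame conductor exponent.
  data Reduction (q : ℕ) : ℕ → Set where
    good           : ¬ + q ∣ℤ Δ → Reduction q 0
    multiplicative : + q ∣ℤ Δ → ¬ + q ∣ℤ c₄ → Reduction q 1
    additive       : + q ∣ℤ Δ → + q ∣ℤ c₄ → Reduction q 2

  -- j = c₄³/Δ is q-integral.
  PotentiallyGood : ℕ → Set
  PotentiallyGood q = ∀ k → + (q ℕ.^ k) ∣ℤ Δ → + (q ℕ.^ k) ∣ℤ c₄ Int.^ 3

  -- The Fourier coefficients of the normalised weight 2 newform of level N with
  -- L(f, s) = L(E, s).  By modularity it exists for every E of conductor N.  For
  -- a globally minimal equation q - #{affine points mod q} is the Euler factor
  -- coefficient at every prime q, bad ones included (the singular point counts
  -- as one affine point).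
  record IsNewform (N : ℕ) (a : ℕ → ℤ) : Set where
    field
      cuspidal       : a 0 ≡ + 0
      normalised     : a 1 ≡ + 1
      coprime        : ∀ m n → Coprime m n → a (m ℕ.* n) ≡ a m Int.* a n
      at-prime       : ∀ q → Prime q → a q ≡ + q Int.- + affinePoints q
      good-power     : ∀ q r → Prime q → ¬ q ℕ.∣ N →
                       a (q ℕ.^ (2 ℕ.+ r)) ≡ a q Int.* a (q ℕ.^ suc r) Int.- + q Int.* a (q ℕ.^ r)
      bad-power      : ∀ q r → Prime q → q ℕ.∣ N →
                       a (q ℕ.^ (2 ℕ.+ r)) ≡ a q Int.* a (q ℕ.^ suc r)

  -- The exponent at q is εq + δq: εq = 0, 1, 2 by reduction type and δq the Swan
  -- exponent of E[ℓ] for any prime ℓ ≠ q, here seen through ρ̄ ≅ E[ℓ] ⊗ κ.  At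
  -- q = ℓ ≥ 5 the wild part δq vanishes.
  IsConductor : ∀ {Q̄ κ} → ℕ → MatRep 2 (Gℚ Q̄) κ → ℕ → Set₁
  IsConductor {Q̄} ℓ ρ̄ N = 1 ℕ.≤ N ×
    (∀ q → Prime q → ∃₂ λ εq δq →
      Reduction q εq × Wild q δq ×
      q ℕ.^ (εq ℕ.+ δq) ℕ.∣ N × ¬ q ℕ.^ suc (εq ℕ.+ δq) ℕ.∣ N)
    where
    Wild : ℕ → ℕ → Set₁
    Wild q δ = (q ≡ ℓ → δ ≡ 0)
             × (q ≢ ℓ → Σ (Place Q̄ q) λ 𝔔 → Ramification.HasSwanExponent 𝔔 ρ̄ δ)

-- A complete discrete valuation ring of characteristic 0 with residue field κ.
record IntegerRing (κ : Ring₀) : Set₁ where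
  private module κ = CommutativeRing κ
  field
    Λ : Ring₀
  open CommutativeRing Λ public hiding (zero)
  field
    reduce     : Carrier → κ.Carrier
    reduce-hom : Hom Λ κ reduce
    reduce-sur : ∀ y → ∃ λ x → reduce x κ.≈ y
    ϖ          : Carrier
    ϖ-kernel   : reduce ϖ κ.≈ κ.0#
    kernel-ϖ   : ∀ x → reduce x κ.≈ κ.0# → ∃ λ y → x ≈ ϖ * y
    ϖ-regular  : ∀ x → ϖ * x ≈ 0# → x ≈ 0#
    local      : ∀ x → ¬ reduce x κ.≈ κ.0# → ∃ λ y → x * y ≈ 1#
    char-0     : ∀ n → ¬ fromℕ Λ (suc n) ≈ 0#

  infix 4 _≡_mod-ϖ^_
  _≡_mod-ϖ^_ : Carrier → Carrier → ℕ → Set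
  x ≡ y mod-ϖ^ n = ∃ λ z → x - y ≈ _^ʳ_ Λ ϖ n * z

  field
    separated  : ∀ x → (∀ n → x ≡ 0# mod-ϖ^ n) → x ≈ 0#
    complete   : ∀ (x : ℕ → Carrier) → (∀ n → x (suc n) ≡ x n mod-ϖ^ n) →
                 ∃ λ y → ∀ n → y ≡ x n mod-ϖ^ n

module _ {Q̄ : AlgebraicClosureOfℚ} where
  open AlgebraicClosureOfℚ Q̄ using (Ω; _≈_; 1#)
  open Automorphism using (ap)

  module _ {R : Ring₀} (ρ : MatRep 2 (Gℚ Q̄) R) where
    open Matrix R
    private module R = CommutativeRing R

    UnramifiedAt : ℕ → Set₁
    UnramifiedAt q = ∀ (𝔔 : Place Q̄ q) σ → Place.Inertia 𝔔 σ → mat ρ σ ≈ₘ 1ₘ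

    -- For the discrete topology on R.
    IsContinuous : Set
    IsContinuous = ∃ λ xs → ∀ σ → FixesAll Q̄ xs σ → mat ρ σ ≈ₘ 1ₘ

    -- The elements of order 2 in Gal(Q̄/ℚ) are the complex conjugations.
    IsOdd : Set
    IsOdd = ∀ c → (∀ x → ap c (ap c x) ≈ x) → ¬ (∀ x → ap c x ≈ x) →
            det₂ (mat ρ c) R.≈ R.- R.1#

    -- No invariant line over any extension field of R.
    IsAbsolutelyIrreducible : Set₁
    IsAbsolutelyIrreducible =
      ∀ (R′ : Ring₀) → IsField R′ → let module R′ = CommutativeRing R′ in
      ∀ (j : R.Carrier → R′.Carrier) → Hom R R′ j →
      ∀ (v : Fin 2 → R′.Carrier) →
      (∀ σ → ∃ λ c → ∀ i →
        Matrix._·ᵛ_ R′ (λ k l → j (mat ρ σ k l)) v i R′.≈ c R′.* v i) →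
      ∀ i → v i R′.≈ R′.0#

  -- ρ : Gal(Q̄/ℚ) → GL₂(Λ) is attached to the newform of level N with Fourier
  -- coefficients a.  For Frobenius at q ∤ Nℓ the determinant condition reads
  -- det ρ(Frob) = q.
  record IsAttached {κ} (O : IntegerRing κ) (ℓ N : ℕ) (a : ℕ → ℤ)
                    (ρ : MatRep 2 (Gℚ Q̄) (IntegerRing.Λ O)) : Set₁ where
    open IntegerRing O using (Λ; _-_; _*_; _≡_mod-ϖ^_) renaming (_≈_ to _≈ᵒ_)
    open Matrix Λ
    field
      continuous  : ∀ n → ∃ λ xs → ∀ σ → FixesAll Q̄ xs σ →
                    ∀ i j → mat ρ σ i j ≡ 1ₘ i j mod-ϖ^ n
      unramified  : ∀ q → Prime q → ¬ q ℕ.∣ N ℕ.* ℓ → UnramifiedAt ρ q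
      trace       : ∀ q → Prime q → ¬ q ℕ.∣ N ℕ.* ℓ →
                    ∀ (𝔔 : Place Q̄ q) σ → Place.IsFrobenius 𝔔 σ →
                    tr (mat ρ σ) ≈ᵒ fromℤ Λ (a q)
      determinant : ∀ σ n b →
                    (∀ ζ → _^ʳ_ Ω ζ (ℓ ℕ.^ n) ≈ 1# → ap σ ζ ≈ _^ʳ_ Ω ζ b) →
                    ∃ λ y → det₂ (mat ρ σ) - fromℕ Λ b ≈ᵒ fromℕ Λ (ℓ ℕ.^ n) * y

  IsReduction : ∀ {κ} (O : IntegerRing κ) →
                MatRep 2 (Gℚ Q̄) (IntegerRing.Λ O) → MatRep 2 (Gℚ Q̄) κ → Set
  IsReduction {κ} O ρ ρ̄ = ∀ σ i j →
    CommutativeRing._≈_ κ (IntegerRing.reduce O (mat ρ σ i j)) (mat ρ̄ σ i j)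

-- The types τ_{sc,p}(d, c, r), twisted by ε₃ if the Boolean is true.
data UnramifiedType (p : ℕ) : (d : ℤ) (c r : ℕ) → Bool → Set where
  tame   : ∀ {u e} → 5 ℕ.≤ p →
           ¬ + p ∣ℤ u → (∀ x → ¬ + p ∣ℤ x Int.* x Int.- u) →
           e ∈ 3 ∷ 4 ∷ 6 ∷ [] → e ℕ.∣ suc p →
           UnramifiedType p u 1 e false
  tame₃  : p ≡ 3 → UnramifiedType p -[1+ 0 ] 1 4 false
  wild₃  : p ≡ 3 → UnramifiedType p -[1+ 0 ] 2 3 false
  wild₃′ : p ≡ 3 → UnramifiedType p -[1+ 0 ] 2 3 true

module _ {Q̄ : AlgebraicClosureOfℚ} {p : ℕ} (𝔓 : Place Q̄ p) where
  open AlgebraicClosureOfℚ Q̄ using (Ω; Carrier) renaming (_≈_ to _≈Ω_; _*_ to _*Ω_)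
  open Place 𝔓
  open Ramification 𝔓

  HasType : ∀ {R s} → ℕ → ℕ → Bool → Character (Subgroup.group (stabiliser s)) R → Set
  HasType c r false χ = HasConductorExponent χ c × HasOrderOnInertia χ r
  HasType {R} {s} c r true χ =
    ∃ λ s₃ → s₃ *Ω s₃ ≈Ω fromℤ Ω (+ 3) ×
    Σ (Character Gₚ R) λ ε₃ → IsQuadraticCharacter s₃ ε₃ ×
    Σ (Character (Subgroup.group (stabiliser s)) R) λ χ₀ →
      HasConductorExponent χ₀ c × HasOrderOnInertia χ₀ r ×
      (∀ g → CommutativeRing._≈_ R (at χ g) (at (χ₀ ·ᶜ resᶜ (stabiliser s) ε₃) g))

  -- The local representation at p: ρ|Gₚ is induced from a character χ of G_K,
  -- K = ℚₚ(√d), whose type is one of the above, and χ is a minimally ramified lift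
  -- of the character χ̄ inducing ρ̄|Gₚ.
  record UnramifiedSupercuspidal {κ : Ring₀} (O : IntegerRing κ)
           (ρ : MatRep 2 (Gℚ Q̄) (IntegerRing.Λ O)) (ρ̄ : MatRep 2 (Gℚ Q̄) κ) : Set₁ where
    open IntegerRing O using (Λ; reduce; _≡_mod-ϖ^_; 1#)
    private module κ = CommutativeRing κ
    field
      d         : ℤ
      c r       : ℕ
      twisted   : Bool
      type      : UnramifiedType p d c r twisted
      √d        : Carrier
      √d-square : √d *Ω √d ≈Ω fromℤ Ω d

    G-K : Subgroup Gₚ
    G-K = stabiliser √d

    field
      χ            : Character (Subgroup.group G-K) Λ
      χ-continuous : ∀ n → ∃ λ xs → ∀ g → FixesAll Q̄ xs (proj₁ (proj₁ g)) → at χ g ≡ 1# mod-ϖ^ n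
      χ-type       : HasType c r twisted χ
      ρ-induced    : standard (resᵐ decomposition ρ) ≅ Ind G-K χ
      χ̄            : Character (Subgroup.group G-K) κ
      lifts        : ∀ g → reduce (at χ g) κ.≈ at χ̄ g
      minimal      : ∃ λ n → HasConductorExponent χ n × HasConductorExponent χ̄ n
      ρ̄-induced    : standard (resᵐ decomposition ρ̄) ≅ Ind G-K χ̄

    module _ (φ : Group.Carrier Gₚ) where
      χ̄ˢ : Character (Subgroup.group G-K) κ
      χ̄ˢ = conjugateᶜ G-K φ (λ {g} → stabiliser-normal Q̄ {d = d} 𝔓 √d-square φ {g}) χ̄

      ψ̄ : Character (Subgroup.group G-K) κ
      ψ̄ = χ̄ /ᶜ χ̄ˢ

      IsRegular : Set
      IsRegular = ¬ (∀ g → at χ̄ g κ.≈ at χ̄ˢ g)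

{-# OPTIONS --safe #-}
module Submission where

-- Frobenius φ at 𝔓 moves √d: otherwise the residue of √d would be fixed by x ↦ xᵖ, hence
-- lie in 𝔽ₚ, and d would be a square mod p.  So G_K has index two in Gₚ with coset
-- representative φ, and in the basis of ρ̄ coming from ρ̄|Gₚ ≅ Ind χ̄ the diagonal entry x
-- of a traceless X spans the εK-line, while g ↦ (g X g⁻¹)₀₁ maps ad⁰ ρ̄ onto Ind ψ̄.
--
-- A root ζ of 1 + X + … + X^(ℓ-1) has residue of exact order ℓ, so ε̄(φ) = p.  An
-- invariant in ε̄ ⊗ Ind ψ̄ is determined by its value at 1, which vanishes unless
-- ε̄ ψ̄ = 1 on G_K.  Evaluating at φ² that forces p² ≡ 1 mod ℓ; and if p ≡ ±1 then ε̄ is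
-- trivial on G_K, so it forces χ̄ = χ̄ˢ.  The line ε̄ εK has invariants only if
-- ε̄(φ) εK(φ) = -p is 1, and if p ≡ -1 it is trivial.

open import Defs
open import Algebra.Bundles using (CommutativeRing; Group)
open import Algebra.Module.Bundles using (LeftModule)
open import Algebra.Module.Morphism.Structures using (module LeftModuleMorphisms)
import Algebra.Properties.AbelianGroup as AbelianGroupProperties
import Algebra.Properties.Group as GroupProperties
import Algebra.Properties.Ring as RingProperties
import Algebra.Properties.Semiring.Exp as Exp
import Algebra.Properties.Semiring.Mult as Mult
import Algebra.Solver.Ring as RingSolver
open import Algebra.Solver.Ring.AlmostCommutativeRing using (fromCommutativeRing; _-Raw-AlmostCommutative⟶_)
import Relation.Binary.Reasoning.Setoid as SetoidReasoning
open import Data.Empty using (⊥-elim)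
open import Data.Fin.Base using (Fin; zero; suc)
open import Data.Integer.Base as Int using (ℤ; +_; -[1+_]; +0; +[1+_]; 0ℤ; 1ℤ)
import Data.Integer.Properties as Int
open import Data.Integer.Divisibility using () renaming (_∣_ to _∣ℤ_)
open import Data.List.Base using (List; _∷_; _++_; [_]; replicate)
open import Data.List.Membership.Propositional using (_∈_; _∉_)
open import Data.List.Relation.Unary.All using (All)
open import Data.Maybe.Base using (map)
open import Data.Nat.Base as ℕ using (ℕ; zero; suc; _≤_; _∸_; _!)
import Data.Nat.Properties as ℕ
open import Data.Nat.Coprimality using (Coprime; coprime-Bézout)
open import Data.Nat.Divisibility using (_∣_; _∣?_; divides; ∣1⇒≡1; ∣⇒≤; ∣m+n∣m⇒∣n)
open import Data.Nat.GCD using (module Bézout)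
open import Data.Nat.Primality using (Prime; euclidsLemma; prime⇒irreducible; ¬prime[0]; ¬prime[1])
open import Data.Nat.Solver using (module +-*-Solver)
open import Data.Product.Base using (Σ; ∃; _×_; _,_; proj₁; proj₂)
open import Data.Sign.Base as Sign using (Sign)
open import Data.Sum.Base using (_⊎_; inj₁; inj₂)
open import Relation.Nullary using (¬_; yes; no)
open import Relation.Nullary.Decidable.Core using (dec⇒maybe; from-no)
open import Relation.Binary.PropositionalEquality.Core as ≡ using (_≡_; _≢_)

-- The argument is shaped by what can be decided. In Ω every element is zero or invertible, so signs
-- of √d and quotients can be chosen. In the residue ring of 𝔓 this fails: 𝔪 is defined by a
-- negation. Equality of residues is therefore stable under double negation but not decidable, and
-- "x lies in 𝔽ₚ" is only ever obtained doubly negated. That suffices, because it is used to prove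
-- either an absurdity or an equality of residues. The same device stands in for the Galois theory
-- of the residue field. A residue fixed by φ is an integer up to double negation, so all of Gₚ
-- fixes it. For p ≡ 1 mod ℓ this applies to the residue z of ζ itself. For p ≡ -1 the residue z
-- generates the quadratic extension of 𝔽ₚ, and combinations of z and r, the residue of √d, that φ
-- does fix have to be found. The representation theory is carried out for any group G with a
-- subgroup H, an element φ outside H and two cosets H, Hφ; η and θ there become ε̄ and εK. In (ii)
-- any isomorphism Θ will do: the second summand has no invariants, so the preimage of the line is
-- all of H⁰.

prime∤⇒coprime : ∀ {q n} → Prime q → ¬ q ∣ n → Coprime q n
prime∤⇒coprime pr q∤n (d∣q , d∣n) with prime⇒irreducible pr d∣q
... | inj₁ d≡1    = d≡1
... | inj₂ ≡.refl = ⊥-elim (q∤n d∣n)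

-- Used with n = q - 1, where it shows that (q - 1)! does not vanish in characteristic q.
prime∣!⇒≤ : ∀ {q} → Prime q → ∀ n → q ∣ n ! → q ≤ n
prime∣!⇒≤ pr zero    q∣1 with ∣1⇒≡1 q∣1
... | ≡.refl = ⊥-elim (¬prime[1] pr)
prime∣!⇒≤ pr (suc n) q∣ with euclidsLemma (suc n) (n !) pr q∣
... | inj₁ q∣1+n = ∣⇒≤ q∣1+n
... | inj₂ q∣n!  = ℕ.m≤n⇒m≤1+n (prime∣!⇒≤ pr n q∣n!)

-- Integers in a commutative ring, and prime characteristic

module CommutativeRingProperties (R : Ring₀) where
  open CommutativeRing R hiding (zero)
  open RingProperties ring
    using (-‿involutive; -0#≈0#; -‿distribˡ-*; -‿distribʳ-*)
  open AbelianGroupProperties +-abelianGroup using (⁻¹-∙-comm)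
  open Mult semiring using (×-homo-+; ×1-homo-*)
  open SetoidReasoning setoid

  infixr 8 _^ᴿ_
  _^ᴿ_ : Carrier → ℕ → Carrier
  _^ᴿ_ = _^ʳ_ R

  ⌜_⌝ : ℕ → Carrier
  ⌜_⌝ = fromℕ R

  fromℕ-+ : ∀ m n → ⌜ m ℕ.+ n ⌝ ≈ ⌜ m ⌝ + ⌜ n ⌝
  fromℕ-+ = ×-homo-+ 1#

  fromℕ-* : ∀ m n → ⌜ m ℕ.* n ⌝ ≈ ⌜ m ⌝ * ⌜ n ⌝
  fromℕ-* = ×1-homo-*

  fromℤ-neg : ∀ i → fromℤ R (Int.- i) ≈ - fromℤ R i
  fromℤ-neg +0       = sym -0#≈0#
  fromℤ-neg +[1+ n ] = refl
  fromℤ-neg -[1+ n ] = sym (-‿involutive _)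

  private
    shift : ∀ x y z → (x + y) - (x + z) ≈ y - z
    shift x y z = begin
      (x + y) - (x + z)      ≈⟨ +-cong (+-comm x y) (sym (⁻¹-∙-comm x z)) ⟩
      (y + x) + (- x - z)    ≈⟨ +-assoc y x _ ⟩
      y + (x + (- x - z))    ≈⟨ +-congˡ (+-assoc x (- x) (- z)) ⟨
      y + ((x - x) - z)      ≈⟨ +-congˡ (+-congʳ (-‿inverseʳ x)) ⟩
      y + (0# - z)           ≈⟨ +-congˡ (+-identityˡ _) ⟩
      y - z                  ∎

  fromℤ-⊖ : ∀ m n → fromℤ R (m Int.⊖ n) ≈ ⌜ m ⌝ - ⌜ n ⌝
  fromℤ-⊖ m       zero    = sym (trans (+-congˡ -0#≈0#) (+-identityʳ _))
  fromℤ-⊖ zero    (suc n) = sym (+-identityˡ _)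
  fromℤ-⊖ (suc m) (suc n) rewrite Int.[1+m]⊖[1+n]≡m⊖n m n =
    trans (fromℤ-⊖ m n) (sym (shift 1# ⌜ m ⌝ ⌜ n ⌝))

  fromℤ-+ : ∀ i j → fromℤ R (i Int.+ j) ≈ fromℤ R i + fromℤ R j
  fromℤ-+ (+ m)    (+ n)    = fromℕ-+ m n
  fromℤ-+ (+ m)    -[1+ n ] = fromℤ-⊖ m (suc n)
  fromℤ-+ -[1+ m ] (+ n)    = trans (fromℤ-⊖ n (suc m)) (+-comm _ _)
  fromℤ-+ -[1+ m ] -[1+ n ] = begin
    - ⌜ suc (suc (m ℕ.+ n)) ⌝      ≡⟨ ≡.cong (λ k → - ⌜ k ⌝) (≡.sym (ℕ.+-suc (suc m) n)) ⟩
    - ⌜ suc m ℕ.+ suc n ⌝          ≈⟨ -‿cong (fromℕ-+ (suc m) (suc n)) ⟩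
    - (⌜ suc m ⌝ + ⌜ suc n ⌝)      ≈⟨ ⁻¹-∙-comm _ _ ⟨
    - ⌜ suc m ⌝ - ⌜ suc n ⌝        ∎

  private
    -- Multiplication in ℤ is computed from signs and absolute values, so multiplicativity of
    -- `fromℤ` is checked on the two separately.
    signed : Sign → Carrier → Carrier
    signed Sign.+ x = x
    signed Sign.- x = - x

    fromℤ-◃ : ∀ s n → fromℤ R (s Int.◃ n) ≈ signed s ⌜ n ⌝
    fromℤ-◃ Sign.+ zero    = refl
    fromℤ-◃ Sign.+ (suc n) = refl
    fromℤ-◃ Sign.- zero    = sym -0#≈0#
    fromℤ-◃ Sign.- (suc n) = refl

    signed-cong : ∀ s {x y} → x ≈ y → signed s x ≈ signed s y
    signed-cong Sign.+ e = e
    signed-cong Sign.- e = -‿cong e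

    signed-* : ∀ s t x y → signed (s Sign.* t) (x * y) ≈ signed s x * signed t y
    signed-* Sign.+ Sign.+ x y = refl
    signed-* Sign.+ Sign.- x y = -‿distribʳ-* x y
    signed-* Sign.- Sign.+ x y = -‿distribˡ-* x y
    signed-* Sign.- Sign.- x y = begin
      x * y          ≈⟨ -‿involutive _ ⟨
      - - (x * y)    ≈⟨ -‿cong (-‿distribʳ-* x y) ⟩
      - (x * - y)    ≈⟨ -‿distribˡ-* x (- y) ⟩
      - x * - y      ∎

    fromℤ-signed : ∀ i → signed (Int.sign i) ⌜ Int.∣ i ∣ ⌝ ≈ fromℤ R i
    fromℤ-signed (+ n)    = refl
    fromℤ-signed -[1+ n ] = refl

  fromℤ-* : ∀ i j → fromℤ R (i Int.* j) ≈ fromℤ R i * fromℤ R j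
  fromℤ-* i j = begin
    fromℤ R (s Sign.* t Int.◃ m ℕ.* n)    ≈⟨ fromℤ-◃ (s Sign.* t) (m ℕ.* n) ⟩
    signed (s Sign.* t) ⌜ m ℕ.* n ⌝       ≈⟨ signed-cong (s Sign.* t) (fromℕ-* m n) ⟩
    signed (s Sign.* t) (⌜ m ⌝ * ⌜ n ⌝)   ≈⟨ signed-* s t ⌜ m ⌝ ⌜ n ⌝ ⟩
    signed s ⌜ m ⌝ * signed t ⌜ n ⌝       ≈⟨ *-cong (fromℤ-signed i) (fromℤ-signed j) ⟩
    fromℤ R i * fromℤ R j                 ∎
    where
    s = Int.sign i
    t = Int.sign j
    m = Int.∣ i ∣
    n = Int.∣ j ∣

  -- Differs from fromℤ R in sending 1 to 1# itself rather than to 1# + 0#, so that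
  -- the constant 1# is recognised in solver goals.
  private
    coefficient : ℤ → Carrier
    coefficient (+ 1) = 1#
    coefficient i     = fromℤ R i

    coefficient≈fromℤ : ∀ i → coefficient i ≈ fromℤ R i
    coefficient≈fromℤ (+ 0)           = refl
    coefficient≈fromℤ (+ 1)           = sym (+-identityʳ 1#)
    coefficient≈fromℤ (+ suc (suc n)) = refl
    coefficient≈fromℤ -[1+ n ]        = refl

    morphism : Int.+-*-rawRing -Raw-AlmostCommutative⟶ fromCommutativeRing R
    morphism = record
      { ⟦_⟧    = coefficient
      ; +-homo = λ i j → trans (≈ℤ (i Int.+ j)) (trans (fromℤ-+ i j) (sym (+-cong (≈ℤ i) (≈ℤ j))))
      ; *-homo = λ i j → trans (≈ℤ (i Int.* j)) (trans (fromℤ-* i j) (sym (*-cong (≈ℤ i) (≈ℤ j))))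
      ; -‿homo = λ i → trans (≈ℤ (Int.- i)) (trans (fromℤ-neg i) (sym (-‿cong (≈ℤ i))))
      ; 0-homo = refl
      ; 1-homo = refl
      }
      where ≈ℤ = coefficient≈fromℤ

  -- The solver compares coefficients, and equality in R need not be decidable. The identities below
  -- have integer coefficients, which can be compared.
  module Solver = RingSolver Int.+-*-rawRing (fromCommutativeRing R) morphism
    (λ i j → map (λ e → reflexive (≡.cong coefficient e)) (dec⇒maybe (i Int.≟ j)))

module PrimeCharacteristic (R : Ring₀)
  (1≉0 : ¬ CommutativeRing._≈_ R (CommutativeRing.1# R) (CommutativeRing.0# R))
  {q : ℕ} (q-prime : Prime q)
  (q≈0 : CommutativeRing._≈_ R (fromℕ R q) (CommutativeRing.0# R)) where
  open CommutativeRing R hiding (zero)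
  open CommutativeRingProperties R
  open SetoidReasoning setoid

  private
    Bézout⇒1≈0 : ∀ {m n} x y → 1 ℕ.+ y ℕ.* n ≡ x ℕ.* m → ⌜ m ⌝ ≈ 0# → ⌜ n ⌝ ≈ 0# → 1# ≈ 0#
    Bézout⇒1≈0 {m} {n} x y eq m≈0 n≈0 = begin
      1#                          ≈⟨ +-identityʳ 1# ⟨
      1# + 0#                     ≈⟨ +-congˡ (trans (*-congˡ n≈0) (zeroʳ ⌜ y ⌝)) ⟨
      1# + ⌜ y ⌝ * ⌜ n ⌝          ≈⟨ +-congˡ (fromℕ-* y n) ⟨
      ⌜ 1 ℕ.+ y ℕ.* n ⌝           ≡⟨ ≡.cong ⌜_⌝ eq ⟩
      ⌜ x ℕ.* m ⌝                 ≈⟨ fromℕ-* x m ⟩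
      ⌜ x ⌝ * ⌜ m ⌝               ≈⟨ trans (*-congˡ m≈0) (zeroʳ ⌜ x ⌝) ⟩
      0#                          ∎

  -- If q did not divide n, a Bézout relation between q and n would read 1 = 0 in R. The case split
  -- is on divisibility in ℕ, so equality in R is never decided.
  fromℕ≈0⇒∣ : ∀ n → ⌜ n ⌝ ≈ 0# → q ∣ n
  fromℕ≈0⇒∣ n n≈0 with q ∣? n
  ... | yes q∣n = q∣n
  ... | no  q∤n with coprime-Bézout (prime∤⇒coprime q-prime q∤n)
  ...   | Bézout.+- x y eq = ⊥-elim (1≉0 (Bézout⇒1≈0 x y eq q≈0 n≈0))
  ...   | Bézout.-+ x y eq = ⊥-elim (1≉0 (Bézout⇒1≈0 y x eq n≈0 q≈0))

  ∣⇒fromℕ≈0 : ∀ {n} → q ∣ n → ⌜ n ⌝ ≈ 0#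
  ∣⇒fromℕ≈0 (divides k ≡.refl) = trans (fromℕ-* k q) (trans (*-congˡ q≈0) (zeroʳ ⌜ k ⌝))

-- Finite differences of powers

module FiniteDifferences (R : Ring₀) where
  open CommutativeRing R hiding (zero)
  open CommutativeRingProperties R
  open SetoidReasoning setoid

  Δ^ : ℕ → (ℕ → Carrier) → ℕ → Carrier
  Δ^ zero    g a = g a
  Δ^ (suc k) g a = Δ^ k g (suc a) - Δ^ k g a

  Δ^-const : ∀ {g c} → (∀ a → g a ≈ c) → ∀ k a → Δ^ (suc k) g a ≈ 0#
  Δ^-const {g} {c} const zero a = trans (+-cong (const (suc a)) (-‿cong (const a))) (-‿inverseʳ c)
  Δ^-const const (suc k) a = trans
    (+-cong (Δ^-const const k (suc a)) (-‿cong (Δ^-const const k a))) (-‿inverseʳ 0#)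

  module _ (r : Carrier) where

    -- The factor r + b has first difference 1 and second difference 0, so only two terms of the
    -- Leibniz rule survive.
    Δ^-Leibniz : ∀ (g : ℕ → Carrier) k a →
      Δ^ (suc k) (λ b → (r + ⌜ b ⌝) * g b) a ≈
      (r + ⌜ a ⌝) * Δ^ (suc k) g a + ⌜ suc k ⌝ * Δ^ k g (suc a)
    Δ^-Leibniz g zero a =
      solve 4 (λ r n u v → (r :+ (con (+ 1) :+ n)) :* v :- (r :+ n) :* u
                        := (r :+ n) :* (v :- u) :+ (con (+ 1) :+ con (+ 0)) :* v)
        refl r ⌜ a ⌝ (g a) (g (suc a))
      where open Solver
    Δ^-Leibniz g (suc k) a = trans
      (+-cong (Δ^-Leibniz g k (suc a)) (-‿cong (Δ^-Leibniz g k a)))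
      (solve 6 (λ r n k u v w →
           ((r :+ (con (+ 1) :+ n)) :* (w :- v) :+ (con (+ 1) :+ k) :* w)
           :- ((r :+ n) :* (v :- u) :+ (con (+ 1) :+ k) :* v)
        := (r :+ n) :* ((w :- v) :- (v :- u)) :+ (con (+ 1) :+ (con (+ 1) :+ k)) :* (w :- v))
        refl r ⌜ a ⌝ ⌜ k ⌝ (Δ^ k g a) (Δ^ k g (suc a)) (Δ^ k g (suc (suc a))))
      where open Solver

    -- The k-th difference of a monic polynomial of degree k is k!. Since this value does not depend
    -- on a, the next difference vanishes, which kills the first Leibniz term in the induction.
    Δ^-power : ∀ k a → Δ^ k (λ b → (r + ⌜ b ⌝) ^ᴿ k) a ≈ ⌜ k ! ⌝
    Δ^-power zero    a = sym (+-identityʳ 1#)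
    Δ^-power (suc k) a = begin
      Δ^ (suc k) (λ b → (r + ⌜ b ⌝) * g b) a                        ≈⟨ Δ^-Leibniz g k a ⟩
      (r + ⌜ a ⌝) * Δ^ (suc k) g a + ⌜ suc k ⌝ * Δ^ k g (suc a)     ≈⟨ +-cong (*-congˡ vanish) (*-congˡ (Δ^-power k (suc a))) ⟩
      (r + ⌜ a ⌝) * 0# + ⌜ suc k ⌝ * ⌜ k ! ⌝                        ≈⟨ +-congʳ (zeroʳ _) ⟩
      0# + ⌜ suc k ⌝ * ⌜ k ! ⌝                                      ≈⟨ +-identityˡ _ ⟩
      ⌜ suc k ⌝ * ⌜ k ! ⌝                                           ≈⟨ fromℕ-* (suc k) (k !) ⟨
      ⌜ suc k ! ⌝                                                   ∎
      where
      g : ℕ → Carrier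
      g b = (r + ⌜ b ⌝) ^ᴿ k
      vanish : Δ^ (suc k) g a ≈ 0#
      vanish = trans (+-cong (Δ^-power k (suc a)) (-‿cong (Δ^-power k a))) (-‿inverseʳ _)

-- Powers and roots of unity

module Powers (R : Ring₀) where
  open CommutativeRing R hiding (zero)
  open CommutativeRingProperties R
  open Exp semiring using (^-assocʳ; ^-congˡ; ^-congʳ)
  open SetoidReasoning setoid

  -- For prime n this is the n-th cyclotomic polynomial at x. Written as `eval` of a coefficient
  -- list, it is in the form for which `closed` supplies a root.
  geometric : ℕ → Carrier → Carrier
  geometric n x = eval R (replicate n 1#) x

  -- Both sides are 1 + x + ... + x^n: the telescoping identity for x^n - 1 with its subtractions
  -- cleared.
  geometric-shift : ∀ n x → 1# + x * geometric n x ≈ geometric n x + x ^ᴿ n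
  geometric-shift zero    x = trans (+-congˡ (zeroʳ x)) (+-comm 1# 0#)
  geometric-shift (suc n) x = begin
    1# + x * (1# + x * geometric n x)           ≈⟨ +-congˡ (*-congˡ (geometric-shift n x)) ⟩
    1# + x * (geometric n x + x ^ᴿ n)           ≈⟨ +-congˡ (distribˡ x _ _) ⟩
    1# + (x * geometric n x + x * x ^ᴿ n)       ≈⟨ +-assoc 1# _ _ ⟨
    (1# + x * geometric n x) + x * x ^ᴿ n       ∎

  geometric≈0⇒power≈1 : ∀ n x → geometric n x ≈ 0# → x ^ᴿ n ≈ 1#
  geometric≈0⇒power≈1 n x g≈0 = begin
    x ^ᴿ n                      ≈⟨ +-identityˡ _ ⟨
    0# + x ^ᴿ n                 ≈⟨ +-congʳ g≈0 ⟨
    geometric n x + x ^ᴿ n      ≈⟨ geometric-shift n x ⟨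
    1# + x * geometric n x      ≈⟨ +-congˡ (trans (*-congˡ g≈0) (zeroʳ x)) ⟩
    1# + 0#                     ≈⟨ +-identityʳ 1# ⟩
    1#                          ∎

  geometric-at-1 : ∀ n {x} → x ≈ 1# → geometric n x ≈ ⌜ n ⌝
  geometric-at-1 zero    x≈1 = refl
  geometric-at-1 (suc n) x≈1 = +-congˡ (trans (*-congʳ x≈1) (trans (*-identityˡ _) (geometric-at-1 n x≈1)))

  1^n≈1 : ∀ n → 1# ^ᴿ n ≈ 1#
  1^n≈1 zero    = refl
  1^n≈1 (suc n) = trans (*-identityˡ _) (1^n≈1 n)

  power-multiple : ∀ {x} n → x ^ᴿ n ≈ 1# → ∀ k → x ^ᴿ (k ℕ.* n) ≈ 1#
  power-multiple {x} n xⁿ≈1 k = begin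
    x ^ᴿ (k ℕ.* n)    ≈⟨ ^-congʳ x (ℕ.*-comm k n) ⟩
    x ^ᴿ (n ℕ.* k)    ≈⟨ ^-assocʳ x n k ⟨
    (x ^ᴿ n) ^ᴿ k     ≈⟨ ^-congˡ k xⁿ≈1 ⟩
    1# ^ᴿ k           ≈⟨ 1^n≈1 k ⟩
    1#                ∎

-- The zero-product rule in a form that survives when equality is not decidable.
NoZeroDivisors : Ring₀ → Set
NoZeroDivisors R = ∀ {x y} → x * y ≈ 0# → ¬ x ≈ 0# → y ≈ 0#
  where open CommutativeRing R

module DomainProperties (R : Ring₀)
  (1≉0 : ¬ CommutativeRing._≈_ R (CommutativeRing.1# R) (CommutativeRing.0# R))
  (noZeroDivisors : NoZeroDivisors R) where
  open CommutativeRing R hiding (zero)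
  open CommutativeRingProperties R
  open GroupProperties +-group using () renaming (x∙y⁻¹≈ε⇒x≈y to x-y≈0⇒x≈y)
  open Powers R
  open Exp semiring using (^-homo-*)
  open SetoidReasoning setoid

  *-cancelˡ : ∀ {x y z} → ¬ x ≈ 0# → x * y ≈ x * z → y ≈ z
  *-cancelˡ {x} {y} {z} x≉0 xy≈xz = x-y≈0⇒x≈y y z (noZeroDivisors (begin
    x * (y - z)      ≈⟨ solve 3 (λ x y z → x :* (y :- z) := x :* y :- x :* z) refl x y z ⟩
    x * y - x * z    ≈⟨ +-congʳ xy≈xz ⟩
    x * z - x * z    ≈⟨ -‿inverseʳ _ ⟩
    0#               ∎) x≉0)
    where open Solver

  -- If no r + a vanished, the m-th differences of (r + a)ᵐ = 1 would be both 0
  -- and m!.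
  fixed-by-power⇒¬¬integer : ∀ {p} → Prime p → ⌜ p ⌝ ≈ 0# →
    ∀ r → (∀ a → (r + ⌜ a ⌝) ^ᴿ p ≈ r + ⌜ a ⌝) → ¬ (∀ a → ¬ r + ⌜ a ⌝ ≈ 0#)
  fixed-by-power⇒¬¬integer {zero}        pr = ⊥-elim (¬prime[0] pr)
  fixed-by-power⇒¬¬integer {suc zero}    pr = ⊥-elim (¬prime[1] pr)
  fixed-by-power⇒¬¬integer {suc (suc m)} pr p≈0 r fixed nonzero =
    ℕ.<-irrefl ≡.refl (prime∣!⇒≤ pr (suc m) (fromℕ≈0⇒∣ _ (begin
      ⌜ suc m ! ⌝                                        ≈⟨ Δ^-power r (suc m) 0 ⟨
      Δ^ (suc m) (λ a → (r + ⌜ a ⌝) ^ᴿ suc m) 0          ≈⟨ Δ^-const powers≈1 m 0 ⟩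
      0#                                                 ∎)))
    where
    open FiniteDifferences R
    open PrimeCharacteristic R 1≉0 pr p≈0
    powers≈1 : ∀ a → (r + ⌜ a ⌝) ^ᴿ suc m ≈ 1#
    powers≈1 a = *-cancelˡ (nonzero a) (trans (fixed a) (sym (*-identityʳ _)))

  private
    Bézout⇒≈1 : ∀ {z m n} x y → 1 ℕ.+ y ℕ.* n ≡ x ℕ.* m → z ^ᴿ m ≈ 1# → z ^ᴿ n ≈ 1# → z ≈ 1#
    Bézout⇒≈1 {z} {m} {n} x y eq zᵐ≈1 zⁿ≈1 = begin
      z                         ≈⟨ *-identityʳ z ⟨
      z * 1#                    ≈⟨ *-congˡ (power-multiple n zⁿ≈1 y) ⟨
      z ^ᴿ (1 ℕ.+ y ℕ.* n)      ≡⟨ ≡.cong (z ^ᴿ_) eq ⟩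
      z ^ᴿ (x ℕ.* m)            ≈⟨ power-multiple m zᵐ≈1 x ⟩
      1#                        ∎

  module PrimitiveRoot {ℓ} (ℓ-prime : Prime ℓ) (ℓ≉0 : ¬ ⌜ ℓ ⌝ ≈ 0#)
                       {z} (gz≈0 : geometric ℓ z ≈ 0#) where

    z^ℓ≈1 : z ^ᴿ ℓ ≈ 1#
    z^ℓ≈1 = geometric≈0⇒power≈1 ℓ z gz≈0

    z≉0 : ¬ z ≈ 0#
    z≉0 z≈0 = 1≉0 (begin
      1#                          ≈⟨ z^ℓ≈1 ⟨
      z ^ᴿ ℓ                      ≈⟨ at-0 ℓ ℓ-prime ⟩
      0#                          ∎)
      where
      at-0 : ∀ n → Prime n → z ^ᴿ n ≈ 0#
      at-0 (suc n) _ = trans (*-congʳ z≈0) (zeroˡ _)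

    z^n≉0 : ∀ n → ¬ z ^ᴿ n ≈ 0#
    z^n≉0 zero    e = 1≉0 e
    z^n≉0 (suc n) e = z^n≉0 n (noZeroDivisors e z≉0)

    -- The sum 1 + z + ... + z^(ℓ-1) equals ℓ at z = 1. Primitivity is assumed through this sum
    -- because an equation passes from Ω to the residue ring, while the inequality ζ ≠ 1 would not.
    z≉1 : ¬ z ≈ 1#
    z≉1 z≈1 = ℓ≉0 (trans (sym (geometric-at-1 ℓ z≈1)) gz≈0)

    order : ∀ n → z ^ᴿ n ≈ 1# → ℓ ∣ n
    order n zⁿ≈1 with ℓ ∣? n
    ... | yes ℓ∣n = ℓ∣n
    ... | no  ℓ∤n with coprime-Bézout (prime∤⇒coprime ℓ-prime ℓ∤n)
    ...   | Bézout.+- x y eq = ⊥-elim (z≉1 (Bézout⇒≈1 x y eq z^ℓ≈1 zⁿ≈1))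
    ...   | Bézout.-+ x y eq = ⊥-elim (z≉1 (Bézout⇒≈1 y x eq zⁿ≈1 z^ℓ≈1))

    private
      equal-powers-+ : ∀ a k → z ^ᴿ a ≈ z ^ᴿ (a ℕ.+ k) → ℓ ∣ k
      equal-powers-+ a k e = order k (sym (*-cancelˡ (z^n≉0 a) (begin
        z ^ᴿ a * 1#          ≈⟨ *-identityʳ _ ⟩
        z ^ᴿ a               ≈⟨ e ⟩
        z ^ᴿ (a ℕ.+ k)       ≈⟨ ^-homo-* z a k ⟩
        z ^ᴿ a * z ^ᴿ k      ∎)))

    module _ (κ : Ring₀) (ℓ≈0 : CommutativeRing._≈_ κ (fromℕ κ ℓ) (CommutativeRing.0# κ)) where
      private
        module κ = CommutativeRing κ
        module κP = CommutativeRingProperties κ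

        fromℕ-+-multiple : ∀ a {k} → ℓ ∣ k → fromℕ κ a κ.≈ fromℕ κ (a ℕ.+ k)
        fromℕ-+-multiple a (divides c ≡.refl) = κ.sym (κ.trans (κP.fromℕ-+ a (c ℕ.* ℓ))
          (κ.trans (κ.+-congˡ (κ.trans (κP.fromℕ-* c ℓ) (κ.trans (κ.*-congˡ ℓ≈0) (κ.zeroʳ _)))) (κ.+-identityʳ _)))

        wlog : ∀ {a b} → a ≤ b → z ^ᴿ a ≈ z ^ᴿ b → fromℕ κ a κ.≈ fromℕ κ b
        wlog {a} {b} a≤b e = ≡.subst (λ n → fromℕ κ a κ.≈ fromℕ κ n) (ℕ.m+[n∸m]≡n a≤b)
          (fromℕ-+-multiple a (equal-powers-+ a (b ∸ a)
            (≡.subst (λ n → z ^ᴿ a ≈ z ^ᴿ n) (≡.sym (ℕ.m+[n∸m]≡n a≤b)) e)))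

      -- `IsModCyclotomic` offers some exponent a with g ζ = ζ^a, not a canonical one. As z has
      -- exact order ℓ, exponents giving the same power are congruent mod ℓ, hence agree in κ, where
      -- ℓ = 0.
      equal-powers : ∀ {a b} → z ^ᴿ a ≈ z ^ᴿ b → fromℕ κ a κ.≈ fromℕ κ b
      equal-powers {a} {b} e with ℕ.≤-total a b
      ... | inj₁ a≤b = wlog a≤b e
      ... | inj₂ b≤a = κ.sym (wlog b≤a (sym e))

-- The residue field of a place

module Residue {Q̄ : AlgebraicClosureOfℚ} {p : ℕ} (𝔓 : Place Q̄ p) where
  open AlgebraicClosureOfℚ Q̄
  open Place 𝔓
  open CommutativeRingProperties Ω using (module Solver; ⌜_⌝; _^ᴿ_)
  open SetoidReasoning setoid

  1≉0 : ¬ 1# ≈ 0#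
  1≉0 = IsField.1≉0 isField

  0-mem : 𝒪 0#
  0-mem = resp (-‿inverseʳ 1#) (+-mem 1-mem (neg-mem 1-mem))

  Unit-resp : ∀ {x y} → x ≈ y → Unit x → Unit y
  Unit-resp x≈y (u , m , xu≈1) = u , m , trans (*-congʳ (sym x≈y)) xu≈1

  𝔪-resp : ∀ {x y} → x ≈ y → 𝔪 x → 𝔪 y
  𝔪-resp x≈y (m , n) = resp x≈y m , λ u → n (Unit-resp (sym x≈y) u)

  𝔪-0 : 𝔪 0#
  𝔪-0 = 0-mem , λ (u , _ , 0u≈1) → 1≉0 (trans (sym 0u≈1) (zeroˡ u))

  𝔪-* : ∀ {x y} → 𝒪 x → 𝔪 y → 𝔪 (x * y)
  𝔪-* {x} {y} o (m , n) = *-mem o m , λ (u , ou , xyu≈1) →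
    n (x * u , *-mem o ou , trans (solve 3 (λ x y u → y :* (x :* u) := (x :* y) :* u) refl x y u) xyu≈1)
    where open Solver

  𝔪-neg : ∀ {x} → 𝔪 x → 𝔪 (- x)
  𝔪-neg {x} m = 𝔪-resp (solve 1 (λ x → (:- con (+ 1)) :* x := :- x) refl x) (𝔪-* (neg-mem 1-mem) m)
    where open Solver

  private
    -- x + y = y (1 + x/y) when x/y is integral.
    ¬Unit-+ : ∀ {x y y⁻¹} → y * y⁻¹ ≈ 1# → 𝒪 (x * y⁻¹) → ¬ Unit y → ¬ Unit (x + y)
    ¬Unit-+ {x} {y} {y⁻¹} yy⁻¹≈1 o n (u , ou , [x+y]u≈1) =
      n ((1# + x * y⁻¹) * u , *-mem (+-mem 1-mem o) ou , (begin
        y * ((1# + x * y⁻¹) * u)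
          ≈⟨ solve 4 (λ x y v u → y :* ((con (+ 1) :+ x :* v) :* u) := (x :* (y :* v) :+ y) :* u) refl x y y⁻¹ u ⟩
        (x * (y * y⁻¹) + y) * u     ≈⟨ *-congʳ (+-congʳ (trans (*-congˡ yy⁻¹≈1) (*-identityʳ x))) ⟩
        (x + y) * u                 ≈⟨ [x+y]u≈1 ⟩
        1#                          ∎))
      where open Solver

  -- `total`, applied to x/y and y/x, whose product is 1, makes one of them integral. The cases x ≈
  -- 0 and y ≈ 0, where a quotient is missing, can be split off because Ω satisfies `IsField`.
  𝔪-+ : ∀ {x y} → 𝔪 x → 𝔪 y → 𝔪 (x + y)
  𝔪-+ {x} {y} mx@(ox , nx) my@(oy , ny) with IsField.zero⊎unit isField x | IsField.zero⊎unit isField y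
  ... | inj₁ x≈0 | _ = 𝔪-resp (sym (trans (+-congʳ x≈0) (+-identityˡ y))) my
  ... | inj₂ _ | inj₁ y≈0 = 𝔪-resp (sym (trans (+-congˡ y≈0) (+-identityʳ x))) mx
  ... | inj₂ (x⁻¹ , xx⁻¹≈1) | inj₂ (y⁻¹ , yy⁻¹≈1) = +-mem ox oy , not-unit
    where
    open Solver
    quotients : (x * y⁻¹) * (y * x⁻¹) ≈ 1#
    quotients = begin
      (x * y⁻¹) * (y * x⁻¹)    ≈⟨ solve 4 (λ x x′ y y′ → (x :* y′) :* (y :* x′) := (x :* x′) :* (y :* y′)) refl x x⁻¹ y y⁻¹ ⟩
      (x * x⁻¹) * (y * y⁻¹)    ≈⟨ *-cong xx⁻¹≈1 yy⁻¹≈1 ⟩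
      1# * 1#                  ≈⟨ *-identityˡ 1# ⟩
      1#                       ∎
    not-unit : ¬ Unit (x + y)
    not-unit u with total _ _ quotients
    ... | inj₁ o = ¬Unit-+ yy⁻¹≈1 o ny u
    ... | inj₂ o = ¬Unit-+ xx⁻¹≈1 o nx (Unit-resp (+-comm x y) u)

  opaque
    -- The quotient by 𝔪 is placed in the equality, with 𝒪 as carrier. Units of 𝒪 cannot be
    -- recognised, so zero-or-unit is out of reach; `residue-noZeroDivisors` and `residue-stable`
    -- serve in its stead.
    residueRing : Ring₀
    residueRing = record
      { Carrier = Σ Carrier 𝒪
      ; _≈_ = λ x y → 𝔪 (proj₁ x - proj₁ y)
      ; _+_ = λ x y → proj₁ x + proj₁ y , +-mem (proj₂ x) (proj₂ y)
      ; _*_ = λ x y → proj₁ x * proj₁ y , *-mem (proj₂ x) (proj₂ y)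
      ; -_  = λ x → - proj₁ x , neg-mem (proj₂ x)
      ; 0#  = 0# , 0-mem
      ; 1#  = 1# , 1-mem
      ; isCommutativeRing = record
        { isRing = record
          { +-isAbelianGroup = record
            { isGroup = record
              { isMonoid = record
                { isSemigroup = record
                  { isMagma = record
                    { isEquivalence = record
                      { refl  = lift refl
                      ; sym   = λ {x} {y} m → 𝔪-resp
                          (solve 2 (λ x y → :- (x :- y) := y :- x) refl (proj₁ x) (proj₁ y)) (𝔪-neg m)
                      ; trans = λ {x} {y} {z} m n → 𝔪-resp
                          (solve 3 (λ x y z → (x :- y) :+ (y :- z) := x :- z) refl (proj₁ x) (proj₁ y) (proj₁ z)) (𝔪-+ m n)
                      }
                    ; ∙-cong = λ {x} {x′} {y} {y′} m n → 𝔪-resp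
                        (solve 4 (λ x x′ y y′ → (x :- x′) :+ (y :- y′) := (x :+ y) :- (x′ :+ y′)) refl
                          (proj₁ x) (proj₁ x′) (proj₁ y) (proj₁ y′)) (𝔪-+ m n)
                    }
                  ; assoc = λ x y z → lift (+-assoc _ _ _)
                  }
                ; identity = (λ x → lift (+-identityˡ _)) , (λ x → lift (+-identityʳ _))
                }
              ; inverse = (λ x → lift (-‿inverseˡ _)) , (λ x → lift (-‿inverseʳ _))
              ; ⁻¹-cong = λ {x} {y} m → 𝔪-resp
                  (solve 2 (λ x y → :- (x :- y) := :- x :- :- y) refl (proj₁ x) (proj₁ y)) (𝔪-neg m)
              }
            ; comm = λ x y → lift (+-comm _ _)
            }
          ; *-cong = λ {x} {x′} {y} {y′} m n → 𝔪-resp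
              (solve 4 (λ x x′ y y′ → y :* (x :- x′) :+ x′ :* (y :- y′) := x :* y :- x′ :* y′) refl
                (proj₁ x) (proj₁ x′) (proj₁ y) (proj₁ y′))
              (𝔪-+ (𝔪-* (proj₂ y) m) (𝔪-* (proj₂ x′) n))
          ; *-assoc = λ x y z → lift (*-assoc _ _ _)
          ; *-identity = (λ x → lift (*-identityˡ _)) , (λ x → lift (*-identityʳ _))
          ; distrib = (λ x y z → lift (distribˡ _ _ _)) , (λ x y z → lift (distribʳ _ _ _))
          }
        ; *-comm = λ x y → lift (*-comm _ _)
        }
      }
      where
      open Solver
      lift : ∀ {x y} → x ≈ y → 𝔪 (x - y)
      lift {x} {y} x≈y = 𝔪-resp (sym (trans (+-congʳ x≈y) (-‿inverseʳ y))) 𝔪-0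

  module 𝔽 where
    open CommutativeRing residueRing public
    open CommutativeRingProperties residueRing public

  opaque
    unfolding residueRing

    residue : ∀ x → 𝒪 x → 𝔽.Carrier
    residue x o = x , o

    value : 𝔽.Carrier → Carrier
    value = proj₁

    value-injective : ∀ x y → value x ≈ value y → x 𝔽.≈ y
    value-injective x y x≈y = 𝔪-resp (sym (trans (+-congʳ x≈y) (-‿inverseʳ _))) 𝔪-0

    residue-* : ∀ {x y o o′ o″} → residue x o 𝔽.* residue y o′ 𝔽.≈ residue (x * y) o″
    residue-* {x} {y} {o} {o′} {o″} = value-injective (residue x o 𝔽.* residue y o′) (residue (x * y) o″) refl

    residue-neg : ∀ {x o o′} → 𝔽.- residue x o 𝔽.≈ residue (- x) o′
    residue-neg {x} {o} {o′} = value-injective (𝔽.- residue x o) (residue (- x) o′) refl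

    private
      value-fromℕ : ∀ n → value 𝔽.⌜ n ⌝ ≈ ⌜ n ⌝
      value-fromℕ zero    = refl
      value-fromℕ (suc n) = +-congˡ (value-fromℕ n)

      value-^ : ∀ x n → value (x 𝔽.^ᴿ n) ≈ value x ^ᴿ n
      value-^ x zero    = refl
      value-^ x (suc n) = *-congˡ (value-^ x n)

      value-geometric : ∀ n x → value (Powers.geometric residueRing n x) ≈ Powers.geometric Ω n (value x)
      value-geometric zero    x = refl
      value-geometric (suc n) x = +-congˡ (*-congˡ (value-geometric n x))

      value-fromℤ : ∀ i → value (fromℤ residueRing i) ≈ fromℤ Ω i
      value-fromℤ (+ n)        = value-fromℕ n
      value-fromℤ Int.-[1+ n ] = -‿cong (value-fromℕ (suc n))

      ≈0⇒𝔪 : ∀ {x : 𝔽.Carrier} → x 𝔽.≈ 𝔽.0# → 𝔪 (value x)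
      ≈0⇒𝔪 {x} = 𝔪-resp (solve 1 (λ x → x :- con (+ 0) := x) refl (value x))
        where open Solver

      𝔪⇒≈0 : ∀ {x : 𝔽.Carrier} → 𝔪 (value x) → x 𝔽.≈ 𝔽.0#
      𝔪⇒≈0 {x} = 𝔪-resp (solve 1 (λ x → x := x :- con (+ 0)) refl (value x))
        where open Solver

    fromℤ-mem : ∀ i → 𝒪 (fromℤ Ω i)
    fromℤ-mem i = resp (value-fromℤ i) (proj₂ (fromℤ residueRing i))

    residue-fromℤ : ∀ {x o} i → x ≈ fromℤ Ω i → residue x o 𝔽.≈ fromℤ residueRing i
    residue-fromℤ {x} {o} i x≈i = value-injective (residue x o) (fromℤ residueRing i) (trans x≈i (sym (value-fromℤ i)))

    residue-^ : ∀ {x o y o′} n → y ≈ x ^ᴿ n → residue y o′ 𝔽.≈ residue x o 𝔽.^ᴿ n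
    residue-^ {x} {o} {y} {o′} n y≈xⁿ = value-injective (residue y o′) (residue x o 𝔽.^ᴿ n) (trans y≈xⁿ (sym (value-^ (x , o) n)))

    residue-geometric : ∀ {x o} n → Powers.geometric Ω n x ≈ 0# →
                        Powers.geometric residueRing n (residue x o) 𝔽.≈ 𝔽.0#
    residue-geometric {x} {o} n e = value-injective (Powers.geometric residueRing n (x , o)) 𝔽.0# (trans (value-geometric n (x , o)) e)

    residue-1≉0 : ¬ 𝔽.1# 𝔽.≈ 𝔽.0#
    residue-1≉0 e = proj₂ (≈0⇒𝔪 {𝔽.1#} e) (1# , 1-mem , *-identityˡ 1#)

    -- Membership of 𝒪 in 𝔪 is the negation of being a unit, and a negation follows from its double
    -- negation.
    residue-stable : ∀ {x y : 𝔽.Carrier} → ¬ ¬ x 𝔽.≈ y → x 𝔽.≈ y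
    residue-stable {x} {y} ¬¬e = +-mem (proj₂ x) (neg-mem (proj₂ y)) , λ u → ¬¬e (λ (_ , n) → n u)

    -- Suppose y is a unit. Then x is not one, as otherwise xy would be; but a non-unit x is 0 in
    -- the residue ring, against the hypothesis. So y is not a unit.
    residue-noZeroDivisors : NoZeroDivisors residueRing
    residue-noZeroDivisors {x} {y} xy≈0 x≉0 = 𝔪⇒≈0 {y} (proj₂ y , λ (v , ov , yv≈1) →
      x≉0 (𝔪⇒≈0 {x} (proj₂ x , λ (u , ou , xu≈1) →
        proj₂ (≈0⇒𝔪 {x 𝔽.* y} xy≈0) (u * v , *-mem ou ov , (begin
          (proj₁ x * proj₁ y) * (u * v)
            ≈⟨ solve 4 (λ x y u v → (x :* y) :* (u :* v) := (x :* u) :* (y :* v)) refl (proj₁ x) (proj₁ y) u v ⟩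
          (proj₁ x * u) * (proj₁ y * v)    ≈⟨ *-cong xu≈1 yv≈1 ⟩
          1# * 1#                          ≈⟨ *-identityˡ 1# ⟩
          1#                               ∎)))))
      where open Solver

    residue-p≈0 : 𝔽.⌜ p ⌝ 𝔽.≈ 𝔽.0#
    residue-p≈0 = 𝔪⇒≈0 {𝔽.⌜ p ⌝} (proj₂ 𝔽.⌜ p ⌝ , λ u → above (Unit-resp (value-fromℕ p) u))

  module _ (g : Group.Carrier Gₚ) where
    private
      τ = proj₁ g
      module τ = Automorphism τ

    opaque
      unfolding residueRing residue value

      act : 𝔽.Carrier → 𝔽.Carrier
      act (x , o) = τ.ap x , proj₁ (proj₂ g x) o

      act-residue : ∀ {x y o o′} → τ.ap x ≈ y → act (residue x o) 𝔽.≈ residue y o′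
      act-residue {x} {y} {o} {o′} = value-injective (act (x , o)) (y , o′)

      -- If g(x - y) had an inverse u in 𝒪, then g⁻¹u would be inverse to x - y; that it is integral
      -- is the converse half of membership in the decomposition group.
      act-cong : ∀ {x y} → x 𝔽.≈ y → act x 𝔽.≈ act y
      act-cong {x , _} {y , _} (o , n) = 𝔪-resp (begin
          τ.ap (x - y)            ≈⟨ τ.+-homo x (- y) ⟩
          τ.ap x + τ.ap (- y)     ≈⟨ +-congˡ (τ.-‿homo y) ⟩
          τ.ap x - τ.ap y         ∎)
        (proj₁ (proj₂ g (x - y)) o , λ (u , ou , e) →
          let v , τv≈u = τ.surjective u in
          n (v , proj₂ (proj₂ g v) (resp (sym (τv≈u refl)) ou)
               , τ.injective (trans (τ.*-homo _ _) (trans (*-congˡ (τv≈u refl)) (trans e (sym τ.1#-homo))))))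

      act-+ : ∀ x y → act (x 𝔽.+ y) 𝔽.≈ act x 𝔽.+ act y
      act-+ x y = value-injective (act (x 𝔽.+ y)) (act x 𝔽.+ act y) (τ.+-homo _ _)

      act-* : ∀ x y → act (x 𝔽.* y) 𝔽.≈ act x 𝔽.* act y
      act-* x y = value-injective (act (x 𝔽.* y)) (act x 𝔽.* act y) (τ.*-homo _ _)

      act-neg : ∀ x → act (𝔽.- x) 𝔽.≈ 𝔽.- act x
      act-neg x = value-injective (act (𝔽.- x)) (𝔽.- act x) (τ.-‿homo _)

      act-1 : act 𝔽.1# 𝔽.≈ 𝔽.1#
      act-1 = value-injective (act 𝔽.1#) (𝔽.1#) τ.1#-homo

      act-fromℕ : ∀ n → act 𝔽.⌜ n ⌝ 𝔽.≈ 𝔽.⌜ n ⌝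
      act-fromℕ n = value-injective (act 𝔽.⌜ n ⌝) (𝔽.⌜ n ⌝) (trans (τ.⟦⟧-cong (value-fromℕ n))
        (trans (fixes-fromℕ Q̄ τ n) (sym (value-fromℕ n))))

      act-frobenius : IsFrobenius τ → ∀ x → act x 𝔽.≈ x 𝔽.^ᴿ p
      act-frobenius (_ , powers) x =
        𝔪-resp (+-congˡ (-‿cong (sym (value-^ x p)))) (powers (proj₁ x) (proj₂ x))

-- Frobenius, the field ℚₚ(√d) and the cyclotomic character

module Frobenius {Q̄ : AlgebraicClosureOfℚ} {p : ℕ} (𝔓 : Place Q̄ p) (p-prime : Prime p)
                 {σ : Automorphism Q̄} (frob : Place.IsFrobenius 𝔓 σ) where
  open AlgebraicClosureOfℚ Q̄ using (Ω; isField; closed)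
  open Automorphism using (ap)
  open Place 𝔓
  open Residue 𝔓
  open PrimeCharacteristic residueRing residue-1≉0 p-prime residue-p≈0
  open DomainProperties residueRing residue-1≉0 residue-noZeroDivisors
  private module Ω = CommutativeRing Ω
  open 𝔽 hiding (zero)
  open Powers residueRing
  open RingProperties ring using (-‿involutive; -0#≈0#)
  open GroupProperties +-group using () renaming (x∙y⁻¹≈ε⇒x≈y to x-y≈0⇒x≈y)
  open SetoidReasoning setoid

  φ : Group.Carrier Gₚ
  φ = σ , proj₁ frob

  act-φ : ∀ x → act φ x ≈ x ^ᴿ p
  act-φ = act-frobenius φ frob

  -- φ is additive and fixes integers, so with x it fixes every x + a; through φ(y) = y^p this is
  -- the hypothesis on p-th powers. The conclusion is that x lies in 𝔽ₚ, doubly negated.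
  fixed⇒¬¬integer : ∀ {x} → act φ x ≈ x → ¬ (∀ a → ¬ x + ⌜ a ⌝ ≈ 0#)
  fixed⇒¬¬integer {x} fixed = fixed-by-power⇒¬¬integer p-prime residue-p≈0 x λ a → begin
    (x + ⌜ a ⌝) ^ᴿ p            ≈⟨ act-φ (x + ⌜ a ⌝) ⟨
    act φ (x + ⌜ a ⌝)           ≈⟨ act-+ φ x ⌜ a ⌝ ⟩
    act φ x + act φ ⌜ a ⌝       ≈⟨ +-cong fixed (act-fromℕ φ a) ⟩
    x + ⌜ a ⌝                   ∎

  -- Integers are fixed by every g, and x is one up to double negation, which may be removed because
  -- the goal is an equality of residues. This plays the part of Frobenius generating the Galois
  -- group of the residue field.
  fixed⇒all-fixed : ∀ {x} → act φ x ≈ x → ∀ g → act g x ≈ x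
  fixed⇒all-fixed {x} fixed g = residue-stable {act g x} {x} λ moved → fixed⇒¬¬integer fixed λ a x+a≈0 →
    moved (x-y≈0⇒x≈y (act g x) x (begin
      act g x - x                                ≈⟨ solve 3 (λ u x n → u :- x := (u :+ n) :- (x :+ n)) refl (act g x) x ⌜ a ⌝ ⟩
      (act g x + ⌜ a ⌝) - (x + ⌜ a ⌝)            ≈⟨ +-congʳ (+-congˡ (act-fromℕ g a)) ⟨
      (act g x + act g ⌜ a ⌝) - (x + ⌜ a ⌝)      ≈⟨ +-congʳ (act-+ g x ⌜ a ⌝) ⟨
      act g (x + ⌜ a ⌝) - (x + ⌜ a ⌝)            ≈⟨ +-cong (act-cong g x+a≈0) (-‿cong x+a≈0) ⟩
      act g ⌜ 0 ⌝ - ⌜ 0 ⌝                        ≈⟨ +-congʳ (act-fromℕ g 0) ⟩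
      0# - 0#                                    ≈⟨ -‿inverseʳ 0# ⟩
      0#                                         ∎))
    where open Solver

  fromℤ≈0⇒∣ : ∀ i → fromℤ residueRing i ≈ 0# → + p ∣ℤ i
  fromℤ≈0⇒∣ (+ n)    e = fromℕ≈0⇒∣ n e
  fromℤ≈0⇒∣ -[1+ n ] e = fromℕ≈0⇒∣ (suc n) (trans (sym (-‿involutive _)) (trans (-‿cong e) -0#≈0#))

  module QuadraticExtension (d : ℤ) (nonsquare : ∀ a → ¬ + p ∣ℤ + a Int.* + a Int.- d)
                            {√d : Ω.Carrier} (√d-square : √d Ω.* √d Ω.≈ fromℤ Ω d) where

    √d-integral : 𝒪 √d
    √d-integral with IsField.zero⊎unit isField √d
    ... | inj₁ √d≈0 = resp (Ω.sym √d≈0) 0-mem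
    ... | inj₂ (s , √ds≈1) with total √d s √ds≈1
    ...   | inj₁ o = o
    -- Here s = 1/√d is integral, and √d = d s.
    ...   | inj₂ o = resp d*s≈√d (*-mem (fromℤ-mem d) o)
      where
      d*s≈√d : fromℤ Ω d Ω.* s Ω.≈ √d
      d*s≈√d = Ω.trans (Ω.*-congʳ (Ω.sym √d-square)) (Ω.trans (Ω.*-assoc _ _ _) (Ω.trans (Ω.*-congˡ √ds≈1) (Ω.*-identityʳ √d)))

    r : Carrier
    r = residue √d √d-integral

    r² : r * r ≈ fromℤ residueRing d
    r² = trans (residue-* {o″ = *-mem √d-integral √d-integral}) (residue-fromℤ d √d-square)

    r≢-integer : ∀ a → ¬ r + ⌜ a ⌝ ≈ 0#
    r≢-integer a r+a≈0 = nonsquare a (fromℤ≈0⇒∣ (+ a Int.* + a Int.- d) (begin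
      fromℤ residueRing (+ a Int.* + a Int.- d)
        ≈⟨ trans (fromℤ-+ (+ a Int.* + a) (Int.- d)) (+-cong (fromℤ-* (+ a) (+ a)) (fromℤ-neg d)) ⟩
      ⌜ a ⌝ * ⌜ a ⌝ - fromℤ residueRing d       ≈⟨ +-congˡ (-‿cong r²) ⟨
      ⌜ a ⌝ * ⌜ a ⌝ - r * r                     ≈⟨ solve 2 (λ a r → a :* a :- r :* r := (r :+ a) :* (a :- r)) refl ⌜ a ⌝ r ⟩
      (r + ⌜ a ⌝) * (⌜ a ⌝ - r)                 ≈⟨ *-congʳ r+a≈0 ⟩
      0# * (⌜ a ⌝ - r)                          ≈⟨ zeroˡ _ ⟩
      0#                                        ∎))
      where open Solver

    r≉0 : ¬ r ≈ 0#
    r≉0 r≈0 = r≢-integer 0 (trans (+-identityʳ r) r≈0)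

    φ-moves-√d : ¬ ap σ √d Ω.≈ √d
    φ-moves-√d fixed = fixed⇒¬¬integer {r} (act-residue φ fixed) r≢-integer

    φ-negates-√d : ap σ √d Ω.≈ Ω.- √d
    φ-negates-√d with image-of-root Q̄ {d} √d-square σ
    ... | inj₁ fixed   = ⊥-elim (φ-moves-√d fixed)
    ... | inj₂ negated = negated

    φr≈-r : act φ r ≈ - r
    φr≈-r = trans (act-residue φ {o′ = neg-mem √d-integral} φ-negates-√d) (sym residue-neg)

    -- The sign in g√d = ±√d is found explicitly, and for the negative sign φ⁻¹ contributes a second
    -- one.
    side : ∀ g → Subgroup.Member (stabiliser √d) g ⊎
                 Subgroup.Member (stabiliser √d) (Group._∙_ Gₚ g (Group._⁻¹ Gₚ φ))
    side g with image-of-root Q̄ {d} √d-square (proj₁ g)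
    ... | inj₁ fixed   = inj₁ fixed
    ... | inj₂ negated = inj₂ (Ω.trans (g.⟦⟧-cong φ⁻¹√d≈-√d)
      (Ω.trans (g.-‿homo √d) (Ω.trans (Ω.-‿cong negated) (Ω-‿involutive √d))))
      where
      open RingProperties Ω.ring using () renaming (-‿involutive to Ω-‿involutive)
      module g = Automorphism (proj₁ g)
      module σ = Automorphism σ
      φ⁻¹√d≈-√d : ap (proj₁ (Group._⁻¹ Gₚ φ)) √d Ω.≈ Ω.- √d
      φ⁻¹√d≈-√d = σ.injective (Ω.trans (Group.inverseʳ Gₚ φ √d)
        (Ω.sym (Ω.trans (σ.-‿homo √d) (Ω.trans (Ω.-‿cong φ-negates-√d) (Ω-‿involutive √d)))))

  module Cyclotomic {ℓ : ℕ} (ℓ-prime : Prime ℓ) (p≢ℓ : p ≢ ℓ)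
                    (κ : Ring₀) (κ-ℓ≈0 : CommutativeRing._≈_ κ (fromℕ κ ℓ) (CommutativeRing.0# κ))
                    (ε : Character (Gℚ Q̄) κ) (ε-cyclotomic : IsModCyclotomic Q̄ ℓ ε) where
    private
      module κ = CommutativeRing κ
      module ΩE = Exp Ω.semiring

      replicate-++ : ∀ k → replicate k Ω.1# ++ [ Ω.1# ] ≡ replicate (suc k) Ω.1#
      replicate-++ zero    = ≡.refl
      replicate-++ (suc k) = ≡.cong (Ω.1# ∷_) (replicate-++ k)

      root : ∀ {n} → Prime n → ∃ λ ζ → Powers.geometric Ω n ζ Ω.≈ Ω.0#
      root {zero}        pr = ⊥-elim (¬prime[0] pr)
      root {suc zero}    pr = ⊥-elim (¬prime[1] pr)
      -- `closed` appends the leading coefficient itself, so the constant term, k further ones and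
      -- the leading one make up the k + 2 coefficients.
      root {suc (suc k)} pr with closed Ω.1# (replicate k Ω.1#)
      ... | ζ , e rewrite replicate-++ k = ζ , e

      -- If x is not seen to be integral, its inverse y = x^(n-1) is; y is again an n-th root of
      -- unity, so x = y⁻¹ = y^(n-1) is integral as well.
      integral : ∀ {n} → Prime n → ∀ {x} → _^ʳ_ Ω x n Ω.≈ Ω.1# → 𝒪 x
      integral {zero}  pr = ⊥-elim (¬prime[0] pr)
      integral {suc k} pr {x} xⁿ≈1 with total x (_^ʳ_ Ω x k) xⁿ≈1
      ... | inj₁ o = o
      ... | inj₂ o = resp y^k≈x (power-mem k)
        where
        y = _^ʳ_ Ω x k
        power-mem : ∀ j → 𝒪 (_^ʳ_ Ω y j)
        power-mem zero    = 1-mem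
        power-mem (suc j) = *-mem o (power-mem j)
        yⁿ≈1 : _^ʳ_ Ω y (suc k) Ω.≈ Ω.1#
        yⁿ≈1 = Ω.trans (ΩE.^-assocʳ x k (suc k)) (Powers.power-multiple Ω (suc k) xⁿ≈1 k)
        y^k≈x : _^ʳ_ Ω y k Ω.≈ x
        y^k≈x = Ω.trans (Ω.sym (Ω.*-identityˡ _)) (Ω.trans (Ω.*-congʳ (Ω.sym xⁿ≈1))
          (Ω.trans (Ω.*-assoc _ _ _) (Ω.trans (Ω.*-congˡ yⁿ≈1) (Ω.*-identityʳ x))))

    ζ : Ω.Carrier
    ζ = proj₁ (root ℓ-prime)

    ζ^ℓ≈1 : _^ʳ_ Ω ζ ℓ Ω.≈ Ω.1#
    ζ^ℓ≈1 = Powers.geometric≈0⇒power≈1 Ω ℓ ζ (proj₂ (root ℓ-prime))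

    z : Carrier
    z = residue ζ (integral ℓ-prime ζ^ℓ≈1)

    private
      ℓ≉0 : ¬ ⌜ ℓ ⌝ ≈ 0#
      ℓ≉0 e with prime⇒irreducible ℓ-prime (fromℕ≈0⇒∣ ℓ e)
      ... | inj₁ ≡.refl = ¬prime[1] p-prime
      ... | inj₂ p≡ℓ    = p≢ℓ p≡ℓ

      geometric-z : geometric ℓ z ≈ 0#
      geometric-z = residue-geometric ℓ (proj₂ (root ℓ-prime))

    open PrimitiveRoot ℓ-prime ℓ≉0 geometric-z

    ε-from-action : ∀ {g} b → act g z ≈ z ^ᴿ b → at ε (proj₁ g) κ.≈ fromℕ κ b
    ε-from-action {g} b e with ε-cyclotomic (proj₁ g)
    ... | a , gζ≈ζ^a , εg≈a = κ.trans εg≈a (equal-powers κ κ-ℓ≈0 {a} {b}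
      (trans (sym (residue-^ {o′ = proj₁ (proj₂ g ζ) (integral ℓ-prime ζ^ℓ≈1)} a (gζ≈ζ^a ζ ζ^ℓ≈1))) (trans (sym (act-residue g Ω.refl)) e)))

    ε-φ : at ε σ κ.≈ fromℕ κ p
    ε-φ = ε-from-action {φ} p (act-φ z)

    private
      ε-trivial : ∀ {g} → act g z ≈ z → at ε (proj₁ g) κ.≈ κ.1#
      ε-trivial {g} e = κ.trans (ε-from-action {g} 1 (trans e (sym (*-identityʳ z)))) (κ.+-identityʳ κ.1#)

      z^multiple : ∀ {n} → ℓ ∣ n → z ^ᴿ n ≈ 1#
      z^multiple (divides k ≡.refl) = power-multiple ℓ z^ℓ≈1 k

      suc-p∸1 : ∀ {n} → Prime n → suc (n ∸ 1) ≡ n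
      suc-p∸1 {zero}  pr = ⊥-elim (¬prime[0] pr)
      suc-p∸1 {suc n} pr = ≡.refl

    -- As z^(p-1) = 1, Frobenius fixes z, and hence so does all of Gₚ, not just G_K.
    p≡1⇒ε-trivial : ℓ ∣ p ∸ 1 → ∀ (g : Group.Carrier Gₚ) → at ε (proj₁ g) κ.≈ κ.1#
    p≡1⇒ε-trivial ℓ∣p-1 g = ε-trivial {g} (fixed⇒all-fixed {z} (begin
      act φ z               ≈⟨ act-φ z ⟩
      z ^ᴿ p                ≡⟨ ≡.cong (z ^ᴿ_) (suc-p∸1 p-prime) ⟨
      z * z ^ᴿ (p ∸ 1)      ≈⟨ *-congˡ (z^multiple ℓ∣p-1) ⟩
      z * 1#                ≈⟨ *-identityʳ z ⟩
      z                     ∎) g)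

    module _ (3≤p : 3 ≤ p) (d : ℤ) (nonsquare : ∀ a → ¬ + p ∣ℤ + a Int.* + a Int.- d)
             {√d : Ω.Carrier} (√d-square : √d Ω.* √d Ω.≈ fromℤ Ω d) where
      open QuadraticExtension d nonsquare √d-square

      -- Frobenius inverts z and negates r, so it fixes z + z⁻¹ and (z - z⁻¹) r.
      p≡-1⇒ε-trivial : ℓ ∣ suc p → ∀ (g : Group.Carrier Gₚ) → ap (proj₁ g) √d Ω.≈ √d →
                       at ε (proj₁ g) κ.≈ κ.1#
      -- Multiplying the fixed sum by r and adding the fixed difference term recovers 2rz, and 2r
      -- can be cancelled because p is odd and r ≠ 0.
      p≡-1⇒ε-trivial ℓ∣1+p g g-fixes = ε-trivial {g} (*-cancelˡ 2r≉0 (begin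
        (⌜ 2 ⌝ * r) * act g z
          ≈⟨ solve 3 (λ r x y → (two :* r) :* x := (x :+ y) :* r :+ (x :- y) :* r) refl r (act g z) (act g z′) ⟩
        (act g z + act g z′) * r + (act g z - act g z′) * r
          ≈⟨ +-cong (*-congʳ sum-fixed) difference-fixed ⟩
        (z + z′) * r + (z - z′) * r
          ≈⟨ solve 3 (λ r x y → (x :+ y) :* r :+ (x :- y) :* r := (two :* r) :* x) refl r z z′ ⟩
        (⌜ 2 ⌝ * r) * z    ∎))
        where
        open Solver
        two : ∀ {n} → Polynomial n
        two = con (+ 1) :+ (con (+ 1) :+ con (+ 0))

        2r≉0 : ¬ ⌜ 2 ⌝ * r ≈ 0#
        2r≉0 e = r≉0 (residue-noZeroDivisors e λ 2≈0 →
          ℕ.<-irrefl ≡.refl (ℕ.≤-trans 3≤p (∣⇒≤ (fromℕ≈0⇒∣ 2 2≈0))))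

        z′ : Carrier
        z′ = z ^ᴿ p

        zz′≈1 : z * z′ ≈ 1#
        zz′≈1 = z^multiple ℓ∣1+p

        φz′≈z : act φ z′ ≈ z
        φz′≈z = *-cancelˡ (z^n≉0 p) (begin
          z′ * act φ z′          ≈⟨ *-congʳ (act-φ z) ⟨
          act φ z * act φ z′     ≈⟨ act-* φ z z′ ⟨
          act φ (z * z′)         ≈⟨ act-cong φ {z * z′} {1#} zz′≈1 ⟩
          act φ 1#               ≈⟨ act-1 φ ⟩
          1#                     ≈⟨ zz′≈1 ⟨
          z * z′                 ≈⟨ *-comm z z′ ⟩
          z′ * z                 ∎)

        act-difference : ∀ h → act h (z - z′) ≈ act h z - act h z′
        act-difference h = trans (act-+ h z (- z′)) (+-congˡ (act-neg h z′))

        sum-fixed : act g z + act g z′ ≈ z + z′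
        sum-fixed = trans (sym (act-+ g z z′)) (fixed⇒all-fixed {z + z′} (begin
          act φ (z + z′)         ≈⟨ act-+ φ z z′ ⟩
          act φ z + act φ z′     ≈⟨ +-cong (act-φ z) φz′≈z ⟩
          z′ + z                 ≈⟨ +-comm z′ z ⟩
          z + z′                 ∎) g)

        difference-fixed : (act g z - act g z′) * r ≈ (z - z′) * r
        difference-fixed = begin
          (act g z - act g z′) * r        ≈⟨ *-cong (act-difference g) (act-residue g g-fixes) ⟨
          act g (z - z′) * act g r        ≈⟨ act-* g (z - z′) r ⟨
          act g ((z - z′) * r)            ≈⟨ fixed⇒all-fixed {(z - z′) * r} (begin
            act φ ((z - z′) * r)          ≈⟨ act-* φ (z - z′) r ⟩
            act φ (z - z′) * act φ r      ≈⟨ *-cong (trans (act-difference φ) (+-cong (act-φ z) (-‿cong φz′≈z))) φr≈-r ⟩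
            (z′ - z) * - r                ≈⟨ solve 3 (λ r x y → (y :- x) :* (:- r) := (x :- y) :* r) refl r z z′ ⟩
            (z - z′) * r                  ∎) g ⟩
          (z - z′) * r                    ∎

-- Fields and isomorphisms of representations

field⇒noZeroDivisors : ∀ (κ : Ring₀) → IsField κ → NoZeroDivisors κ
field⇒noZeroDivisors κ isField {x} {y} xy≈0 x≉0 with IsField.zero⊎unit isField x
... | inj₁ x≈0 = ⊥-elim (x≉0 x≈0)
... | inj₂ (x⁻¹ , xx⁻¹≈1) = begin
  y                    ≈⟨ *-identityˡ y ⟨
  1# * y              ≈⟨ *-congʳ xx⁻¹≈1 ⟨
  (x * x⁻¹) * y      ≈⟨ solve 3 (λ x x′ y → (x :* x′) :* y := x′ :* (x :* y)) refl x x⁻¹ y ⟩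
  x⁻¹ * (x * y)      ≈⟨ *-congˡ xy≈0 ⟩
  x⁻¹ * 0#            ≈⟨ zeroʳ x⁻¹ ⟩
  0#                   ∎
  where
  open CommutativeRing κ
  open CommutativeRingProperties κ using (module Solver)
  open Solver
  open SetoidReasoning setoid

module ≅-Properties {G : Group₀} {κ : Ring₀} {V W : Rep G κ} (Θ : V ≅ W) where
  private
    module V = Rep V
    module W = Rep W
  open _≅_ Θ public
  open LeftModuleMorphisms.IsLeftModuleIsomorphism isLeftModuleIsomorphism public

  equivariant-≈ : ∀ g v {v′} → v′ V.≈ᴹ V.act g v → to v′ W.≈ᴹ W.act g (to v)
  equivariant-≈ g v v′≈gv = W.≈ᴹ-trans (⟦⟧-cong v′≈gv) (equivariant g v)

module _ {G : Group₀} {κ : Ring₀} {V W : Rep G κ} where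
  private
    module G = Group G
    module V = Rep V
    module W = Rep W

  -- Equivariance is asked for up to ≈ᴹ: a literal to (V.act g v) would carry along the
  -- proof components of V.act g v.
  mk≅ : (to : V.Carrierᴹ → W.Carrierᴹ) →
    (∀ {v w} → v V.≈ᴹ w → to v W.≈ᴹ to w) →
    (∀ v w → to (v V.+ᴹ w) W.≈ᴹ to v W.+ᴹ to w) →
    to V.0ᴹ W.≈ᴹ W.0ᴹ →
    (∀ v → to (V.-ᴹ v) W.≈ᴹ W.-ᴹ to v) →
    (∀ r v → to (r V.*ₗ v) W.≈ᴹ r W.*ₗ to v) →
    (∀ {v w} → to v W.≈ᴹ to w → v V.≈ᴹ w) →
    (∀ w → ∃ λ v → ∀ {v′} → v′ V.≈ᴹ v → to v′ W.≈ᴹ w) →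
    (∀ g v {v′} → v′ V.≈ᴹ V.act g v → to v′ W.≈ᴹ W.act g (to v)) →
    V ≅ W
  mk≅ to cong +-homo 0-homo neg-homo *-homo injective surjective equivariant = record
    { to = to
    ; isLeftModuleIsomorphism = record
      { isLeftModuleMonomorphism = record
        { isLeftModuleHomomorphism = record
          { +ᴹ-isGroupHomomorphism = record
            { isMonoidHomomorphism = record
              { isMagmaHomomorphism = record
                { isRelHomomorphism = record { cong = cong }
                ; homo = +-homo
                }
              ; ε-homo = 0-homo
              }
            ; ⁻¹-homo = neg-homo
            }
          ; *ₗ-homo = *-homo
          }
        ; injective = injective
        }
      ; surjective = surjective
      }
    ; equivariant = λ g v → equivariant g v V.≈ᴹ-refl
    }

pattern 0F = zero
pattern 1F = suc zero

-- Representations induced from a subgroup of index two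

module IndexTwo {G : Group₀} {κ : Ring₀} (H : Subgroup G) (φ : Group.Carrier G)
  (normal : ∀ {g} → Subgroup.Member H g →
            Subgroup.Member H (Group._∙_ G (Group._∙_ G (Group._⁻¹ G φ) g) φ))
  (side : ∀ g → Subgroup.Member H g ⊎ Subgroup.Member H (Group._∙_ G g (Group._⁻¹ G φ)))
  (φ∉H : ¬ Subgroup.Member H φ) where
  private
    module G = Group G
    module GP = GroupProperties G
  open G using (_∙_; _⁻¹; ε)
  open Subgroup H using (Member; ∙-mem; ⁻¹-mem; ε-mem) renaming (resp to Member-resp; group to Hᴳ)
  open CommutativeRing κ hiding (zero)
  open CommutativeRingProperties κ using (module Solver)
  open SetoidReasoning setoid

  private
    gφ⁻¹φ≈g : ∀ g → (g ∙ φ ⁻¹) ∙ φ G.≈ g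
    gφ⁻¹φ≈g g = G.trans (G.assoc g (φ ⁻¹) φ) (G.trans (G.∙-congˡ (G.inverseˡ φ)) (G.identityʳ g))

    gφφ⁻¹≈g : ∀ g → (g ∙ φ) ∙ φ ⁻¹ G.≈ g
    gφφ⁻¹≈g g = G.trans (G.assoc g φ (φ ⁻¹)) (G.trans (G.∙-congˡ (G.inverseʳ φ)) (G.identityʳ g))

    φ⁻²φ : (φ ∙ φ) ⁻¹ ∙ φ G.≈ φ ⁻¹
    φ⁻²φ = G.trans (G.∙-congʳ (GP.⁻¹-anti-homo-∙ φ φ)) (gφ⁻¹φ≈g (φ ⁻¹))

  φ²∈H : Member (φ ∙ φ)
  φ²∈H with side (φ ∙ φ)
  ... | inj₁ m = m
  ... | inj₂ m = ⊥-elim (φ∉H (Member-resp (gφφ⁻¹≈g φ) m))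

  -- Otherwise (gφ⁻¹)⁻¹ g = φ would lie in H.
  exclusive : ∀ {g} → Member g → ¬ Member (g ∙ φ ⁻¹)
  exclusive {g} m n = φ∉H (Member-resp
    (G.trans (G.∙-congʳ (GP.⁻¹-anti-homo-∙ g (φ ⁻¹)))
      (G.trans (G.assoc _ _ g) (G.trans (G.∙-congˡ (G.inverseˡ g)) (G.trans (G.identityʳ _) (GP.⁻¹-involutive φ)))))
    (∙-mem (⁻¹-mem n) m))

  private
    -- Normality is given for g ↦ φ⁻¹gφ only; conjugating further by φ², an element of H, turns this
    -- into g ↦ φgφ⁻¹.
    conjugation : ∀ g → (φ ∙ φ) ∙ ((φ ⁻¹ ∙ g ∙ φ) ∙ (φ ∙ φ) ⁻¹) G.≈ (φ ∙ g) ∙ φ ⁻¹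
    conjugation g =
      G.trans (G.∙-congˡ (G.∙-congˡ (GP.⁻¹-anti-homo-∙ φ φ)))
      (G.trans (G.∙-congˡ (G.sym (G.assoc _ (φ ⁻¹) (φ ⁻¹))))
      (G.trans (G.∙-congˡ (G.∙-congʳ (gφφ⁻¹≈g (φ ⁻¹ ∙ g))))
      (G.trans (G.assoc φ φ _)
      (G.trans (G.∙-congˡ (G.sym (G.assoc φ _ (φ ⁻¹))))
      (G.trans (G.∙-congˡ (G.∙-congʳ (G.sym (G.assoc φ (φ ⁻¹) g))))
      (G.trans (G.∙-congˡ (G.∙-congʳ (G.trans (G.∙-congʳ (G.inverseʳ φ)) (G.identityˡ g))))
      (G.sym (G.assoc φ g (φ ⁻¹)))))))))

  module _ (χ : Character Hᴳ κ) where
    private module χ = Character χ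

    at-inverse : ∀ g → at χ g * at χ (Group._⁻¹ Hᴳ g) ≈ 1#
    at-inverse g = trans (sym (χ.homo g (Group._⁻¹ Hᴳ g)))
      (trans (χ.⟦⟧-cong (G.inverseʳ (proj₁ g))) χ.ε-homo)

    conjugate : Character Hᴳ κ
    conjugate = conjugateᶜ H φ (λ {g} → normal {g}) χ

    -- Conjugation by φ and by φ⁻¹ differ by φ² ∈ H.
    at-conjugate : ∀ {g} (m : Member g) →
      Σ (Member ((φ ∙ g) ∙ φ ⁻¹)) λ n → at χ (_ , n) ≈ at conjugate (g , m)
    at-conjugate {g} m = n , (begin
      at χ (_ , n)
        ≈⟨ χ.⟦⟧-cong {_ , n} {_ , n′} (G.sym (conjugation g)) ⟩
      at χ (_ , n′)
        ≈⟨ χ.homo φ² (_ , ∙-mem (normal m) (⁻¹-mem φ²∈H)) ⟩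
      at χ φ² * at χ (_ , ∙-mem (normal m) (⁻¹-mem φ²∈H))
        ≈⟨ *-congˡ (χ.homo (_ , normal m) (Group._⁻¹ Hᴳ φ²)) ⟩
      at χ φ² * (at conjugate (g , m) * at χ (Group._⁻¹ Hᴳ φ²))
        ≈⟨ solve 3 (λ a b c → a :* (b :* c) := (a :* c) :* b) refl _ _ _ ⟩
      (at χ φ² * at χ (Group._⁻¹ Hᴳ φ²)) * at conjugate (g , m)
        ≈⟨ *-congʳ (at-inverse φ²) ⟩
      1# * at conjugate (g , m)
        ≈⟨ *-identityˡ _ ⟩
      at conjugate (g , m)    ∎)
      where
      open Solver
      φ² : Group.Carrier Hᴳ
      φ² = φ ∙ φ , φ²∈H
      n′ : Member ((φ ∙ φ) ∙ ((φ ⁻¹ ∙ g ∙ φ) ∙ (φ ∙ φ) ⁻¹))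
      n′ = ∙-mem φ²∈H (∙-mem (normal m) (⁻¹-mem φ²∈H))
      n : Member ((φ ∙ g) ∙ φ ⁻¹)
      n = Member-resp (conjugation g) n′

  module Induced (χ : Character Hᴳ κ) where
    private module χ = Character χ
    open Rep (Ind H χ) public using () renaming (Carrierᴹ to Element; _≈ᴹ_ to _≈ᴵ_)

    extensionality : ∀ (f f′ : Element) → proj₁ f ε ≈ proj₁ f′ ε → proj₁ f φ ≈ proj₁ f′ φ → f ≈ᴵ f′
    extensionality f f′ eq-ε eq-φ g with side g
    ... | inj₁ m = begin
      proj₁ f g                       ≈⟨ proj₁ (proj₂ f) (G.identityʳ g) ⟨
      proj₁ f (g ∙ ε)                 ≈⟨ proj₂ (proj₂ f) (g , m) ε ⟩
      at χ (g , m) * proj₁ f ε        ≈⟨ *-congˡ eq-ε ⟩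
      at χ (g , m) * proj₁ f′ ε       ≈⟨ proj₂ (proj₂ f′) (g , m) ε ⟨
      proj₁ f′ (g ∙ ε)                ≈⟨ proj₁ (proj₂ f′) (G.identityʳ g) ⟩
      proj₁ f′ g                      ∎
    ... | inj₂ m = begin
      proj₁ f g                       ≈⟨ proj₁ (proj₂ f) (gφ⁻¹φ≈g g) ⟨
      proj₁ f (g ∙ φ ⁻¹ ∙ φ)          ≈⟨ proj₂ (proj₂ f) (_ , m) φ ⟩
      at χ (_ , m) * proj₁ f φ        ≈⟨ *-congˡ eq-φ ⟩
      at χ (_ , m) * proj₁ f′ φ       ≈⟨ proj₂ (proj₂ f′) (_ , m) φ ⟨
      proj₁ f′ (g ∙ φ ⁻¹ ∙ φ)         ≈⟨ proj₁ (proj₂ f′) (gφ⁻¹φ≈g g) ⟩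
      proj₁ f′ g                      ∎

    module _ (a b : Carrier) where
      private
        extend : ∀ g → Member g ⊎ Member (g ∙ φ ⁻¹) → Carrier
        extend g (inj₁ m) = at χ (g , m) * a
        extend g (inj₂ m) = at χ (g ∙ φ ⁻¹ , m) * b

        value : G.Carrier → Carrier
        value g = extend g (side g)

      -- The proof of membership does not matter, since equality in the subgroup ignores it, and
      -- `exclusive` rules out the other coset.
      value-inside : ∀ {g} (m : Member g) → value g ≈ at χ (g , m) * a
      value-inside {g} m with side g
      ... | inj₁ n = *-congʳ (χ.⟦⟧-cong G.refl)
      ... | inj₂ n = ⊥-elim (exclusive m n)

      value-outside : ∀ {g} (m : Member (g ∙ φ ⁻¹)) → value g ≈ at χ (g ∙ φ ⁻¹ , m) * b
      value-outside {g} m with side g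
      ... | inj₁ n = ⊥-elim (exclusive n m)
      ... | inj₂ n = *-congʳ (χ.⟦⟧-cong G.refl)

      private
        value-cong : ∀ {g h} → g G.≈ h → value g ≈ value h
        value-cong {g} {h} g≈h with side g
        ... | inj₁ m = trans (*-congʳ (χ.⟦⟧-cong g≈h)) (sym (value-inside (Member-resp g≈h m)))
        ... | inj₂ m = trans (*-congʳ (χ.⟦⟧-cong (G.∙-congʳ g≈h)))
                             (sym (value-outside (Member-resp (G.∙-congʳ g≈h) m)))

        value-equivariant : ∀ h g → value (proj₁ h ∙ g) ≈ at χ h * value g
        value-equivariant (h , m) g with side g
        ... | inj₁ n = trans (value-inside (∙-mem m n)) (trans (*-congʳ (χ.homo (h , m) (g , n))) (*-assoc _ _ _))
        ... | inj₂ n = trans (value-outside o)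
            (trans (*-congʳ (trans (χ.⟦⟧-cong {_ , o} {_ , ∙-mem m n} (G.assoc h g (φ ⁻¹))) (χ.homo (h , m) (_ , n))))
              (*-assoc _ _ _))
          where
          o : Member (h ∙ g ∙ φ ⁻¹)
          o = Member-resp (G.sym (G.assoc h g (φ ⁻¹))) (∙-mem m n)

      fromValues : Element
      fromValues = value , value-cong , value-equivariant

      fromValues-ε : proj₁ fromValues ε ≈ a
      fromValues-ε = trans (value-inside ε-mem) (trans (*-congʳ χ.ε-homo) (*-identityˡ a))

      fromValues-φ : proj₁ fromValues φ ≈ b
      fromValues-φ = trans (value-outside m)
        (trans (*-congʳ (trans (χ.⟦⟧-cong {_ , m} {_ , ε-mem} (G.inverseʳ φ)) χ.ε-homo)) (*-identityˡ b))
        where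
        m : Member (φ ∙ φ ⁻¹)
        m = Member-resp (G.sym (G.inverseʳ φ)) ε-mem

  module AdjointDecomposition (χ : Character Hᴳ κ) (ρ : MatRep 2 G κ) (Φ : standard ρ ≅ Ind H χ) where
    open Matrix κ using (Mat; _≈ₘ_; _·_; _·ᵛ_; 1ₘ; tr; sum-assoc; sum-*; 1ₘ-sumʳ)
    open Induced χ
    χˢ : Character Hᴳ κ
    χˢ = conjugate χ

    private
      module Φ = ≅-Properties Φ
      module ad⁰ = Rep (ad⁰ ρ)

    Vector : Set
    Vector = Fin 2 → Carrier

    ev : Vector → G.Carrier → Carrier
    ev v = proj₁ (Φ.to v)

    ev-cong : ∀ {v w} → (∀ i → v i ≈ w i) → ∀ g → ev v g ≈ ev w g
    ev-cong = Φ.⟦⟧-cong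

    ev-resp : ∀ v {g h} → g G.≈ h → ev v g ≈ ev v h
    ev-resp v = proj₁ (proj₂ (Φ.to v))

    ev-+ : ∀ v w g → ev (λ i → v i + w i) g ≈ ev v g + ev w g
    ev-+ = Φ.+ᴹ-homo

    ev-* : ∀ r v g → ev (λ i → r * v i) g ≈ r * ev v g
    ev-* = Φ.*ₗ-homo

    ev-ρ : ∀ g v x → ev (mat ρ g ·ᵛ v) x ≈ ev v (x ∙ g)
    ev-ρ = Φ.equivariant

    ev-H : ∀ h v x → ev v (proj₁ h ∙ x) ≈ at χ h * ev v x
    ev-H h v = proj₂ (proj₂ (Φ.to v)) h

    -- The coordinates in the basis u₀, u₁ below. G is the union of H and Hφ, so a function in Ind χ
    -- is determined by its values at 1 and φ.
    α β : Vector → Carrier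
    α v = ev v ε
    β v = ev v φ

    vector-ext : ∀ v w → α v ≈ α w → β v ≈ β w → ∀ i → v i ≈ w i
    vector-ext v w eq-α eq-β = Φ.injective (extensionality (Φ.to v) (Φ.to w) eq-α eq-β)

    fromCoordinates : Carrier → Carrier → Vector
    fromCoordinates a b = proj₁ (Φ.surjective (fromValues a b))

    ev-fromCoordinates : ∀ a b g → ev (fromCoordinates a b) g ≈ proj₁ (fromValues a b) g
    ev-fromCoordinates a b = proj₂ (Φ.surjective (fromValues a b)) (λ i → refl)

    -- They correspond to functions supported on H and on Hφ. Hence each spans an H-stable line,
    -- with characters χ and χˢ.
    u₀ u₁ : Vector
    u₀ = fromCoordinates 1# 0#
    u₁ = fromCoordinates 0# 1#

    αu₀ : α u₀ ≈ 1#
    αu₀ = trans (ev-fromCoordinates 1# 0# ε) (fromValues-ε 1# 0#)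
    βu₀ : β u₀ ≈ 0#
    βu₀ = trans (ev-fromCoordinates 1# 0# φ) (fromValues-φ 1# 0#)
    αu₁ : α u₁ ≈ 0#
    αu₁ = trans (ev-fromCoordinates 0# 1# ε) (fromValues-ε 0# 1#)
    βu₁ : β u₁ ≈ 1#
    βu₁ = trans (ev-fromCoordinates 0# 1# φ) (fromValues-φ 0# 1#)

    combine : Carrier → Carrier → Vector
    combine a b i = a * u₀ i + b * u₁ i

    ev-combine : ∀ a b g → ev (combine a b) g ≈ a * ev u₀ g + b * ev u₁ g
    ev-combine a b g = trans (ev-+ _ _ g) (+-cong (ev-* a u₀ g) (ev-* b u₁ g))

    α-combine : ∀ a b → α (combine a b) ≈ a
    α-combine a b = trans (ev-combine a b ε) (trans (+-cong (*-congˡ αu₀) (*-congˡ αu₁))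
      (solve 2 (λ a b → a :* con (+ 1) :+ b :* con (+ 0) := a) refl a b))
      where open Solver

    β-combine : ∀ a b → β (combine a b) ≈ b
    β-combine a b = trans (ev-combine a b φ) (trans (+-cong (*-congˡ βu₀) (*-congˡ βu₁))
      (solve 2 (λ a b → a :* con (+ 0) :+ b :* con (+ 1) := b) refl a b))
      where open Solver

    decompose : ∀ v i → v i ≈ combine (α v) (β v) i
    decompose v = vector-ext v (combine (α v) (β v)) (sym (α-combine _ _)) (sym (β-combine _ _))

    ρ-u₀ : ∀ h i → (mat ρ (proj₁ h) ·ᵛ u₀) i ≈ at χ h * u₀ i
    ρ-u₀ h@(g , m) = vector-ext _ _
      (begin
        α (mat ρ g ·ᵛ u₀)                    ≈⟨ ev-ρ g u₀ ε ⟩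
        ev u₀ (ε ∙ g)                        ≈⟨ ev-resp u₀ (G.trans (G.identityˡ g) (G.sym (G.identityʳ g))) ⟩
        ev u₀ (g ∙ ε)                        ≈⟨ ev-H h u₀ ε ⟩
        at χ h * α u₀                        ≈⟨ ev-* (at χ h) u₀ ε ⟨
        α (λ i → at χ h * u₀ i)              ∎)
      (begin
        β (mat ρ g ·ᵛ u₀)                    ≈⟨ ev-ρ g u₀ φ ⟩
        ev u₀ (φ ∙ g)                        ≈⟨ ev-resp u₀ (gφ⁻¹φ≈g (φ ∙ g)) ⟨
        ev u₀ (φ ∙ g ∙ φ ⁻¹ ∙ φ)             ≈⟨ ev-H (_ , proj₁ (at-conjugate χ m)) u₀ φ ⟩
        _ * β u₀                             ≈⟨ trans (*-congˡ βu₀) (zeroʳ _) ⟩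
        0#                                   ≈⟨ trans (*-congˡ βu₀) (zeroʳ _) ⟨
        at χ h * β u₀                        ≈⟨ ev-* (at χ h) u₀ φ ⟨
        β (λ i → at χ h * u₀ i)              ∎)

    -- Evaluating at φ uses φg = (φgφ⁻¹)φ and so brings in χ(φgφ⁻¹), whereas χˢ is defined through
    -- φ⁻¹gφ; `at-conjugate` reconciles the two.
    ρ-u₁ : ∀ h i → (mat ρ (proj₁ h) ·ᵛ u₁) i ≈ at χˢ h * u₁ i
    ρ-u₁ h@(g , m) = vector-ext _ _
      (begin
        α (mat ρ g ·ᵛ u₁)                    ≈⟨ ev-ρ g u₁ ε ⟩
        ev u₁ (ε ∙ g)                        ≈⟨ ev-resp u₁ (G.trans (G.identityˡ g) (G.sym (G.identityʳ g))) ⟩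
        ev u₁ (g ∙ ε)                        ≈⟨ ev-H h u₁ ε ⟩
        at χ h * α u₁                        ≈⟨ trans (*-congˡ αu₁) (zeroʳ _) ⟩
        0#                                   ≈⟨ trans (*-congˡ αu₁) (zeroʳ _) ⟨
        at χˢ h * α u₁                       ≈⟨ ev-* (at χˢ h) u₁ ε ⟨
        α (λ i → at χˢ h * u₁ i)             ∎)
      (begin
        β (mat ρ g ·ᵛ u₁)                    ≈⟨ ev-ρ g u₁ φ ⟩
        ev u₁ (φ ∙ g)                        ≈⟨ ev-resp u₁ (gφ⁻¹φ≈g (φ ∙ g)) ⟨
        ev u₁ (φ ∙ g ∙ φ ⁻¹ ∙ φ)             ≈⟨ ev-H (_ , proj₁ (at-conjugate χ m)) u₁ φ ⟩
        _ * β u₁                             ≈⟨ *-congʳ (proj₂ (at-conjugate χ m)) ⟩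
        at χˢ h * β u₁                       ≈⟨ ev-* (at χˢ h) u₁ φ ⟨
        β (λ i → at χˢ h * u₁ i)             ∎)

    ρφ⁻¹-u₀ : ∀ i → (mat ρ (φ ⁻¹) ·ᵛ u₀) i ≈ u₁ i
    ρφ⁻¹-u₀ = vector-ext _ _
      (begin
        α (mat ρ (φ ⁻¹) ·ᵛ u₀)               ≈⟨ ev-ρ (φ ⁻¹) u₀ ε ⟩
        ev u₀ (ε ∙ φ ⁻¹)                     ≈⟨ ev-resp u₀ (G.trans (G.identityˡ _) (G.sym φ⁻²φ)) ⟩
        ev u₀ ((φ ∙ φ) ⁻¹ ∙ φ)               ≈⟨ ev-H (_ , ⁻¹-mem φ²∈H) u₀ φ ⟩
        _ * β u₀                             ≈⟨ trans (*-congˡ βu₀) (zeroʳ _) ⟩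
        0#                                   ≈⟨ αu₁ ⟨
        α u₁                                 ∎)
      (begin
        β (mat ρ (φ ⁻¹) ·ᵛ u₀)               ≈⟨ ev-ρ (φ ⁻¹) u₀ φ ⟩
        ev u₀ (φ ∙ φ ⁻¹)                     ≈⟨ ev-resp u₀ (G.inverseʳ φ) ⟩
        α u₀                                 ≈⟨ αu₀ ⟩
        1#                                   ≈⟨ βu₁ ⟨
        β u₁                                 ∎)

    -- φ interchanges the lines of u₀ and u₁, and c = χ(φ²) is what remains after going round: φ⁻¹
    -- sends u₀ to u₁ and u₁ to c⁻¹u₀.
    c : Carrier
    c = at χ (φ ∙ φ , φ²∈H)

    c⁻¹ : Carrier
    c⁻¹ = at χ ((φ ∙ φ) ⁻¹ , ⁻¹-mem φ²∈H)

    cc⁻¹≈1 : c * c⁻¹ ≈ 1#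
    cc⁻¹≈1 = at-inverse χ (φ ∙ φ , φ²∈H)

    ρφ⁻¹-u₁ : ∀ i → (mat ρ (φ ⁻¹) ·ᵛ u₁) i ≈ c⁻¹ * u₀ i
    ρφ⁻¹-u₁ = vector-ext _ _
      (begin
        α (mat ρ (φ ⁻¹) ·ᵛ u₁)               ≈⟨ ev-ρ (φ ⁻¹) u₁ ε ⟩
        ev u₁ (ε ∙ φ ⁻¹)                     ≈⟨ ev-resp u₁ (G.trans (G.identityˡ _) (G.sym φ⁻²φ)) ⟩
        ev u₁ ((φ ∙ φ) ⁻¹ ∙ φ)               ≈⟨ ev-H (_ , ⁻¹-mem φ²∈H) u₁ φ ⟩
        c⁻¹ * β u₁                           ≈⟨ *-congˡ (trans βu₁ (sym αu₀)) ⟩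
        c⁻¹ * α u₀                           ≈⟨ ev-* c⁻¹ u₀ ε ⟨
        α (λ i → c⁻¹ * u₀ i)                 ∎)
      (begin
        β (mat ρ (φ ⁻¹) ·ᵛ u₁)               ≈⟨ ev-ρ (φ ⁻¹) u₁ φ ⟩
        ev u₁ (φ ∙ φ ⁻¹)                     ≈⟨ ev-resp u₁ (G.inverseʳ φ) ⟩
        α u₁                                 ≈⟨ αu₁ ⟩
        0#                                   ≈⟨ trans (*-congˡ βu₀) (zeroʳ _) ⟨
        c⁻¹ * β u₀                           ≈⟨ ev-* c⁻¹ u₀ φ ⟨
        β (λ i → c⁻¹ * u₀ i)                 ∎)

    -- The entries X₀₀, X₀₁, X₁₀, X₁₁ in the basis u₀, u₁ are `L u₀ ε`, `L u₁ ε`, `L u₀ φ`,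
    -- `L u₁ φ`. Keeping the vector and the evaluation point general makes conjugation easy to
    -- track.
    L : Vector → G.Carrier → Mat 2 → Carrier
    L v g X = ev (X ·ᵛ v) g

    private
      ·ᵛ-cong : ∀ {X Y : Mat 2} {v w : Vector} → X ≈ₘ Y → (∀ i → v i ≈ w i) → ∀ i → (X ·ᵛ v) i ≈ (Y ·ᵛ w) i
      ·ᵛ-cong X≈Y v≈w i = +-cong (*-cong (X≈Y i 0F) (v≈w 0F)) (+-congʳ (*-cong (X≈Y i 1F) (v≈w 1F)))

    L-cong : ∀ {X Y v w g h} → (∀ i → v i ≈ w i) → g G.≈ h → X ≈ₘ Y → L v g X ≈ L w h Y
    L-cong {X} {Y} {v} {w} v≈w g≈h X≈Y =
      trans (ev-resp (X ·ᵛ v) g≈h) (ev-cong (·ᵛ-cong {X} {Y} {v} {w} X≈Y v≈w) _)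

    L-+ : ∀ v g X Y → L v g (λ i j → X i j + Y i j) ≈ L v g X + L v g Y
    L-+ v g X Y = trans (ev-cong (λ i → solve 6
      (λ a b c d x y → (a :+ c) :* x :+ ((b :+ d) :* y :+ con (+ 0))
                    := (a :* x :+ (b :* y :+ con (+ 0))) :+ (c :* x :+ (d :* y :+ con (+ 0))))
      refl (X i 0F) (X i 1F) (Y i 0F) (Y i 1F) (v 0F) (v 1F)) g) (ev-+ (X ·ᵛ v) (Y ·ᵛ v) g)
      where open Solver

    L-* : ∀ v g r X → L v g (λ i j → r * X i j) ≈ r * L v g X
    L-* v g r X = trans (ev-cong (λ i → solve 5
      (λ r a b x y → (r :* a) :* x :+ ((r :* b) :* y :+ con (+ 0)) := r :* (a :* x :+ (b :* y :+ con (+ 0))))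
      refl r (X i 0F) (X i 1F) (v 0F) (v 1F)) g) (ev-* r (X ·ᵛ v) g)
      where open Solver

    L-neg : ∀ v g X → L v g (λ i j → - X i j) ≈ - L v g X
    L-neg v g X = trans (L-cong {v = v} (λ i → refl) G.refl
        (λ i j → solve 1 (λ x → :- x := (:- con (+ 1)) :* x) refl (X i j)))
      (trans (L-* v g (- 1#) X) (solve 1 (λ x → (:- con (+ 1)) :* x := :- x) refl (L v g X)))
      where open Solver

    L-0 : ∀ v g → L v g (λ i j → 0#) ≈ 0#
    L-0 v g = trans (L-cong {v = v} (λ i → refl) G.refl (λ i j → sym (zeroˡ 0#)))
      (trans (L-* v g 0# (λ i j → 0#)) (zeroˡ _))

    L-scale : ∀ r v g X → L (λ i → r * v i) g X ≈ r * L v g X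
    L-scale r v g X = trans (ev-cong (λ i → sum-* r (X i) v) g) (ev-* r (X ·ᵛ v) g)

    L-H : ∀ h v x X → L v (proj₁ h ∙ x) X ≈ at χ h * L v x X
    L-H h v x X = ev-H h (X ·ᵛ v) x

    -- Under Φ the action of ρ(k) is translation of the evaluation point, so the left factor moves x
    -- to xk, and the right factor moves v to k⁻¹v.
    L-conjugate : ∀ v x k X → L v x (mat ρ k · X · mat ρ (k ⁻¹)) ≈ L (mat ρ (k ⁻¹) ·ᵛ v) (x ∙ k) X
    L-conjugate v x k X = trans
      (ev-cong (λ i → trans (sum-assoc ((mat ρ k · X) i) (mat ρ (k ⁻¹)) v) (sum-assoc (mat ρ k i) X (mat ρ (k ⁻¹) ·ᵛ v))) x)
      (ev-ρ k (X ·ᵛ (mat ρ (k ⁻¹) ·ᵛ v)) x)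

    δ : Fin 2 → Vector
    δ j i = 1ₘ i j

    ev-expand : ∀ v g → ev v g ≈ v 0F * ev (δ 0F) g + v 1F * ev (δ 1F) g
    ev-expand v g = trans (ev-cong expand g)
      (trans (ev-+ (λ i → v 0F * δ 0F i) (λ i → v 1F * δ 1F i) g) (+-cong (ev-* (v 0F) (δ 0F) g) (ev-* (v 1F) (δ 1F) g)))
      where
      open Solver
      expand : ∀ i → v i ≈ v 0F * δ 0F i + v 1F * δ 1F i
      expand 0F = solve 2 (λ x y → x := x :* con (+ 1) :+ y :* con (+ 0)) refl (v 0F) (v 1F)
      expand 1F = solve 2 (λ x y → y := x :* con (+ 0) :+ y :* con (+ 1)) refl (v 0F) (v 1F)

    -- Expanding Xu₀ and Xu₁ in the standard basis and regrouping by the entries of X leaves the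
    -- combinations α(δⱼ)u₀ + β(δⱼ)u₁, which `decompose` identifies with δⱼ. This does the work of a
    -- change-of-basis matrix and its inverse.
    trace-in-basis : ∀ X → L u₀ ε X + L u₁ φ X ≈ tr X
    trace-in-basis X = begin
      L u₀ ε X + L u₁ φ X
        ≈⟨ +-cong (ev-expand (X ·ᵛ u₀) ε) (ev-expand (X ·ᵛ u₁) φ) ⟩
      ((X ·ᵛ u₀) 0F * α (δ 0F) + (X ·ᵛ u₀) 1F * α (δ 1F)) + ((X ·ᵛ u₁) 0F * β (δ 0F) + (X ·ᵛ u₁) 1F * β (δ 1F))
        ≈⟨ solve 12 (λ x00 x01 x10 x11 p0 p1 q0 q1 a0 a1 b0 b1 →
             ((x00 :* p0 :+ (x01 :* p1 :+ con (+ 0))) :* a0 :+ (x10 :* p0 :+ (x11 :* p1 :+ con (+ 0))) :* a1)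
             :+ ((x00 :* q0 :+ (x01 :* q1 :+ con (+ 0))) :* b0 :+ (x10 :* q0 :+ (x11 :* q1 :+ con (+ 0))) :* b1)
             := (x00 :* (a0 :* p0 :+ b0 :* q0) :+ x01 :* (a0 :* p1 :+ b0 :* q1))
             :+ (x10 :* (a1 :* p0 :+ b1 :* q0) :+ x11 :* (a1 :* p1 :+ b1 :* q1)))
             refl (X 0F 0F) (X 0F 1F) (X 1F 0F) (X 1F 1F) (u₀ 0F) (u₀ 1F) (u₁ 0F) (u₁ 1F)
             (α (δ 0F)) (α (δ 1F)) (β (δ 0F)) (β (δ 1F)) ⟩
      (X 0F 0F * combine (α (δ 0F)) (β (δ 0F)) 0F + X 0F 1F * combine (α (δ 0F)) (β (δ 0F)) 1F)
      + (X 1F 0F * combine (α (δ 1F)) (β (δ 1F)) 0F + X 1F 1F * combine (α (δ 1F)) (β (δ 1F)) 1F)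
        ≈⟨ +-cong (+-cong (*-congˡ (decompose (δ 0F) 0F)) (*-congˡ (decompose (δ 0F) 1F)))
                  (+-cong (*-congˡ (decompose (δ 1F) 0F)) (*-congˡ (decompose (δ 1F) 1F))) ⟨
      (X 0F 0F * 1# + X 0F 1F * 0#) + (X 1F 0F * 0# + X 1F 1F * 1#)
        ≈⟨ solve 4 (λ a b c d → (a :* con (+ 1) :+ b :* con (+ 0)) :+ (c :* con (+ 0) :+ d :* con (+ 1))
             := a :+ (d :+ con (+ 0))) refl (X 0F 0F) (X 0F 1F) (X 1F 0F) (X 1F 1F) ⟩
      tr X    ∎
      where open Solver

    matrix-ext : ∀ X Y → (∀ i → (X ·ᵛ u₀) i ≈ (Y ·ᵛ u₀) i) → (∀ i → (X ·ᵛ u₁) i ≈ (Y ·ᵛ u₁) i) → X ≈ₘ Y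
    matrix-ext X Y eq₀ eq₁ i j = trans (column X) (trans (+-cong (*-congˡ (eq₀ i)) (*-congˡ (eq₁ i))) (sym (column Y)))
      where
      open Solver
      column : ∀ Z → Z i j ≈ α (δ j) * (Z ·ᵛ u₀) i + β (δ j) * (Z ·ᵛ u₁) i
      column Z = begin
        Z i j                                      ≈⟨ 1ₘ-sumʳ j (Z i) ⟨
        (Z ·ᵛ δ j) i                               ≈⟨ ·ᵛ-cong {Z} {Z} {δ j} (λ _ _ → refl) (decompose (δ j)) i ⟩
        (Z ·ᵛ combine (α (δ j)) (β (δ j))) i
          ≈⟨ solve 8 (λ x y a b p0 p1 q0 q1 →
               x :* (a :* p0 :+ b :* q0) :+ (y :* (a :* p1 :+ b :* q1) :+ con (+ 0))
               := a :* (x :* p0 :+ (y :* p1 :+ con (+ 0))) :+ b :* (x :* q0 :+ (y :* q1 :+ con (+ 0))))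
               refl (Z i 0F) (Z i 1F) (α (δ j)) (β (δ j)) (u₀ 0F) (u₀ 1F) (u₁ 0F) (u₁ 1F) ⟩
        α (δ j) * (Z ·ᵛ u₀) i + β (δ j) * (Z ·ᵛ u₁) i    ∎

    module _ (x y z : Carrier) where
      -- The endomorphism with matrix (x y; z −x) in the basis u₀, u₁.
      tracelessMatrix : Mat 2
      tracelessMatrix i j = combine (x * α (δ j) + y * β (δ j)) (z * α (δ j) - x * β (δ j)) i

      tracelessMatrix-·ᵛ : ∀ v i → (tracelessMatrix ·ᵛ v) i ≈ combine (x * α v + y * β v) (z * α v - x * β v) i
      tracelessMatrix-·ᵛ v i = trans
        (solve 11 (λ x y z a0 a1 b0 b1 v0 v1 p q →
          ((x :* a0 :+ y :* b0) :* p :+ (z :* a0 :- x :* b0) :* q) :* v0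
          :+ (((x :* a1 :+ y :* b1) :* p :+ (z :* a1 :- x :* b1) :* q) :* v1 :+ con (+ 0))
          := (x :* (v0 :* a0 :+ v1 :* a1) :+ y :* (v0 :* b0 :+ v1 :* b1)) :* p
          :+ (z :* (v0 :* a0 :+ v1 :* a1) :- x :* (v0 :* b0 :+ v1 :* b1)) :* q)
          refl x y z (α (δ 0F)) (α (δ 1F)) (β (δ 0F)) (β (δ 1F)) (v 0F) (v 1F) (u₀ i) (u₁ i))
        (sym (+-cong (*-congʳ (+-cong (*-congˡ (ev-expand v ε)) (*-congˡ (ev-expand v φ))))
                     (*-congʳ (+-cong (*-congˡ (ev-expand v ε)) (-‿cong (*-congˡ (ev-expand v φ)))))))
        where open Solver

      private
        L-ε : ∀ v → L v ε tracelessMatrix ≈ x * α v + y * β v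
        L-ε v = trans (ev-cong (tracelessMatrix-·ᵛ v) ε) (α-combine _ _)
        L-φ : ∀ v → L v φ tracelessMatrix ≈ z * α v - x * β v
        L-φ v = trans (ev-cong (tracelessMatrix-·ᵛ v) φ) (β-combine _ _)

      tracelessMatrix-x : L u₀ ε tracelessMatrix ≈ x
      tracelessMatrix-x = trans (L-ε u₀) (trans (+-cong (*-congˡ αu₀) (*-congˡ βu₀))
        (solve 2 (λ x y → x :* con (+ 1) :+ y :* con (+ 0) := x) refl x y))
        where open Solver
      tracelessMatrix-y : L u₁ ε tracelessMatrix ≈ y
      tracelessMatrix-y = trans (L-ε u₁) (trans (+-cong (*-congˡ αu₁) (*-congˡ βu₁))
        (solve 2 (λ x y → x :* con (+ 0) :+ y :* con (+ 1) := y) refl x y))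
        where open Solver
      tracelessMatrix-z : L u₀ φ tracelessMatrix ≈ z
      tracelessMatrix-z = trans (L-φ u₀) (trans (+-cong (*-congˡ αu₀) (-‿cong (*-congˡ βu₀)))
        (solve 2 (λ x z → z :* con (+ 1) :- x :* con (+ 0) := z) refl x z))
        where open Solver
      tracelessMatrix-w : L u₁ φ tracelessMatrix ≈ - x
      tracelessMatrix-w = trans (L-φ u₁) (trans (+-cong (*-congˡ αu₁) (-‿cong (*-congˡ βu₁)))
        (solve 2 (λ x z → z :* con (+ 0) :- x :* con (+ 1) := :- x) refl x z))
        where open Solver

      tr-tracelessMatrix : tr tracelessMatrix ≈ 0#
      tr-tracelessMatrix = trans (sym (trace-in-basis tracelessMatrix))
        (trans (+-cong tracelessMatrix-x tracelessMatrix-w) (-‿inverseʳ x))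

    ρ-cong : ∀ v {g h} → g G.≈ h → ∀ i → (mat ρ g ·ᵛ v) i ≈ (mat ρ h ·ᵛ v) i
    ρ-cong v g≈h = Rep.act-cong (standard ρ) {v = v} {v} g≈h (λ i → refl)

    L-congᵛ : ∀ v w g X → (∀ i → v i ≈ w i) → L v g X ≈ L w g X
    L-congᵛ v w g X v≈w = L-cong {X} {X} {v} {w} v≈w G.refl (λ i j → refl)

    ψ : Character Hᴳ κ
    ψ = χ /ᶜ χˢ

    -- The (0,1)-entry of g X g⁻¹ in the basis u₀, u₁: the Frobenius reciprocity map
    -- attached to the functional X ↦ X₀₁, on which H acts through ψ.
    toInd : Mat 2 → Rep.Carrierᴹ (Ind H ψ)
    toInd X = (λ g → L (mat ρ (g ⁻¹) ·ᵛ u₁) g X)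
            , (λ {g} {h} g≈h → L-cong {X} {X} {mat ρ (g ⁻¹) ·ᵛ u₁} {mat ρ (h ⁻¹) ·ᵛ u₁}
                (ρ-cong u₁ (G.⁻¹-cong g≈h)) g≈h (λ i j → refl))
            , equivariant
      where
      module S = Rep (standard ρ)
      equivariant : ∀ h g → L (mat ρ ((proj₁ h ∙ g) ⁻¹) ·ᵛ u₁) (proj₁ h ∙ g) X ≈
                            at ψ h * L (mat ρ (g ⁻¹) ·ᵛ u₁) g X
      equivariant h@(k , m) g = begin
        L (mat ρ ((k ∙ g) ⁻¹) ·ᵛ u₁) (k ∙ g) X              ≈⟨ L-congᵛ _ (λ i → s * (mat ρ (g ⁻¹) ·ᵛ u₁) i) (k ∙ g) X vectors ⟩
        L (λ i → s * (mat ρ (g ⁻¹) ·ᵛ u₁) i) (k ∙ g) X      ≈⟨ L-scale s (mat ρ (g ⁻¹) ·ᵛ u₁) (k ∙ g) X ⟩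
        s * L (mat ρ (g ⁻¹) ·ᵛ u₁) (k ∙ g) X                ≈⟨ *-congˡ (L-H h (mat ρ (g ⁻¹) ·ᵛ u₁) g X) ⟩
        s * (at χ h * L (mat ρ (g ⁻¹) ·ᵛ u₁) g X)           ≈⟨ *-assoc _ _ _ ⟨
        (s * at χ h) * L (mat ρ (g ⁻¹) ·ᵛ u₁) g X           ≈⟨ *-congʳ (*-comm s _) ⟩
        at ψ h * L (mat ρ (g ⁻¹) ·ᵛ u₁) g X                 ∎
        where
        s : Carrier
        s = at χˢ (Group._⁻¹ Hᴳ h)
        vectors : ∀ i → (mat ρ ((k ∙ g) ⁻¹) ·ᵛ u₁) i ≈ s * (mat ρ (g ⁻¹) ·ᵛ u₁) i
        vectors i = begin
          (mat ρ ((k ∙ g) ⁻¹) ·ᵛ u₁) i                      ≈⟨ ρ-cong u₁ (GP.⁻¹-anti-homo-∙ k g) i ⟩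
          (mat ρ (g ⁻¹ ∙ k ⁻¹) ·ᵛ u₁) i                     ≈⟨ S.act-∙ (g ⁻¹) (k ⁻¹) u₁ i ⟩
          (mat ρ (g ⁻¹) ·ᵛ (mat ρ (k ⁻¹) ·ᵛ u₁)) i          ≈⟨ S.act-cong {g ⁻¹} {v = mat ρ (k ⁻¹) ·ᵛ u₁} {λ j → s * u₁ j} G.refl (ρ-u₁ (Group._⁻¹ Hᴳ h)) i ⟩
          (mat ρ (g ⁻¹) ·ᵛ (λ j → s * u₁ j)) i              ≈⟨ S.act-* (g ⁻¹) s u₁ i ⟩
          s * (mat ρ (g ⁻¹) ·ᵛ u₁) i                        ∎

    toInd-ε : ∀ X → proj₁ (toInd X) ε ≈ L u₁ ε X
    toInd-ε X = L-congᵛ (mat ρ (ε ⁻¹) ·ᵛ u₁) u₁ ε X λ i → trans (ρ-cong u₁ GP.ε⁻¹≈ε i) (S.act-ε u₁ i)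
      where module S = Rep (standard ρ)

    toInd-φ : ∀ X → proj₁ (toInd X) φ ≈ c⁻¹ * L u₀ φ X
    toInd-φ X = trans (L-congᵛ (mat ρ (φ ⁻¹) ·ᵛ u₁) (λ i → c⁻¹ * u₀ i) φ X ρφ⁻¹-u₁) (L-scale c⁻¹ u₀ φ X)

    toInd-conjugate : ∀ k X g →
      proj₁ (toInd (mat ρ k · X · mat ρ (k ⁻¹))) g ≈ proj₁ (toInd X) (g ∙ k)
    toInd-conjugate k X g = trans (L-conjugate (mat ρ (g ⁻¹) ·ᵛ u₁) g k X)
      (L-congᵛ (mat ρ (k ⁻¹) ·ᵛ (mat ρ (g ⁻¹) ·ᵛ u₁)) (mat ρ ((g ∙ k) ⁻¹) ·ᵛ u₁) (g ∙ k) X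
        (λ i → sym (trans (ρ-cong u₁ (GP.⁻¹-anti-homo-∙ g k) i) (S.act-∙ (k ⁻¹) (g ⁻¹) u₁ i))))
      where module S = Rep (standard ρ)

    module _ (θ : Character G κ) (θ-H : ∀ (h : Group.Carrier Hᴳ) → at θ (proj₁ h) ≈ 1#) (θ-φ : at θ φ ≈ - 1#) where
      private module θ = Character θ

      private
        x-H : ∀ h X → L u₀ ε (mat ρ (proj₁ h) · X · mat ρ (proj₁ h ⁻¹)) ≈ L u₀ ε X
        x-H h@(g , _) X = begin
          L u₀ ε (mat ρ g · X · mat ρ (g ⁻¹))              ≈⟨ L-conjugate u₀ ε g X ⟩
          L (mat ρ (g ⁻¹) ·ᵛ u₀) (ε ∙ g) X
            ≈⟨ L-cong {X} {X} {mat ρ (g ⁻¹) ·ᵛ u₀} {λ i → s * u₀ i} (ρ-u₀ (Group._⁻¹ Hᴳ h))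
                 (G.trans (G.identityˡ g) (G.sym (G.identityʳ g))) (λ i j → refl) ⟩
          L (λ i → s * u₀ i) (g ∙ ε) X                     ≈⟨ L-scale s u₀ (g ∙ ε) X ⟩
          s * L u₀ (g ∙ ε) X                               ≈⟨ *-congˡ (L-H h u₀ ε X) ⟩
          s * (at χ h * L u₀ ε X)                          ≈⟨ *-assoc _ _ _ ⟨
          s * at χ h * L u₀ ε X                            ≈⟨ *-congʳ (trans (*-comm _ _) (at-inverse χ h)) ⟩
          1# * L u₀ ε X                                    ≈⟨ *-identityˡ _ ⟩
          L u₀ ε X                                         ∎
          where
          s : Carrier
          s = at χ (Group._⁻¹ Hᴳ h)

        w≈-x : ∀ X → tr X ≈ 0# → L u₁ φ X ≈ - L u₀ ε X
        w≈-x X tr≈0 = begin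
          L u₁ φ X                                  ≈⟨ solve 2 (λ x w → w := (x :+ w) :- x) refl (L u₀ ε X) (L u₁ φ X) ⟩
          (L u₀ ε X + L u₁ φ X) - L u₀ ε X          ≈⟨ +-congʳ (trans (trace-in-basis X) tr≈0) ⟩
          0# - L u₀ ε X                             ≈⟨ +-identityˡ _ ⟩
          - L u₀ ε X                                ∎
          where open Solver

        x-φ : ∀ X → tr X ≈ 0# → L u₀ ε (mat ρ φ · X · mat ρ (φ ⁻¹)) ≈ - L u₀ ε X
        x-φ X tr≈0 = begin
          L u₀ ε (mat ρ φ · X · mat ρ (φ ⁻¹))       ≈⟨ L-conjugate u₀ ε φ X ⟩
          L (mat ρ (φ ⁻¹) ·ᵛ u₀) (ε ∙ φ) X
            ≈⟨ L-cong {X} {X} {mat ρ (φ ⁻¹) ·ᵛ u₀} {u₁} ρφ⁻¹-u₀ (G.identityˡ φ) (λ i j → refl) ⟩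
          L u₁ φ X                                  ≈⟨ w≈-x X tr≈0 ⟩
          - L u₀ ε X                                ∎

      -- On H the factors χ(h) and χ(h)⁻¹ picked up by X₀₀ cancel. Conjugation by φ replaces X₀₀ by
      -- X₁₁, which is -X₀₀ because the trace vanishes. The other elements are h φ with h in H.
      x-conjugate : ∀ g (X : ad⁰.Carrierᴹ) → L u₀ ε (proj₁ (ad⁰.act g X)) ≈ at θ g * L u₀ ε (proj₁ X)
      x-conjugate g X with side g
      ... | inj₁ m = trans (x-H (g , m) (proj₁ X)) (trans (sym (*-identityˡ _)) (*-congʳ (sym (θ-H (g , m)))))
      ... | inj₂ m = begin
        x (ad⁰.act g X)                      ≈⟨ x-cong (ad⁰.act g X) (ad⁰.act h (ad⁰.act φ X))
                                                  (ad⁰.≈ᴹ-trans {ad⁰.act g X} {ad⁰.act (h ∙ φ) X} {ad⁰.act h (ad⁰.act φ X)}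
                                                    (ad⁰.act-cong {g} {h ∙ φ} {X} {X} (G.sym (gφ⁻¹φ≈g g)) (λ i j → refl))
                                                    (ad⁰.act-∙ h φ X)) ⟩
        x (ad⁰.act h (ad⁰.act φ X))          ≈⟨ x-H (h , m) (proj₁ (ad⁰.act φ X)) ⟩
        x (ad⁰.act φ X)                      ≈⟨ x-φ (proj₁ X) (proj₂ X) ⟩
        - x X                                ≈⟨ solve 1 (λ x → :- x := (con (+ 1) :* (:- con (+ 1))) :* x) refl (x X) ⟩
        (1# * - 1#) * x X                    ≈⟨ *-congʳ (*-cong (θ-H (h , m)) θ-φ) ⟨
        (at θ h * at θ φ) * x X              ≈⟨ *-congʳ (trans (sym (θ.homo h φ)) (θ.⟦⟧-cong (gφ⁻¹φ≈g g))) ⟩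
        at θ g * x X                         ∎
        where
        open Solver
        h : G.Carrier
        h = g ∙ φ ⁻¹
        x : ad⁰.Carrierᴹ → Carrier
        x Y = L u₀ ε (proj₁ Y)
        x-cong : ∀ Y Z → Y ad⁰.≈ᴹ Z → x Y ≈ x Z
        x-cong Y Z Y≈Z = L-cong {proj₁ Y} {proj₁ Z} {u₀} {u₀} (λ i → refl) G.refl Y≈Z

      -- X₀₀ and `toInd X` determine X: X₁₁ is -X₀₀, and `toInd X` has the values X₀₁ at 1 and
      -- c⁻¹X₁₀ at φ. As η only rescales the action, the same linear map serves for every twist.
      adjoint-decomposition : ∀ (η : Character G κ) →
        (η ⊗ ad⁰ ρ) ≅ (line (η ·ᶜ θ) ⊕ (η ⊗ Ind H ψ))
      adjoint-decomposition η = mk≅ to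
          (λ {X} {Y} → to-cong {X} {Y})
          (λ (X , _) (Y , _) → L-+ u₀ ε X Y , λ g → L-+ (mat ρ (g ⁻¹) ·ᵛ u₁) g X Y)
          (L-0 u₀ ε , λ g → L-0 (mat ρ (g ⁻¹) ·ᵛ u₁) g)
          (λ (X , _) → L-neg u₀ ε X , λ g → L-neg (mat ρ (g ⁻¹) ·ᵛ u₁) g X)
          (λ r (X , _) → L-* u₀ ε r X , λ g → L-* (mat ρ (g ⁻¹) ·ᵛ u₁) g r X)
          (λ {X} {Y} → to-injective {X} {Y})
          (λ y → from y , λ {X} X≈from →
            trans (proj₁ (to-cong {X} {from y} X≈from)) (proj₁ (to-from y)) ,
            λ g → trans (proj₂ (to-cong {X} {from y} X≈from) g) (proj₂ (to-from y) g))
          (λ g X {Y} Y≈gX → W.≈ᴹ-trans {to Y} {to (Rep.act (η ⊗ ad⁰ ρ) g X)} {W.act g (to X)}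
            (to-cong {Y} {Rep.act (η ⊗ ad⁰ ρ) g X} Y≈gX)
            ( trans (L-* u₀ ε (at η g) (proj₁ (ad⁰.act g X)))
                (trans (*-congˡ (x-conjugate g X)) (sym (*-assoc _ _ _)))
            , λ k → trans (L-* (mat ρ (k ⁻¹) ·ᵛ u₁) k (at η g) (proj₁ (ad⁰.act g X)))
                (*-congˡ (toInd-conjugate g (proj₁ X) k))))
        where
        module W = Rep (line (η ·ᶜ θ) ⊕ (η ⊗ Ind H ψ))

        to : ad⁰.Carrierᴹ → W.Carrierᴹ
        to (X , _) = L u₀ ε X , toInd X

        to-cong : ∀ {X Y} → X ad⁰.≈ᴹ Y → to X W.≈ᴹ to Y
        to-cong {X , _} {Y , _} X≈Y =
          L-cong {X} {Y} {u₀} {u₀} (λ i → refl) G.refl X≈Y ,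
          λ g → L-cong {X} {Y} {mat ρ (g ⁻¹) ·ᵛ u₁} {mat ρ (g ⁻¹) ·ᵛ u₁} (λ i → refl) G.refl X≈Y

        c-cancel : ∀ a → c * (c⁻¹ * a) ≈ a
        c-cancel a = trans (sym (*-assoc _ _ _)) (trans (*-congʳ cc⁻¹≈1) (*-identityˡ a))

        z-from-φ : ∀ X → L u₀ φ X ≈ c * proj₁ (toInd X) φ
        z-from-φ X = sym (trans (*-congˡ (toInd-φ X)) (c-cancel _))

        to-injective : ∀ {X Y} → to X W.≈ᴹ to Y → X ad⁰.≈ᴹ Y
        to-injective {X , tX} {Y , tY} (x≈ , f≈) = matrix-ext X Y
          (vector-ext (X ·ᵛ u₀) (Y ·ᵛ u₀) x≈
            (trans (z-from-φ X) (trans (*-congˡ (f≈ φ)) (sym (z-from-φ Y)))))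
          (vector-ext (X ·ᵛ u₁) (Y ·ᵛ u₁)
            (trans (sym (toInd-ε X)) (trans (f≈ ε) (toInd-ε Y)))
            (trans (w≈-x X tX) (trans (-‿cong x≈) (sym (w≈-x Y tY)))))

        from : W.Carrierᴹ → ad⁰.Carrierᴹ
        -- The factor c undoes the c⁻¹ in the value of `toInd` at φ.
        from (x , f , _) = tracelessMatrix x (f ε) (c * f φ) , tr-tracelessMatrix x (f ε) (c * f φ)

        to-from : ∀ y → to (from y) W.≈ᴹ y
        to-from (x , f) = tracelessMatrix-x x y z , Induced.extensionality ψ (toInd X) f
          (trans (toInd-ε X) (tracelessMatrix-y x y z))
          (trans (toInd-φ X) (trans (*-congˡ (tracelessMatrix-z x y z))
            (trans (sym (*-assoc _ _ _)) (trans (*-congʳ (trans (*-comm _ _) cc⁻¹≈1)) (*-identityˡ _)))))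
          where
          y z : Carrier
          y = proj₁ f ε
          z = c * proj₁ f φ
          X : Mat 2
          X = tracelessMatrix x y z

-- Invariants

module _ {R : Ring₀} {M : Linear.Mod R} where
  open CommutativeRing R using (_≈_; 0#)
  open LeftModule M

  Spans : (Carrierᴹ → Set) → Carrierᴹ → Set
  Spans P w = P w × (∀ a → a *ₗ w ≈ᴹ 0ᴹ → a ≈ 0#) × (∀ v → P v → ∃ λ a → v ≈ᴹ a *ₗ w)

  -- Q carries along a property of the same generator; in the application it prescribes the image
  -- under Θ.
  spans⇒basis : ∀ {P Q : Carrierᴹ → Set} → (∃ λ w → Q w × Spans P w) →
                ∃ λ w → Q w × Linear.IsBasis R M P {1} (λ _ → w)
  spans⇒basis (w , Qw , Pw , independent , spanning) = w , Qw , record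
    { members     = λ _ → Pw
    ; independent = λ { c cw≈0 zero → independent (c zero) (≈ᴹ-trans (≈ᴹ-sym (+ᴹ-identityʳ _)) cw≈0) }
    ; spanning    = λ v Pv → let a , v≈aw = spanning v Pv in
        (λ _ → a) , ≈ᴹ-trans v≈aw (≈ᴹ-sym (+ᴹ-identityʳ _))
    }

  spans⇒dimension-1 : ∀ {P Q : Carrierᴹ → Set} → (∃ λ w → Q w × Spans P w) → Linear.HasDimension R M P 1
  spans⇒dimension-1 {P} {Q} ws = let w , _ , basis = spans⇒basis {P} {Q} ws in (λ _ → w) , basis

module _ {G : Group₀} {κ : Ring₀} where
  private module G = Group G
  open CommutativeRing κ hiding (zero)
  open SetoidReasoning setoid

  -- Frobenius reciprocity: these are the invariants of ηψ on H. The hypothesis yields no particular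
  -- h with η(h)ψ(h) ≠ 1, so the case split is on f(1); if that is invertible, it cancels from
  -- η(h)ψ(h)f(1) = f(1) for all h.
  H⁰-twisted-Ind : IsField κ → ∀ (H : Subgroup G) (ψ : Character (Subgroup.group H) κ) (η : Character G κ) →
    ¬ (∀ h → at η (proj₁ h) * at ψ h ≈ 1#) →
    ∀ f → Rep.H⁰ (η ⊗ Ind H ψ) f → Rep._≈ᴹ_ (η ⊗ Ind H ψ) f (Rep.0ᴹ (η ⊗ Ind H ψ))
  H⁰-twisted-Ind isField H ψ η nontrivial (f , f-cong , f-H) invariant =
    λ x → trans (f≈ηf x) (trans (*-congˡ f-ε≈0) (zeroʳ _))
    where
    module η = Character η
    f≈ηf : ∀ x → f x ≈ at η (x G.⁻¹) * f G.ε
    f≈ηf x = sym (trans (*-congˡ (f-cong (G.sym (G.inverseʳ x)))) (invariant (x G.⁻¹) x))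

    f-ε≈0 : f G.ε ≈ 0#
    f-ε≈0 with IsField.zero⊎unit isField (f G.ε)
    ... | inj₁ f≈0 = f≈0
    ... | inj₂ (y , fy≈1) = ⊥-elim (nontrivial λ h → begin
      at η (proj₁ h) * at ψ h                              ≈⟨ *-identityʳ _ ⟨
      (at η (proj₁ h) * at ψ h) * 1#                      ≈⟨ *-congˡ fy≈1 ⟨
      (at η (proj₁ h) * at ψ h) * (f G.ε * y)
        ≈⟨ solve 4 (λ a b c d → (a :* b) :* (c :* d) := (a :* (b :* c)) :* d) refl _ _ _ _ ⟩
      (at η (proj₁ h) * (at ψ h * f G.ε)) * y            ≈⟨ *-congʳ (*-congˡ (f-H h G.ε)) ⟨
      (at η (proj₁ h) * f (proj₁ h G.∙ G.ε)) * y
        ≈⟨ *-congʳ (*-congˡ (f-cong (G.trans (G.identityʳ _) (G.sym (G.identityˡ _))))) ⟩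
      (at η (proj₁ h) * f (G.ε G.∙ proj₁ h)) * y          ≈⟨ *-congʳ (invariant (proj₁ h) G.ε) ⟩
      f G.ε * y                                            ≈⟨ fy≈1 ⟩
      1#                                                    ∎)
      where
      open CommutativeRingProperties κ using (module Solver)
      open Solver

  module LinePlus {V : Rep G κ} (lam : Character G κ) (U : Rep G κ)
                  (H⁰U≈0 : ∀ f → Rep.H⁰ U f → Rep._≈ᴹ_ U f (Rep.0ᴹ U))
                  (Θ : V ≅ (line lam ⊕ U)) where
    private
      module V = Rep V
      module U = Rep U
      module W = Rep (line lam ⊕ U)
      module Θ = ≅-Properties Θ
      to-invariant : ∀ {v} → V.H⁰ v → W.H⁰ (Θ.to v)
      to-invariant {v} inv g = W.≈ᴹ-trans (W.≈ᴹ-sym (Θ.equivariant g v)) (Θ.⟦⟧-cong (inv g))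

    invariants-vanish : ∀ g → (∀ a → at lam g * a ≈ a → a ≈ 0#) → ∀ v → V.H⁰ v → v V.≈ᴹ V.0ᴹ
    invariants-vanish g nontrivial v inv = Θ.injective (W.≈ᴹ-trans
      ( nontrivial (proj₁ (Θ.to v)) (proj₁ (to-invariant inv g))
      , H⁰U≈0 (proj₂ (Θ.to v)) (λ h → proj₂ (to-invariant inv h)) )
      (W.≈ᴹ-sym Θ.0ᴹ-homo))

    module _ (trivial : ∀ g → at lam g ≈ 1#) where
      generator : V.Carrierᴹ
      generator = proj₁ (Θ.surjective (1# , U.0ᴹ))

      to-generator : Θ.to generator W.≈ᴹ (1# , U.0ᴹ)
      to-generator = proj₂ (Θ.surjective (1# , U.0ᴹ)) V.≈ᴹ-refl

      private
        act-0 : ∀ g → U.act g U.0ᴹ U.≈ᴹ U.0ᴹ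
        act-0 g = U.≈ᴹ-trans (U.act-cong G.refl (U.≈ᴹ-sym (U.*ₗ-zeroˡ U.0ᴹ)))
          (U.≈ᴹ-trans (U.act-* g 0# U.0ᴹ) (U.*ₗ-zeroˡ _))

        to-multiple : ∀ a → Θ.to (a V.*ₗ generator) W.≈ᴹ (a , U.0ᴹ)
        to-multiple a = W.≈ᴹ-trans (Θ.*ₗ-homo a generator)
          (W.≈ᴹ-trans (W.*ₗ-congˡ to-generator) (*-identityʳ a , U.*ₗ-zeroʳ a))

      -- Θ sends an invariant of V to a pair whose second component is an invariant of U, hence 0.
      -- So invariants are multiples of the preimage of (1, 0), whichever Θ is given.
      generator-spans : Spans {R = κ} {M = V.space} V.H⁰ generator
      generator-spans = invariant , torsion-free , spanning
        where
        invariant : V.H⁰ generator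
        invariant g = Θ.injective (W.≈ᴹ-trans (Θ.equivariant g generator)
          (W.≈ᴹ-trans (W.act-cong G.refl to-generator)
            (W.≈ᴹ-trans (trans (*-identityʳ _) (trivial g) , act-0 g) (W.≈ᴹ-sym to-generator))))

        torsion-free : ∀ a → a V.*ₗ generator V.≈ᴹ V.0ᴹ → a ≈ 0#
        torsion-free a aw≈0 =
          proj₁ (W.≈ᴹ-trans (W.≈ᴹ-sym (to-multiple a)) (W.≈ᴹ-trans (Θ.⟦⟧-cong aw≈0) Θ.0ᴹ-homo))

        spanning : ∀ v → V.H⁰ v → ∃ λ a → v V.≈ᴹ a V.*ₗ generator
        spanning v inv = proj₁ (Θ.to v) , Θ.injective
          (W.≈ᴹ-trans (refl , H⁰U≈0 (proj₂ (Θ.to v)) (λ h → proj₂ (to-invariant inv h)))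
            (W.≈ᴹ-sym (to-multiple _)))

-- Invariants of the twisted adjoint representation

module AdjointInvariants {G : Group₀} {κ : Ring₀} (κ-field : IsField κ)
  (H : Subgroup G) (φ : Group.Carrier G)
  (normal : ∀ {g} → Subgroup.Member H g →
            Subgroup.Member H (Group._∙_ G (Group._∙_ G (Group._⁻¹ G φ) g) φ))
  (side : ∀ g → Subgroup.Member H g ⊎ Subgroup.Member H (Group._∙_ G g (Group._⁻¹ G φ)))
  (φ∉H : ¬ Subgroup.Member H φ)
  (χ : Character (Subgroup.group H) κ) (ρ : MatRep 2 G κ) (Φ : standard ρ ≅ Ind H χ)
  (regular : ¬ (∀ h → CommutativeRing._≈_ κ (at χ h) (at (conjugateᶜ H φ (λ {g} → normal {g}) χ) h)))
  (θ : Character G κ) (θ-H : ∀ (h : Group.Carrier (Subgroup.group H)) →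
         CommutativeRing._≈_ κ (at θ (proj₁ h)) (CommutativeRing.1# κ))
  (θ-φ : CommutativeRing._≈_ κ (at θ φ) (CommutativeRing.-_ κ (CommutativeRing.1# κ)))
  (η : Character G κ) where
  private
    module G = Group G
    module H = Group (Subgroup.group H)
  open G using (_∙_; _⁻¹)
  open CommutativeRing κ hiding (zero)
  open CommutativeRingProperties κ using (module Solver)
  open SetoidReasoning setoid
  open Solver
  open IndexTwo {G} {κ} H φ (λ {g} → normal {g}) side φ∉H
  open AdjointDecomposition χ ρ Φ using (ψ; χˢ; adjoint-decomposition)

  V U W : Rep G κ
  V = η ⊗ ad⁰ ρ
  U = η ⊗ Ind H ψ
  W = line (η ·ᶜ θ) ⊕ U

  V≅W : V ≅ W
  V≅W = adjoint-decomposition θ θ-H θ-φ η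

  NoInvariants : Set
  NoInvariants = ∀ v → Rep.H⁰ V v → Rep._≈ᴹ_ V v (Rep.0ᴹ V)

  private
    q : Carrier
    q = at η φ

    Nontrivial : Set
    Nontrivial = ¬ (∀ h → at η (proj₁ h) * at ψ h ≈ 1#)

    module LP (nontrivial : Nontrivial) (Θ : V ≅ W) =
      LinePlus {V = V} (η ·ᶜ θ) U (H⁰-twisted-Ind κ-field H ψ η nontrivial) Θ

    vanishing : ¬ 1# + q ≈ 0# → Nontrivial → NoInvariants
    vanishing 1+q≉0 nontrivial =
      LP.invariants-vanish nontrivial V≅W φ λ a -qa≈a → field⇒noZeroDivisors κ κ-field (begin
        (1# + q) * a                  ≈⟨ solve 2 (λ q a → (con 1ℤ :+ q) :* a := a :- (q :* (:- con 1ℤ)) :* a) refl q a ⟩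
        a - (q * - 1#) * a            ≈⟨ +-congˡ (-‿cong (*-congʳ (*-congˡ θ-φ))) ⟨
        a - (q * at θ φ) * a          ≈⟨ +-congˡ (-‿cong -qa≈a) ⟩
        a - a                         ≈⟨ -‿inverseʳ a ⟩
        0#                            ∎) 1+q≉0

    trivial⇒nontrivial : (∀ h → at η (proj₁ h) ≈ 1#) → Nontrivial
    trivial⇒nontrivial η≈1 ηψ≈1 = regular λ h → begin
      at χ h                                     ≈⟨ *-identityʳ _ ⟨
      at χ h * 1#                                ≈⟨ *-congˡ (at-inverse χˢ h) ⟨
      at χ h * (at χˢ h * at χˢ (h H.⁻¹))        ≈⟨ solve 3 (λ a b c → a :* (b :* c) := (con 1ℤ :* (a :* c)) :* b) refl _ _ _ ⟩
      (1# * at ψ h) * at χˢ h                    ≈⟨ *-congʳ (trans (*-congʳ (sym (η≈1 h))) (ηψ≈1 h)) ⟩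
      1# * at χˢ h                               ≈⟨ *-identityˡ _ ⟩
      at χˢ h                                    ∎

    -- ψ is trivial on φ², since conjugation by φ fixes φ².
    q²≉1⇒nontrivial : ¬ q * q ≈ 1# → Nontrivial
    q²≉1⇒nontrivial q²≉1 ηψ≈1 = q²≉1 (begin
      q * q                          ≈⟨ Character.homo η φ φ ⟨
      at η (φ ∙ φ)                   ≈⟨ *-identityʳ _ ⟨
      at η (φ ∙ φ) * 1#              ≈⟨ *-congˡ ψφ²≈1 ⟨
      at η (φ ∙ φ) * at ψ φ²         ≈⟨ ηψ≈1 φ² ⟩
      1#                             ∎)
      where
      φ² : H.Carrier
      φ² = φ ∙ φ , φ²∈H
      φ²-conjugate : φ ∙ φ G.≈ φ ⁻¹ ∙ (φ ∙ φ) ∙ φ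
      φ²-conjugate = G.sym (G.∙-congʳ (G.trans (G.sym (G.assoc (φ ⁻¹) φ φ))
        (G.trans (G.∙-congʳ (G.inverseˡ φ)) (G.identityˡ φ))))
      ψφ²≈1 : at ψ φ² ≈ 1#
      ψφ²≈1 = trans (*-congʳ (Character.⟦⟧-cong χ {φ²} {_ , normal φ²∈H} φ²-conjugate)) (at-inverse χˢ φ²)

    λ-trivial : 1# + q ≈ 0# → (∀ h → at η (proj₁ h) ≈ 1#) → ∀ g → at (η ·ᶜ θ) g ≈ 1#
    λ-trivial 1+q≈0 η≈1 g = on-side (side g)
      where
      module ηθ = Character (η ·ᶜ θ)
      on-H : ∀ h → at (η ·ᶜ θ) (proj₁ h) ≈ 1#
      on-H h = trans (*-cong (η≈1 h) (θ-H h)) (*-identityˡ 1#)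
      at-φ : at (η ·ᶜ θ) φ ≈ 1#
      at-φ = begin
        q * at θ φ                ≈⟨ *-congˡ θ-φ ⟩
        q * - 1#                  ≈⟨ solve 1 (λ q → q :* (:- con 1ℤ) := con 1ℤ :- (con 1ℤ :+ q)) refl q ⟩
        1# - (1# + q)             ≈⟨ +-congˡ (-‿cong 1+q≈0) ⟩
        1# - 0#                   ≈⟨ solve 0 (con 1ℤ :- con 0ℤ := con 1ℤ) refl ⟩
        1#                        ∎
      on-side : Subgroup.Member H g ⊎ Subgroup.Member H (g ∙ φ ⁻¹) → at (η ·ᶜ θ) g ≈ 1#
      on-side (inj₁ m) = on-H (g , m)
      on-side (inj₂ m) = begin
        at (η ·ᶜ θ) g                                 ≈⟨ ηθ.⟦⟧-cong (G.sym gφ⁻¹φ≈g) ⟩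
        at (η ·ᶜ θ) (g ∙ φ ⁻¹ ∙ φ)                    ≈⟨ ηθ.homo (g ∙ φ ⁻¹) φ ⟩
        at (η ·ᶜ θ) (g ∙ φ ⁻¹) * at (η ·ᶜ θ) φ        ≈⟨ *-cong (on-H (_ , m)) at-φ ⟩
        1# * 1#                                       ≈⟨ *-identityˡ 1# ⟩
        1#                                            ∎
        where
        gφ⁻¹φ≈g : g ∙ φ ⁻¹ ∙ φ G.≈ g
        gφ⁻¹φ≈g = G.trans (G.assoc g (φ ⁻¹) φ) (G.trans (G.∙-congˡ (G.inverseˡ φ)) (G.identityʳ g))

  q²≉1⇒no-invariants : ¬ 1# + at η φ ≈ 0# → ¬ at η φ * at η φ ≈ 1# →
    NoInvariants
  q²≉1⇒no-invariants 1+q≉0 q²≉1 = vanishing 1+q≉0 (q²≉1⇒nontrivial q²≉1)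

  trivial⇒no-invariants : ¬ 1# + at η φ ≈ 0# → (∀ h → at η (proj₁ h) ≈ 1#) →
    NoInvariants
  trivial⇒no-invariants 1+q≉0 η≈1 = vanishing 1+q≉0 (trivial⇒nontrivial η≈1)

  line-of-invariants : 1# + at η φ ≈ 0# → (∀ h → at η (proj₁ h) ≈ 1#) → ∀ (Θ : V ≅ W) →
    ∃ λ w → Rep._≈ᴹ_ W (_≅_.to Θ w) (1# , Rep.0ᴹ U) × Spans {R = κ} {M = Rep.space V} (Rep.H⁰ V) w
  line-of-invariants 1+q≈0 η≈1 Θ = generator trivial , to-generator trivial , generator-spans trivial
    where
    open LP (trivial⇒nontrivial η≈1) Θ
    trivial = λ-trivial 1+q≈0 η≈1

-- Inertness of p, and the three congruence cases

open import Data.Nat.Base using (_*_; _^_)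

private
  -- The class of a² + 1 mod 3 has period 3 in a; the values at 0, 1, 2 are 1, 2, 5. So -1 is not a
  -- square mod 3.
  3∤a²+1 : ∀ a → ¬ 3 ∣ a * a ℕ.+ 1
  3∤a²+1 0 = from-no (3 ∣? 1)
  3∤a²+1 1 = from-no (3 ∣? 2)
  3∤a²+1 2 = from-no (3 ∣? 5)
  3∤a²+1 (suc (suc (suc a))) 3∣ = 3∤a²+1 a (∣m+n∣m⇒∣n
    (≡.subst (3 ∣_) (solve 1 (λ a → (con 3 :+ a) :* (con 3 :+ a) :+ con 1
                                 := (con 3 :+ con 2 :* a) :* con 3 :+ (a :* a :+ con 1)) ≡.refl a) 3∣)
    (divides (3 ℕ.+ 2 * a) ≡.refl))
    where open +-*-Solver

  3∤a²-[-1] : ∀ a → ¬ + 3 ∣ℤ + a Int.* + a Int.- -[1+ 0 ]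
  3∤a²-[-1] a rewrite ≡.sym (Int.pos-* a a) = 3∤a²+1 a

-- This is where K/ℚₚ being unramified enters: p is inert in ℚ(√d). A type at p ≥ 5 contains the
-- condition; the types at 3 all have d = -1.
unramified⇒nonsquare : ∀ {p d c r b} → UnramifiedType p d c r b → ∀ a → ¬ + p ∣ℤ + a Int.* + a Int.- d
unramified⇒nonsquare (tame _ _ nonsquare _ _) a = nonsquare (+ a)
unramified⇒nonsquare (tame₃ ≡.refl)  = 3∤a²-[-1]
unramified⇒nonsquare (wild₃ ≡.refl)  = 3∤a²-[-1]
unramified⇒nonsquare (wild₃′ ≡.refl) = 3∤a²-[-1]

proposition5p3 :
  ∀ (Q̄ : AlgebraicClosureOfℚ)
    (E : WeierstrassEquation) (N : ℕ) (f : ℕ → ℤ) (p ℓ : ℕ)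
    (κ : Ring₀) (O : IntegerRing κ)
    (ρ : MatRep 2 (Gℚ Q̄) (IntegerRing.Λ O)) (ρ̄ : MatRep 2 (Gℚ Q̄) κ)
    (S : List ℕ) →
  Prime p → 3 ≤ p → Prime ℓ → 5 ≤ ℓ → p ≢ ℓ → p ^ 2 ∣ N → ¬ ℓ ∣ N →
  IsField κ → IsFinite κ → CommutativeRing._≈_ κ (fromℕ κ ℓ) (CommutativeRing.0# κ) →
  IsMinimalModel E → IsConductor E ℓ ρ̄ N → IsNewform E N f → ¬ + ℓ ∣ℤ f ℓ →
  All Prime S → (∀ q → Prime q → q ∣ N * ℓ → q ∈ S) →
  IsAttached O ℓ N f ρ → IsReduction O ρ ρ̄ →
  (∀ q → Prime q → q ∉ S → UnramifiedAt ρ̄ q) →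
  IsContinuous ρ̄ → IsOdd ρ̄ → IsAbsolutelyIrreducible ρ̄ →
  Reduction E p 2 → PotentiallyGood E p →
  ∀ (𝔓 : Place Q̄ p) →
  let open Place 𝔓 in
  ∀ (σ : Automorphism Q̄) (frob : IsFrobenius σ) →
  let Frob : Group.Carrier Gₚ
      Frob = σ , proj₁ frob in
  ∀ (sc : UnramifiedSupercuspidal 𝔓 O ρ ρ̄) →
  let open UnramifiedSupercuspidal sc in
  IsRegular Frob →
  ∀ (ε̄ℓ : Character (Gℚ Q̄) κ) → IsModCyclotomic Q̄ ℓ ε̄ℓ →
  ∀ (εK : Character Gₚ κ) → IsQuadraticCharacter √d εK →
  let ε̄ = resᶜ decomposition ε̄ℓ
      V = ε̄ ⊗ ad⁰ (resᵐ decomposition ρ̄)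
      W = line (ε̄ ·ᶜ εK) ⊕ (ε̄ ⊗ Ind G-K (ψ̄ Frob))
      module V = Rep V
      module W = Rep W
      open Linear κ in
    (¬ ℓ ∣ p ∸ 1 → ¬ ℓ ∣ suc p → HasDimension V.space V.H⁰ 0)
  × (ℓ ∣ suc p →
        HasDimension V.space V.H⁰ 1
      × (V ≅ W)
      × (∀ (Θ : V ≅ W) → ∃ λ w →
            (_≅_.to Θ w W.≈ᴹ (CommutativeRing.1# κ , Rep.0ᴹ (ε̄ ⊗ Ind G-K (ψ̄ Frob))))
          × IsBasis V.space V.H⁰ {1} (λ _ → w)))
  × (ℓ ∣ p ∸ 1 → HasDimension V.space V.H⁰ 0)
proposition5p3 Q̄ E N f p ℓ κ O ρ ρ̄ S p-prime 3≤p ℓ-prime 5≤ℓ p≢ℓ _ _ κ-field _ ℓ≈0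
  _ _ _ _ _ _ _ _ _ _ _ _ _ _ 𝔓 σ frob sc regular ε̄ℓ ε̄ℓ-cyclotomic εK εK-quadratic =
    -- With a basis indexed by `Fin 0`, spanning asks that every invariant equal the empty
    -- combination, which is 0.
    (λ p≢1 p≢-1 → (λ ()) , record
      { members     = λ ()
      ; independent = λ _ _ ()
      ; spanning    = λ v inv → (λ ()) , q²≉1⇒no-invariants (1+q≉0 p≢-1) (q²≉1 p≢1 p≢-1) v inv
      })
  , (λ p≡-1 →
        spans⇒dimension-1 (line-of-invariants (1+q≈0 p≡-1) (p≡-1⇒η-trivial p≡-1) V≅W)
      , (let module Θ₀ = ≅-Properties V≅W in
          mk≅ Θ₀.to (λ {v} {w} → Θ₀.⟦⟧-cong {v} {w}) Θ₀.+ᴹ-homo Θ₀.0ᴹ-homo Θ₀.-ᴹ-homo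
            Θ₀.*ₗ-homo (λ {v} {w} → Θ₀.injective {v} {w}) Θ₀.surjective (λ g v {v′} → Θ₀.equivariant-≈ g v {v′}))
      , λ Θ →
          let module Θ = ≅-Properties Θ in
          spans⇒basis (line-of-invariants (1+q≈0 p≡-1) (p≡-1⇒η-trivial p≡-1)
            (mk≅ Θ.to (λ {v} {w} → Θ.⟦⟧-cong {v} {w}) Θ.+ᴹ-homo Θ.0ᴹ-homo Θ.-ᴹ-homo
              Θ.*ₗ-homo (λ {v} {w} → Θ.injective {v} {w}) Θ.surjective
              (λ g v {v′} → Θ.equivariant-≈ g v {v′}))))
  , (λ p≡1 → (λ ()) , record
      { members     = λ ()
      ; independent = λ _ _ ()
      ; spanning    = λ v inv → (λ ()) , trivial⇒no-invariants (1+q≉0 (p≡1⇒p≢-1 p≡1))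
                                           (λ h → p≡1⇒ε-trivial p≡1 (proj₁ h)) v inv
      })
  where
  open Place 𝔓 using (Gₚ; decomposition)
  open UnramifiedSupercuspidal sc
  open Frobenius 𝔓 p-prime {σ} frob
  nonsquare : ∀ a → ¬ + p ∣ℤ + a Int.* + a Int.- d
  nonsquare = unramified⇒nonsquare type
  open QuadraticExtension d nonsquare √d-square
  open Cyclotomic ℓ-prime p≢ℓ κ ℓ≈0 ε̄ℓ ε̄ℓ-cyclotomic
  open CommutativeRing κ renaming (_*_ to _·_) hiding (zero)
  open CommutativeRingProperties κ
  open PrimeCharacteristic κ (IsField.1≉0 κ-field) ℓ-prime ℓ≈0
  open SetoidReasoning setoid

  module Φ = ≅-Properties ρ̄-induced

  -- Here and in the result, isomorphisms and bases are repacked field by field: this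
  -- keeps Agda from comparing whole representations, whose axioms are large terms.
  open AdjointInvariants {Gₚ} {κ} κ-field G-K φ
    (λ {g} → stabiliser-normal Q̄ {d = d} 𝔓 √d-square φ {g}) side φ-moves-√d
    χ̄ (resᵐ decomposition ρ̄)
    (mk≅ Φ.to (λ {v} {w} → Φ.⟦⟧-cong {v} {w}) Φ.+ᴹ-homo Φ.0ᴹ-homo Φ.-ᴹ-homo
      Φ.*ₗ-homo (λ {v} {w} → Φ.injective {v} {w}) Φ.surjective (λ g v {v′} → Φ.equivariant-≈ g v {v′}))
    regular
    εK (λ h → proj₁ (εK-quadratic (proj₁ h)) (proj₂ h)) (proj₂ (εK-quadratic φ) φ-negates-√d)
    (resᶜ decomposition ε̄ℓ)

  q : Carrier
  q = at ε̄ℓ σ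

  1+q≈0 : ℓ ∣ suc p → 1# + q ≈ 0#
  1+q≈0 p≡-1 = trans (+-congˡ ε-φ) (∣⇒fromℕ≈0 p≡-1)

  p≡-1⇒η-trivial : ℓ ∣ suc p → ∀ (h : Group.Carrier (Subgroup.group G-K)) → at ε̄ℓ (proj₁ (proj₁ h)) ≈ 1#
  p≡-1⇒η-trivial p≡-1 h = p≡-1⇒ε-trivial 3≤p d nonsquare √d-square p≡-1 (proj₁ h) (proj₂ h)

  1+q≉0 : ¬ ℓ ∣ suc p → ¬ 1# + q ≈ 0#
  1+q≉0 p≢-1 e = p≢-1 (fromℕ≈0⇒∣ (suc p) (trans (+-congˡ (sym ε-φ)) e))

  q²≉1 : ¬ ℓ ∣ p ∸ 1 → ¬ ℓ ∣ suc p → ¬ q · q ≈ 1#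
  -- As q is the image of p, (1 + q)(p - 1) = q² - 1. The second factor is kept as the image of a
  -- natural number, so that its vanishing becomes ℓ ∣ p - 1.
  q²≉1 p≢1 p≢-1 q²≈1 = p≢1 (fromℕ≈0⇒∣ (p ∸ 1) (field⇒noZeroDivisors κ κ-field (begin
    (1# + q) · ⌜ p ∸ 1 ⌝                      ≈⟨ *-congʳ (+-congˡ q≈1+p-1) ⟩
    (1# + (1# + ⌜ p ∸ 1 ⌝)) · ⌜ p ∸ 1 ⌝       ≈⟨ solve 1 (λ q → (con 1ℤ :+ (con 1ℤ :+ q)) :* q
                                                    := (con 1ℤ :+ q) :* (con 1ℤ :+ q) :- con 1ℤ) refl ⌜ p ∸ 1 ⌝ ⟩
    (1# + ⌜ p ∸ 1 ⌝) · (1# + ⌜ p ∸ 1 ⌝) - 1#  ≈⟨ +-congʳ (*-cong q≈1+p-1 q≈1+p-1) ⟨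
    q · q - 1#                                ≈⟨ +-congʳ q²≈1 ⟩
    1# - 1#                                   ≈⟨ -‿inverseʳ 1# ⟩
    0#                                        ∎) (1+q≉0 p≢-1)))
    where
    open Solver
    q≈1+p-1 : q ≈ 1# + ⌜ p ∸ 1 ⌝
    q≈1+p-1 = trans ε-φ (reflexive (≡.cong ⌜_⌝ (≡.sym (ℕ.m+[n∸m]≡n (ℕ.≤-trans (ℕ.s≤s ℕ.z≤n) 3≤p)))))

  p≡1⇒p≢-1 : ℓ ∣ p ∸ 1 → ¬ ℓ ∣ suc p
  -- From p + 1 = (p - 1) + 2 it would follow that ℓ divides 2, against ℓ ≥ 5.
  p≡1⇒p≢-1 ℓ∣p-1 ℓ∣1+p = ℕ.<⇒≱ (ℕ.≤-trans (ℕ.s≤s (ℕ.s≤s (ℕ.s≤s ℕ.z≤n))) 5≤ℓ)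
    (∣⇒≤ (∣m+n∣m⇒∣n {m = p ∸ 1} {n = 2} (≡.subst (ℓ ∣_) 1+p≡p-1+2 ℓ∣1+p) ℓ∣p-1))
    where
    1+p≡p-1+2 : suc p ≡ p ∸ 1 ℕ.+ 2
    1+p≡p-1+2 = ≡.trans (≡.cong suc (≡.sym (ℕ.m∸n+n≡m (ℕ.≤-trans (ℕ.s≤s ℕ.z≤n) 3≤p)))) (≡.sym (ℕ.+-suc (p ∸ 1) 1))
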